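{- Fix some $\epsilon$, $0<\epsilon<1$. In the mobile telephone model with tag length $b=1$ and any stability factor $\tau\ge1$, and with shared randomness available to all nodes, the SharedBit gossip algorithm solves the $\epsilon$-gossip problem in $$O\left(\frac{n\sqrt{\Delta\log\Delta}}{(1-\epsilon)\alpha}\right)$$ rounds, where $n$ is the network size and $\alpha$ and $\Delta$ are the vertex expansion and maximum degree of the dynamic graph.
   Context: Mobile telephone model. Time proceeds in synchronous rounds $1,2,\dots$, and all nodes start in round 1. The topology is a dynamic graph $G_1,G_2,\dots$ fixed before the execution begins, where each $G_r=(V,E_r)$ is a connected undirected graph on the same node set $V$, $|V|=n>1$. Stability factor $\tau\ge1$: at least $\tau$ rounds pass between any two changes of the topology ($\tau=1$: it may change arbitrarily every round; $\tau=\infty$: it never changes). At the beginning of round $r$ each node selects a tag of $b$ bits to advertise, then learns its neighbor set in $G_r$ and the tags of its neighbors. Each node may then send a connection proposal to at most one neighbor. A node that sends a proposal cannot receive one; a node that does not send a proposal and receives at least one proposal accepts one chosen uniformly at random among those received. A proposer and acceptor are then connected for the round and may exchange at most $O(1)$ tokens and $O(\mathrm{polylog}(N))$ additional bits. Graph parameters. For a graph $G=(V,E)$ and $S\subseteq V$ nonempty, $\partial S$ is the set of nodes in $V\setminus S$ with a neighbor in $S$, and $\alpha(G)=\min_{S\subset V,\,0<|S|\le n/2}|\partial S|/|S|$. For a dynamic graph, $\alpha=\min_i\alpha(G_i)$ and $\Delta$ is the largest maximum degree of any $G_i$. $\epsilon$-gossip problem. Each node knows an upper bound $N\ge n$ and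 has a unique ID in $[N]=\{1,\dots,N\}$. Every one of the $n$ nodes starts with its own token, labelled by its ID; tokens are black boxes that can only be passed through connections. $T_u(r)$ is the set of tokens known by $u$ at the beginning of round $r$. $\epsilon$-gossip is solved once there is a set $S\subseteq V$ with $|S|\ge\epsilon n$ such that for all $u,v\in S$, $u$ knows $v$'s token and $v$ knows $u$'s token. An algorithm solves $\epsilon$-gossip in $f$ rounds if this holds by round $f$ with probability at least $1-1/n$. $O(\cdot)$ is asymptotic (as $n\to\infty$) with universal constants. Transfer$(\varepsilon)$ subroutine. Run by two connected nodes $u,v$ with token sets $T_u,T_v$ (using fresh private randomness); if $T_u\ne T_v$, then with probability at least $1-\varepsilon$ the smallest token in $(T_u\cup T_v)\setminus(T_u\cap T_v)$ is transferred by the node that knows it to the node that does not. In all cases nodes only gain tokens that the other node knows. SharedBit. All nodes have access to a common uniformly random bit string $\hat r$ of length $cN^3(\lceil\log N\rceil+1)$, partitioned into $cN^2$ groups labelled $1,\dots,cN^2$, each consisting of $N$ bundles labelled $1,\dots,N$ of $\lceil\log N\rceil+1$ bits each. In round $r\le cN^2$, for each token $t\in T_u(r)$ let $t.\mathrm{bit}$ be the first bit of bundle $t$ of group $r$. Node $u$ advertises $b_u(r)=\left(\sum_{t\in T_u(r)}t.\mathrm{bit}\right)\bmod 2$. If $b_u(r)=0$, $u$ sends no proposal and waits to receive proposals. If $b_u(r)=1$ and $u$ has at least one neighbor advertising $0$, then $u$ chooses one of these neighbors uniformly at random (the choice being made with the remaining $\lceil\log N\rceil$ bits of the bundle of group $r$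 labelled by $u$'s ID, and treated as uniform) and sends it a proposal. Two nodes that connect run Transfer$(n^{ -c_t})$. Here $c,c_t\ge1$ are sufficiently large constants. After round $cN^2$ the behavior is arbitrary.
   Formalization: The outcome probabilities of the Transfer subroutine, and of the arbitrary behavior after round cN², are taken to be rational (with finite support) instead of arbitrary reals. -}

module Defs where

open import Data.Bool using (Bool; true; false; not; _∧_; if_then_else_; T)
open import Data.Fin as Fin using (Fin; zero; suc; fromℕ<; combine)
open import Data.Fin.Properties using () renaming (_≟_ to _≟F_)
open import Data.Fin.Subset using (Subset; _∈_; _⊆_; _∪_; _∩_; _─_; ⁅_⁆; ∣_∣)
open import Data.Fin.Subset.Properties using (_∈?_)
open import Data.Integer using (+_)
open import Data.List using (List; []; _∷_; map; concatMap; length; filter; filterᵇ; mapMaybe; allFin)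
open import Data.List.Relation.Unary.All using (All)
open import Data.Maybe using (Maybe; just; nothing)
open import Data.Maybe.Properties using (≡-dec)
open import Data.Nat as ℕ using (ℕ; zero; suc; _%_; _≡ᵇ_; _^_)
open import Data.Nat.Logarithm using (⌈log₂_⌉)
open import Data.Product using (Σ; ∃; ∃₂; ∃-syntax; _×_; _,_; proj₁; proj₂)
open import Data.Rational using (ℚ; 0ℚ; 1ℚ; _+_; _*_; _-_; _≤_; _<_; _/_)
open import Data.Sum using (_⊎_)
open import Data.Vec as Vec using (Vec; []; _∷_; lookup; tabulate; _[_]≔_)
open import Relation.Binary.Construct.Closure.ReflexiveTransitive using (Star)
open import Relation.Binary.PropositionalEquality using (_≡_)
open import Relation.Nullary using (¬_; yes; no)

-- m // 0 is set to 0; only positive denominators are ever used.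
infixl 7 _//_
_//_ : ℕ → ℕ → ℚ
m // zero  = 0ℚ
m // suc k = + m / suc k

fromℕ : ℕ → ℚ
fromℕ m = m // 1

-- Dedekind reals: lower q is "q < x" and upper q is "x < q".
record ℝ : Set₁ where
  field
    lower upper    : ℚ → Set
    lower-nonempty : ∃ lower
    upper-nonempty : ∃ upper
    lower-closed   : ∀ {p q} → p < q → lower q → lower p
    lower-open     : ∀ {p} → lower p → ∃[ q ] (p < q × lower q)
    upper-closed   : ∀ {p q} → p < q → upper p → upper q
    upper-open     : ∀ {q} → upper q → ∃[ p ] (p < q × upper p)
    disjoint       : ∀ {q} → ¬ (lower q × upper q)
    located        : ∀ {p q} → p < q → lower p ⊎ upper q

infix 4 _<ᴿ_ _ᴿ<_ _ᴿ≤_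

_<ᴿ_ : ℚ → ℝ → Set
q <ᴿ x = ℝ.lower x q

_ᴿ<_ : ℝ → ℚ → Set
x ᴿ< q = ℝ.upper x q

_ᴿ≤_ : ℝ → ℚ → Set
x ᴿ≤ q = ∀ p → p <ᴿ x → p ≤ q

-- log₂ Δ ≤ ℓ for rational ℓ = a/b ≥ 0, that is, Δᵇ ≤ 2ᵃ.
Log₂≤ : ℕ → ℚ → Set
Log₂≤ Δ ℓ = ∃₂ λ a b → ℓ ≡ a // suc b × Δ ^ suc b ℕ.≤ 2 ^ a

Sqrt≤ : ℚ → ℚ → Set
Sqrt≤ x s = 0ℚ ≤ s × x ≤ s * s

-- C · n √(Δ log₂ Δ) / ((1 - ε) α) ≤ R.  The three possibly irrational
-- quantities ε, log₂ Δ and √(Δ log₂ Δ) enter through rational upper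
-- bounds; every R strictly above the real-valued expression admits such
-- bounds (n, Δ ≥ 2 and α > 0), and every R that admits them is at least
-- that expression.
BoundedBy : (C n Δ : ℕ) (α : ℚ) (ε : ℝ) (R : ℕ) → Set
BoundedBy C n Δ α ε R =
  ∃[ q ] ∃[ ℓ ] ∃[ s ]
    (ε ᴿ≤ q × q < 1ℚ × Log₂≤ Δ ℓ × Sqrt≤ (fromℕ Δ * ℓ) s
      × fromℕ C * fromℕ n * s ≤ fromℕ R * ((1ℚ - q) * α))

-- A list of (weight, outcome) pairs; an outcome may be listed repeatedly.
Dist : Set → Set
Dist A = List (ℚ × A)

total : ∀ {A : Set} → Dist A → ℚ
total []            = 0ℚ
total ((w , _) ∷ d) = w + total d

record IsProbability {A : Set} (d : Dist A) : Set where
  field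
    positive : All (λ wx → 0ℚ < proj₁ wx) d
    total≡1  : total d ≡ 1ℚ

return : ∀ {A : Set} → A → Dist A
return x = (1ℚ , x) ∷ []

infixl 1 _>>=_
_>>=_ : ∀ {A B : Set} → Dist A → (A → Dist B) → Dist B
d >>= f = concatMap (λ { (w , x) → map (λ { (w′ , y) → w * w′ , y }) (f x) }) d

uniform : ∀ {A : Set} → List A → Dist A
uniform xs = map (λ x → 1 // length xs , x) xs

uniformMaybe : ∀ {A : Set} → List A → Dist (Maybe A)
uniformMaybe []         = return nothing
uniformMaybe xs@(_ ∷ _) = uniform (map just xs)

independent : ∀ {A : Set} {m} → (Fin m → Dist A) → Dist (Vec A m)
independent {m = zero}  d = return []
independent {m = suc m} d =
  d zero >>= λ x → independent (λ i → d (suc i)) >>= λ xs → return (x ∷ xs)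

Surely : ∀ {A : Set} → Dist A → (A → Set) → Set
Surely d P = All (λ wx → P (proj₂ wx)) d

-- Pr[E] ≥ p.  Since E need not be decidable (it may compare a cardinality
-- with a real number), the probability is that of a decidable event
-- contained in E; for decidable E this is the usual meaning.
ProbAtLeast : ∀ {A : Set} → ℚ → Dist A → (A → Set) → Set
ProbAtLeast {A} p d E =
  Σ (A → Bool) λ e →
    (∀ x → T (e x) → E x) × p ≤ total (filterᵇ (λ wx → e (proj₂ wx)) d)

record Graph (n : ℕ) : Set where
  field
    adj         : Fin n → Fin n → Bool
    symmetric   : ∀ u v → adj u v ≡ adj v u
    irreflexive : ∀ u → adj u u ≡ false

open Graph public

neighbors : ∀ {n} → Graph n → Fin n → List (Fin n)
neighbors G u = filterᵇ (adj G u) (allFin _)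

degree : ∀ {n} → Graph n → Fin n → ℕ
degree G u = length (neighbors G u)

Connected : ∀ {n} → Graph n → Set
Connected G = ∀ u v → Star (λ x y → T (adj G x y)) u v

boundary : ∀ {n} → Graph n → Subset n → Subset n
boundary G S = tabulate λ v →
  not (lookup S v) ∧ not (length (filter (_∈? S) (neighbors G v)) ≡ᵇ 0)

expansionRatio : ∀ {n} → Graph n → Subset n → ℚ
expansionRatio G S = ∣ boundary G S ∣ // ∣ S ∣

Admissible : ∀ {n} → Subset n → Set
Admissible {n} S = 0 ℕ.< ∣ S ∣ × 2 ℕ.* ∣ S ∣ ℕ.≤ n

IsExpansion : ∀ {n} → Graph n → ℚ → Set
IsExpansion G α =
    (∃[ S ] (Admissible S × expansionRatio G S ≡ α))
  × (∀ S → Admissible S → α ≤ expansionRatio G S)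

-- The graph at index i is the topology of round i + 1.
DynamicGraph : ℕ → Set
DynamicGraph n = ℕ → Graph n

IsDynamicExpansion : ∀ {n} → DynamicGraph n → ℚ → Set
IsDynamicExpansion 𝒢 α =
    (∃[ i ] IsExpansion (𝒢 i) α)
  × (∀ i β → IsExpansion (𝒢 i) β → α ≤ β)

IsMaxDegree : ∀ {n} → DynamicGraph n → ℕ → Set
IsMaxDegree 𝒢 Δ =
    (∃₂ λ i u → degree (𝒢 i) u ≡ Δ)
  × (∀ i u → degree (𝒢 i) u ℕ.≤ Δ)

Unchanged : ∀ {n} → DynamicGraph n → ℕ → Set
Unchanged 𝒢 i = ∀ u v → adj (𝒢 i) u v ≡ adj (𝒢 (suc i)) u v

data StabilityFactor : Set where
  finite : (τ : ℕ) → 1 ℕ.≤ τ → StabilityFactor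
  ∞      : StabilityFactor

Stable : ∀ {n} → StabilityFactor → DynamicGraph n → Set
Stable (finite τ _) 𝒢 =
  ∀ i j → i ℕ.< j → ¬ Unchanged 𝒢 i → ¬ Unchanged 𝒢 j → i ℕ.+ τ ℕ.≤ j
Stable ∞            𝒢 = ∀ i → Unchanged 𝒢 i

-- IDs, and the tokens labelled by them, are elements of Fin N.
TokenSet : ℕ → Set
TokenSet N = Subset N

State : (n N : ℕ) → Set
State n N = Vec (TokenSet N) n

initial : ∀ {n N} → (Fin n → Fin N) → State n N
initial ident = tabulate λ u → ⁅ ident u ⁆

Solved : ∀ {n N} → ℝ → (Fin n → Fin N) → State n N → Set
Solved {n} ε ident st =
  ∃[ S ] (ε·n≤ ∣ S ∣
    × (∀ u v → u ∈ S → v ∈ S →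
         ident v ∈ lookup st u × ident u ∈ lookup st v))
  where
  ε·n≤_ : ℕ → Set
  ε·n≤ m = ∀ q → q <ᴿ ε → q * fromℕ n ≤ fromℕ m

symmetricDifference : ∀ {N} → TokenSet N → TokenSet N → TokenSet N
symmetricDifference A B = (A ∪ B) ─ (A ∩ B)

IsSmallest : ∀ {N} → Fin N → TokenSet N → Set
IsSmallest t A = t ∈ A × (∀ t′ → t′ ∈ A → t Fin.≤ t′)

-- Any subroutine with failure probability at most δ; run A B is the joint
-- law of the token sets of the two nodes afterwards.
record Transfer (N : ℕ) (δ : ℚ) : Set where
  field
    run           : TokenSet N → TokenSet N → Dist (TokenSet N × TokenSet N)
    isProbability : ∀ A B → IsProbability (run A B)
    onlyGains     : ∀ A B → Surely (run A B) λ { (A′ , B′) →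
                      (A ⊆ A′ × A′ ⊆ A ∪ B) × (B ⊆ B′ × B′ ⊆ A ∪ B) }
    succeeds      : ∀ A B t → IsSmallest t (symmetricDifference A B) →
                    ProbAtLeast (1ℚ - δ) (run A B) λ { (A′ , B′) →
                      t ∈ A′ × t ∈ B′ }

-- lookup p u is the neighbor to which u proposes, if any.
Proposals : ℕ → Set
Proposals n = Vec (Maybe (Fin n)) n

proposersTo : ∀ {n} → Proposals n → Fin n → List (Fin n)
proposersTo p v = filter (λ u → ≡-dec _≟F_ (lookup p u) (just v)) (allFin _)

accept : ∀ {n} → Proposals n → Fin n → Dist (Maybe (Fin n))
accept p v with lookup p v
... | just _  = return nothing
... | nothing = uniformMaybe (proposersTo p v)

-- The (proposer , acceptor) pairs.
connectionsOf : ∀ {n} → Vec (Maybe (Fin n)) n → List (Fin n × Fin n)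
connectionsOf {n} acc = mapMaybe pair (allFin _)
  where
  pair : Fin n → Maybe (Fin n × Fin n)
  pair v with lookup acc v
  ... | just u  = just (u , v)
  ... | nothing = nothing

-- Connections are pairwise disjoint, so the processing order is immaterial.
exchange : ∀ {n N δ} → Transfer N δ → List (Fin n × Fin n) → State n N →
           Dist (State n N)
exchange tr []             st = return st
exchange tr ((u , v) ∷ cs) st =
  Transfer.run tr (lookup st u) (lookup st v) >>= λ { (A , B) →
  exchange tr cs ((st [ u ]≔ A) [ v ]≔ B) }

groups : (c N : ℕ) → ℕ
groups c N = c ℕ.* (N ℕ.* N)

bundleSize : ℕ → ℕ
bundleSize N = suc ⌈log₂ N ⌉

SharedString : (c N : ℕ) → Set
SharedString c N = Vec Bool (groups c N ℕ.* N ℕ.* bundleSize N)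

sharedString : ∀ c N → Dist (SharedString c N)
sharedString c N = independent λ _ → uniform (false ∷ true ∷ [])

tokenBit : ∀ {c N} → SharedString c N → Fin (groups c N) → Fin N → Bool
tokenBit r̂ g t = lookup r̂ (combine (combine g t) zero)

advertise : ∀ {N} → (Fin N → Bool) → TokenSet N → Bool
advertise {N} bit A = (Vec.sum (tabulate summand) % 2) ≡ᵇ 1
  where
  summand : Fin N → ℕ
  summand t = if lookup A t ∧ bit t then 1 else 0

-- The choice is a fresh uniform one, rather than being read off the
-- remaining ⌈log N⌉ bits of the bundle of u's ID.
propose : ∀ {n} → Graph n → (Fin n → Bool) → Fin n → Dist (Maybe (Fin n))
propose G b u =
  if b u then uniformMaybe (filterᵇ (λ v → not (b v)) (neighbors G u))
         else return nothing

sharedBitRound : ∀ {n N δ} → Graph n → Transfer N δ → (Fin N → Bool) →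
                 State n N → Dist (State n N)
sharedBitRound G tr bit st =
  independent (propose G (λ u → advertise bit (lookup st u))) >>= λ p →
  independent (accept p) >>= λ acc →
  exchange tr (connectionsOf acc) st

-- Token sets at the beginnings of rounds 1, …, m, most recent first.
History : (n N m : ℕ) → Set
History n N m = Vec (State n N) m

-- Behavior after the shared string is exhausted: it may be randomized and
-- depend on the string and the whole history.
record LateBehavior (c n N : ℕ) : Set where
  field
    next          : SharedString c N → ∀ {m} → History n N (suc m) →
                    Dist (State n N)
    isProbability : ∀ r̂ {m} (h : History n N (suc m)) →
                    IsProbability (next r̂ h)

module _ {n N c : ℕ} {δ : ℚ} (ident : Fin n → Fin N) (𝒢 : DynamicGraph n)
         (tr : Transfer N δ) (late : LateBehavior c n N) where

  -- Index i stands for round i + 1, in which group i + 1 is used.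
  step : SharedString c N → (i : ℕ) → History n N (suc i) → Dist (State n N)
  step r̂ i h with i ℕ.<? groups c N
  ... | yes i<g = sharedBitRound (𝒢 i) tr (tokenBit {c} r̂ (fromℕ< i<g)) (Vec.head h)
  ... | no  _   = LateBehavior.next late r̂ h

  executionWith : SharedString c N → (m : ℕ) → Dist (History n N m)
  executionWith r̂ zero          = return []
  executionWith r̂ (suc zero)    = return (initial ident ∷ [])
  executionWith r̂ (suc (suc i)) =
    executionWith r̂ (suc i) >>= λ h →
    step r̂ i h >>= λ st →
    return (st ∷ h)

  execution : (m : ℕ) → Dist (History n N m)
  execution m = sharedString c N >>= λ r̂ → executionWith r̂ m

{-# OPTIONS --safe #-}
module Submission where

-- Let Φ ≤ n² count the pairs (u , w) such that u knows the token of w, and weigh a state by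
-- a^Φ with a = 1 − 1/(2n).  A connection joins nodes with different token sets, so it multiplies
-- the expected weight by at most 1 − 1/(4n), and a round with H expected connections multiplies
-- it by at most 1 − H/(8n).
--
-- Given the advertised bits, let U and W be the sets of nodes advertising 1 and 0, and let s ≥ √Δ.
-- The nodes of U with more than s neighbors in W, and the neighbors in W of the other nodes of U,
-- form a vertex cover of the edges between U and W of size at most 3sH.  Removing it from the
-- smaller of U and W leaves a set whose boundary lies in the cover, so
-- α |U| |W| / n ≤ α min(|U|, |W|) ≤ 9sH.  Nodes with different token sets advertise different bits
-- with probability ½; hence E |U| |W| ≥ (1 − q) n² / 4 as long as no qn nodes have equal token sets,
-- and then 36 s E H ≥ α (1 − q) n.  After R rounds the expected weight of the unsolved
-- executions is at most (1 + 6n/R)^(−(R−1)) ≤ 4⁻ⁿ, whereas a^Φ ≥ 2⁻ⁿ.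
--
-- If R exceeds the number c N² of groups, the same argument is applied to the first c N² rounds
-- with q = 1: some edge joins different token sets unless all are equal, hence E H ≥ ½.

open import Defs
open import Algebra.Bundles using (CommutativeRing)
open import Data.Bool using (Bool; true; false; not; _∧_; _∨_; _xor_; if_then_else_; T)
import Data.Bool.Properties as Boolₚ
open import Data.Bool.Properties using (T?)
open import Data.Fin as Fin using (Fin; zero; suc)
import Data.Fin.Properties as Finₚ
open import Data.Fin.Properties using (all?; any?) renaming (_≟_ to _≟F_)
open import Data.Fin.Subset as Subset using (Subset; _∈_; _⊆_; _∪_; ∁; ⁅_⁆; ∣_∣)
import Data.Fin.Subset.Properties as Subₚ
import Data.Integer as ℤ
import Data.Integer.Properties as ℤₚ
open import Data.List as List using (List; []; _∷_; _++_; map; length; filter; filterᵇ; mapMaybe; allFin)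
import Data.List.Extrema as Extrema
import Data.List.Membership.Propositional as L
import Data.List.Membership.Propositional.Properties as L
open import Data.List.Properties using (length-tabulate)
open import Data.List.Relation.Unary.All as All using (All; []; _∷_)
import Data.List.Relation.Unary.All.Properties as All
open import Data.List.Relation.Unary.AllPairs using (AllPairs; []; _∷_)
open import Data.List.Relation.Unary.Any using (here)
open import Data.List.Relation.Unary.Unique.Propositional.Properties using (allFin⁺)
open import Data.Maybe using (Maybe; just; nothing)
open import Data.Maybe.Properties using (≡-dec; just-injective)
open import Data.Nat as ℕ using (ℕ; zero; suc)
import Data.Nat.DivMod as DivMod
open import Data.Nat.Logarithm using (⌈log₂_⌉)
import Data.Nat.Properties as ℕₚ
open import Data.Product using (Σ; ∃; ∃₂; ∃-syntax; _×_; _,_; proj₁; proj₂)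
open import Data.Rational as ℚ using (ℚ; 0ℚ; 1ℚ; ½; _+_; _*_; _-_; -_; _≤_; _<_; nonNegative; positive; toℚᵘ)
open import Data.Rational.Properties as ℚₚ using (≤-refl; ≤-trans; ≤-reflexive; module ≤-Reasoning)
import Data.Rational.Unnormalised as ℚᵘ
import Data.Rational.Unnormalised.Properties as ℚᵘₚ
open import Data.Sum using (_⊎_; inj₁; inj₂; [_,_]′)
open import Data.Unit using (⊤; tt)
open import Data.Vec as Vec using (Vec; []; _∷_; lookup; tabulate; _[_]≔_)
import Data.Vec.Properties as Vecₚ
open import Data.Vec.Relation.Unary.Any as AnyV using (Any)
open import Function using (_∘_; id)
open import Function.Definitions using (Injective)
open import Level using (0ℓ)
open import Relation.Binary.Bundles using (DecTotalOrder)
open import Relation.Binary.Construct.Closure.ReflexiveTransitive using (Star; _◅_) renaming (ε to stop)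
open import Relation.Binary.PropositionalEquality using (_≡_; _≢_; refl; sym; trans; cong; cong₂; subst; subst₂; module ≡-Reasoning)
open import Relation.Nullary using (¬_; Dec; yes; no; does; contradiction)
open import Relation.Nullary.Decidable using (dec-true; dec-false; _×-dec_)
open import Tactic.RingSolver using (solve-∀)
open import Tactic.RingSolver.Core.AlmostCommutativeRing using (AlmostCommutativeRing; fromCommutativeRing)

ℚring : AlmostCommutativeRing 0ℓ 0ℓ
ℚring = fromCommutativeRing ℚₚ.+-*-commutativeRing λ x → isZero (0ℚ ℚₚ.≟ x)
  where
  isZero : ∀ {P : Set} → Dec P → Maybe P
  isZero (yes p) = just p
  isZero (no _)  = nothing

open CommutativeRing ℚₚ.+-*-commutativeRing using ()
  renaming (semiring to ℚ-semiring; commutativeSemiring to ℚ-commutativeSemiring;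
            +-commutativeMonoid to ℚ-+-commutativeMonoid; *-commutativeMonoid to ℚ-*-commutativeMonoid)
open import Algebra.Properties.Semiring.Exp ℚ-semiring using (_^_; ^-assocʳ)
open import Algebra.Properties.CommutativeSemiring.Exp ℚ-commutativeSemiring using (^-distrib-*)
open import Algebra.Properties.Semiring.Sum ℚ-semiring using (*-distribˡ-sum; *-distribʳ-sum)
open import Algebra.Properties.CommutativeMonoid.Sum ℚ-+-commutativeMonoid using (sum; sum-cong-≗; ∑-distrib-+; ∑-comm; sum-replicate-zero)
open import Algebra.Properties.CommutativeMonoid.Sum ℚ-*-commutativeMonoid using () renaming (sum to prod; sum-cong-≗ to prod-cong)
open import Algebra.Properties.CommutativeMonoid.Sum ℕₚ.+-0-commutativeMonoid using () renaming (sum to sumℕ)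
open Extrema (DecTotalOrder.totalOrder ℚₚ.≤-decTotalOrder) using (argmin; argmin-all; f[argmin]≤f[⊤]; f[argmin]≤f[xs])

private variable
  X Y : Set
  p q r s x y z : ℚ
  k m n M N : ℕ

-- Rational arithmetic

≤-+ʳ : 0ℚ ≤ r → q ≡ p + r → p ≤ q
≤-+ʳ {r} {q} {p} 0≤r refl = subst (_≤ p + r) (ℚₚ.+-identityʳ p) (ℚₚ.+-monoʳ-≤ p 0≤r)

p≤q⇒0≤q-p : p ≤ q → 0ℚ ≤ q - p
p≤q⇒0≤q-p {p} {q} p≤q = subst (_≤ q - p) (ℚₚ.+-inverseʳ p) (ℚₚ.+-monoˡ-≤ (- p) p≤q)

0≤q-p⇒p≤q : 0ℚ ≤ q - p → p ≤ q
0≤q-p⇒p≤q {q} {p} h = ≤-+ʳ h (identity p q)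
  where
  identity : ∀ p q → q ≡ p + (q - p)
  identity = solve-∀ ℚring

0≤+ : 0ℚ ≤ p → 0ℚ ≤ q → 0ℚ ≤ p + q
0≤+ = ℚₚ.+-mono-≤

*-monoˡ : 0ℚ ≤ r → p ≤ q → r * p ≤ r * q
*-monoˡ {r} 0≤r = ℚₚ.*-monoˡ-≤-nonNeg r {{nonNegative 0≤r}}

*-monoʳ : 0ℚ ≤ r → p ≤ q → p * r ≤ q * r
*-monoʳ {r} 0≤r = ℚₚ.*-monoʳ-≤-nonNeg r {{nonNegative 0≤r}}

0≤* : 0ℚ ≤ p → 0ℚ ≤ q → 0ℚ ≤ p * q
0≤* {p} {q} 0≤p 0≤q = subst (_≤ p * q) (ℚₚ.*-zeroʳ p) (*-monoˡ 0≤p 0≤q)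

*-swap : ∀ a b c → a * (b * c) ≡ b * (a * c)
*-swap = solve-∀ ℚring

*-mono : 0ℚ ≤ p → 0ℚ ≤ s → p ≤ q → r ≤ s → p * r ≤ q * s
*-mono 0≤p 0≤s p≤q r≤s = ≤-trans (*-monoˡ 0≤p r≤s) (*-monoʳ 0≤s p≤q)

*-cancelˡ : 0ℚ < r → r * p ≤ r * q → p ≤ q
*-cancelˡ {r} 0<r = ℚₚ.*-cancelˡ-≤-pos r {{positive 0<r}}

0≤1 : 0ℚ ≤ 1ℚ
0≤1 = ℚₚ.nonNegative⁻¹ 1ℚ

0<1 : 0ℚ < 1ℚ
0<1 = ℚₚ.positive⁻¹ 1ℚ

toℚᵘ-// : ∀ m k → toℚᵘ (m // suc k) ℚᵘ.≃ ℚᵘ.mkℚᵘ (ℤ.+ m) k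
toℚᵘ-// m k = ℚₚ.toℚᵘ-fromℚᵘ (ℚᵘ.mkℚᵘ (ℤ.+ m) k)

fromℕ-+ : ∀ m n → fromℕ (m ℕ.+ n) ≡ fromℕ m + fromℕ n
fromℕ-+ m n = ℚₚ.toℚᵘ-injective (begin
  toℚᵘ (fromℕ (m ℕ.+ n))                  ≈⟨ toℚᵘ-// (m ℕ.+ n) 0 ⟩
  ℚᵘ.mkℚᵘ (ℤ.+ (m ℕ.+ n)) 0                 ≈⟨ ℚᵘ.*≡* (cong (ℤ._* ℤ.1ℤ) (sym (cong₂ ℤ._+_ (ℤₚ.*-identityʳ (ℤ.+ m)) (ℤₚ.*-identityʳ (ℤ.+ n))))) ⟩
  ℚᵘ.mkℚᵘ (ℤ.+ m) 0 ℚᵘ.+ ℚᵘ.mkℚᵘ (ℤ.+ n) 0    ≈⟨ ℚᵘₚ.+-cong (toℚᵘ-// m 0) (toℚᵘ-// n 0) ⟨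
  toℚᵘ (fromℕ m) ℚᵘ.+ toℚᵘ (fromℕ n)      ≈⟨ ℚₚ.toℚᵘ-homo-+ (fromℕ m) (fromℕ n) ⟨
  toℚᵘ (fromℕ m + fromℕ n)                ∎)
  where open ℚᵘₚ.≃-Reasoning

fromℕ-* : ∀ m n → fromℕ (m ℕ.* n) ≡ fromℕ m * fromℕ n
fromℕ-* m n = ℚₚ.toℚᵘ-injective (begin
  toℚᵘ (fromℕ (m ℕ.* n))                  ≈⟨ toℚᵘ-// (m ℕ.* n) 0 ⟩
  ℚᵘ.mkℚᵘ (ℤ.+ (m ℕ.* n)) 0                 ≈⟨ ℚᵘ.*≡* (cong (ℤ._* ℤ.1ℤ) (ℤₚ.pos-* m n)) ⟩
  ℚᵘ.mkℚᵘ (ℤ.+ m) 0 ℚᵘ.* ℚᵘ.mkℚᵘ (ℤ.+ n) 0    ≈⟨ ℚᵘₚ.*-cong (toℚᵘ-// m 0) (toℚᵘ-// n 0) ⟨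
  toℚᵘ (fromℕ m) ℚᵘ.* toℚᵘ (fromℕ n)      ≈⟨ ℚₚ.toℚᵘ-homo-* (fromℕ m) (fromℕ n) ⟨
  toℚᵘ (fromℕ m * fromℕ n)                ∎)
  where open ℚᵘₚ.≃-Reasoning

//-*-cancel : ∀ m k → (m // suc k) * fromℕ (suc k) ≡ fromℕ m
//-*-cancel m k = ℚₚ.toℚᵘ-injective (begin
  toℚᵘ (m // suc k * fromℕ (suc k))              ≈⟨ ℚₚ.toℚᵘ-homo-* (m // suc k) (fromℕ (suc k)) ⟩
  toℚᵘ (m // suc k) ℚᵘ.* toℚᵘ (fromℕ (suc k))    ≈⟨ ℚᵘₚ.*-cong (toℚᵘ-// m k) (toℚᵘ-// (suc k) 0) ⟩
  ℚᵘ.mkℚᵘ (ℤ.+ m) k ℚᵘ.* ℚᵘ.mkℚᵘ (ℤ.+ suc k) 0       ≈⟨ ℚᵘ.*≡* (ℤₚ.*-assoc (ℤ.+ m) (ℤ.+ suc k) ℤ.1ℤ) ⟩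
  ℚᵘ.mkℚᵘ (ℤ.+ m) 0                                ≈⟨ toℚᵘ-// m 0 ⟨
  toℚᵘ (fromℕ m)                                 ∎)
  where open ℚᵘₚ.≃-Reasoning

0≤// : ∀ m k → 0ℚ ≤ m // k
0≤// m zero    = ≤-refl
0≤// m (suc k) = ℚₚ.nonNegative⁻¹ _ {{ℚₚ.normalize-nonNeg m (suc k)}}

0≤fromℕ : ∀ m → 0ℚ ≤ fromℕ m
0≤fromℕ m = 0≤// m 1

fromℕ-mono : m ℕ.≤ n → fromℕ m ≤ fromℕ n
fromℕ-mono {m} m≤n with k , refl ← ℕₚ.m≤n⇒∃[o]m+o≡n m≤n =
  ≤-+ʳ (0≤fromℕ k) (fromℕ-+ m k)

fromℕ-suc : ∀ m → fromℕ (suc m) ≡ 1ℚ + fromℕ m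
fromℕ-suc = fromℕ-+ 1

0<fromℕ-suc : ∀ m → 0ℚ < fromℕ (suc m)
0<fromℕ-suc m = subst (0ℚ <_) (sym (fromℕ-suc m)) (ℚₚ.<-≤-trans 0<1 (≤-+ʳ (0≤fromℕ m) refl))

fromℕ-cancel-≤ : fromℕ m ≤ fromℕ n → m ℕ.≤ n
fromℕ-cancel-≤ {m} {n} h with m ℕ.≤? n
... | yes m≤n = m≤n
... | no m≰n  = contradiction
  (ℚₚ.<-≤-trans (ℚₚ.<-≤-trans n<1+n (fromℕ-mono (ℕₚ.≰⇒> m≰n))) h) (ℚₚ.<-irrefl refl)
  where
  n<1+n : fromℕ n < fromℕ (suc n)
  n<1+n = subst₂ _<_ (ℚₚ.+-identityˡ _) (sym (fromℕ-suc n)) (ℚₚ.+-monoˡ-< (fromℕ n) 0<1)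

⟦_⟧ : Bool → ℚ
⟦ true ⟧  = 1ℚ
⟦ false ⟧ = 0ℚ

0≤⟦⟧ : ∀ b → 0ℚ ≤ ⟦ b ⟧
0≤⟦⟧ true  = 0≤1
0≤⟦⟧ false = ≤-refl

⟦⟧≤1 : ∀ b → ⟦ b ⟧ ≤ 1ℚ
⟦⟧≤1 true  = ≤-refl
⟦⟧≤1 false = 0≤1

⟦∧⟧≤ : ∀ b c → ⟦ b ∧ c ⟧ ≤ ⟦ c ⟧
⟦∧⟧≤ true  c = ≤-refl
⟦∧⟧≤ false c = 0≤⟦⟧ c

⟦⟧-not : ∀ b → ⟦ not b ⟧ ≡ 1ℚ - ⟦ b ⟧
⟦⟧-not true  = refl
⟦⟧-not false = refl

^-nonNeg : ∀ k → 0ℚ ≤ x → 0ℚ ≤ x ^ k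
^-nonNeg zero    _   = 0≤1
^-nonNeg (suc k) 0≤x = 0≤* 0≤x (^-nonNeg k 0≤x)

^-monoˡ : ∀ k → 0ℚ ≤ x → x ≤ y → x ^ k ≤ y ^ k
^-monoˡ zero    _   _   = ≤-refl
^-monoˡ (suc k) 0≤x x≤y = *-mono 0≤x (^-nonNeg k (≤-trans 0≤x x≤y)) x≤y (^-monoˡ k 0≤x x≤y)

^-≥1 : ∀ k → 1ℚ ≤ x → 1ℚ ≤ x ^ k
^-≥1 zero    _   = ≤-refl
^-≥1 (suc k) 1≤x = *-mono 0≤1 (^-nonNeg k (≤-trans 0≤1 1≤x)) 1≤x (^-≥1 k 1≤x)

^-antimonoʳ : 0ℚ ≤ x → x ≤ 1ℚ → m ℕ.≤ n → x ^ n ≤ x ^ m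
^-antimonoʳ {n = zero}  0≤x x≤1 ℕ.z≤n       = ≤-refl
^-antimonoʳ {n = suc n} 0≤x x≤1 ℕ.z≤n       =
  *-mono 0≤x 0≤1 x≤1 (^-antimonoʳ {n = n} 0≤x x≤1 ℕ.z≤n)
^-antimonoʳ             0≤x x≤1 (ℕ.s≤s m≤n) = *-monoˡ 0≤x (^-antimonoʳ 0≤x x≤1 m≤n)

^-monoʳ : 1ℚ ≤ x → m ℕ.≤ n → x ^ m ≤ x ^ n
^-monoʳ {n = n} 1≤x ℕ.z≤n       = ^-≥1 n 1≤x
^-monoʳ         1≤x (ℕ.s≤s m≤n) = *-monoˡ (≤-trans 0≤1 1≤x) (^-monoʳ 1≤x m≤n)

bernoulli : ∀ k → 0ℚ ≤ 1ℚ + x → 1ℚ + fromℕ k * x ≤ (1ℚ + x) ^ k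
bernoulli {x} zero    _     = ≤-reflexive (identity x)
  where
  identity : ∀ x → 1ℚ + 0ℚ * x ≡ 1ℚ
  identity = solve-∀ ℚring
bernoulli {x} (suc k) 0≤1+x = ≤-trans
  (≤-+ʳ (0≤* (0≤fromℕ k) (0≤x² x))
    (trans (identity (fromℕ k) x) (cong (λ c → 1ℚ + c * x + fromℕ k * (x * x)) (sym (fromℕ-suc k)))))
  (*-monoˡ 0≤1+x (bernoulli k 0≤1+x))
  where
  identity : ∀ k x → (1ℚ + x) * (1ℚ + k * x) ≡ 1ℚ + (1ℚ + k) * x + k * (x * x)
  identity = solve-∀ ℚring
  0≤x² : ∀ x → 0ℚ ≤ x * x
  0≤x² x with ℚₚ.≤-total 0ℚ x
  ... | inj₁ 0≤x = 0≤* 0≤x 0≤x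
  ... | inj₂ x≤0 = subst (0ℚ ≤_) (square x) (0≤* 0≤-x 0≤-x)
    where
    square : ∀ x → (0ℚ - x) * (0ℚ - x) ≡ x * x
    square = solve-∀ ℚring
    0≤-x : 0ℚ ≤ 0ℚ - x
    0≤-x = p≤q⇒0≤q-p x≤0

reverse-bernoulli : ∀ k → 0ℚ ≤ y → (y + y) * fromℕ k ≤ 1ℚ → (1ℚ - (y + y)) ^ k ≤ 1ℚ - y * fromℕ k
reverse-bernoulli {y} zero    _   _ = ≤-reflexive (identity y)
  where
  identity : ∀ y → 1ℚ ≡ 1ℚ - y * 0ℚ
  identity = solve-∀ ℚring
reverse-bernoulli {y} (suc k) 0≤y h = begin
  (1ℚ - (y + y)) * (1ℚ - (y + y)) ^ k      ≤⟨ *-monoˡ (p≤q⇒0≤q-p 2y≤1) (reverse-bernoulli k 0≤y 2yk≤1) ⟩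
  (1ℚ - (y + y)) * (1ℚ - y * fromℕ k)      ≤⟨ ≤-+ʳ (0≤* 0≤y (p≤q⇒0≤q-p 2yk≤1)) (identity y (fromℕ k)) ⟩
  1ℚ - y * (1ℚ + fromℕ k)                  ≡⟨ cong (λ c → 1ℚ - y * c) (fromℕ-suc k) ⟨
  1ℚ - y * fromℕ (suc k)                   ∎
  where
  open ≤-Reasoning
  h′ : (y + y) * (1ℚ + fromℕ k) ≤ 1ℚ
  h′ = subst (λ c → (y + y) * c ≤ 1ℚ) (fromℕ-suc k) h
  0≤2y : 0ℚ ≤ y + y
  0≤2y = 0≤+ 0≤y 0≤y
  2yk≤1 : (y + y) * fromℕ k ≤ 1ℚ
  2yk≤1 = ≤-trans (*-monoˡ 0≤2y (≤-+ʳ 0≤1 (ℚₚ.+-comm 1ℚ (fromℕ k)))) h′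
  2y≤1 : y + y ≤ 1ℚ
  2y≤1 = ≤-trans (≤-+ʳ (0≤* 0≤2y (0≤fromℕ k)) (expand (y + y) (fromℕ k))) h′
    where
    expand : ∀ z k → z * (1ℚ + k) ≡ z + z * k
    expand = solve-∀ ℚring
  identity : ∀ y k → 1ℚ - y * (1ℚ + k) ≡ (1ℚ - (y + y)) * (1ℚ - y * k) + y * (1ℚ - (y + y) * k)
  identity = solve-∀ ℚring

sum-mono : {f g : Fin n → ℚ} → (∀ i → f i ≤ g i) → sum f ≤ sum g
sum-mono {zero}  _   = ≤-refl
sum-mono {suc n} f≤g = ℚₚ.+-mono-≤ (f≤g zero) (sum-mono (f≤g ∘ suc))

sum-zero : {f : Fin n → ℚ} → (∀ i → f i ≡ 0ℚ) → sum f ≡ 0ℚ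
sum-zero {n} f≡0 = trans (sum-cong-≗ f≡0) (sum-replicate-zero n)

sum-nonNeg : {f : Fin n → ℚ} → (∀ i → 0ℚ ≤ f i) → 0ℚ ≤ sum f
sum-nonNeg {n} {f} 0≤f = subst (_≤ sum f) (sum-replicate-zero n) (sum-mono 0≤f)

term≤sum : {f : Fin n → ℚ} → (∀ i → 0ℚ ≤ f i) → ∀ i → f i ≤ sum f
term≤sum 0≤f zero    = ≤-+ʳ (sum-nonNeg (0≤f ∘ suc)) refl
term≤sum {f = f} 0≤f (suc i) = ≤-trans (term≤sum (0≤f ∘ suc) i) (≤-+ʳ (0≤f zero) (ℚₚ.+-comm (f zero) _))

sum-const : ∀ n x → sum {n} (λ _ → x) ≡ fromℕ n * x
sum-const zero    x = sym (ℚₚ.*-zeroˡ x)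
sum-const (suc n) x = trans (cong (x +_) (sum-const n x))
  (trans (identity x (fromℕ n)) (cong (_* x) (sym (fromℕ-suc n))))
  where
  identity : ∀ x n → x + n * x ≡ (1ℚ + n) * x
  identity = solve-∀ ℚring

sum-1 : ∀ n → sum {n} (λ _ → 1ℚ) ≡ fromℕ n
sum-1 n = trans (sum-const n 1ℚ) (ℚₚ.*-identityʳ _)

∑-distrib-- : (f g : Fin n → ℚ) → sum (λ i → f i - g i) ≡ sum f - sum g
∑-distrib-- {zero}  f g = refl
∑-distrib-- {suc n} f g = trans (cong (f zero - g zero +_) (∑-distrib-- (f ∘ suc) (g ∘ suc)))
  (identity (f zero) (g zero) (sum (f ∘ suc)) (sum (g ∘ suc)))
  where
  identity : ∀ a b c d → (a - b) + (c - d) ≡ (a + c) - (b + d)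
  identity = solve-∀ ℚring

prod-nonNeg : {f : Fin n → ℚ} → (∀ i → 0ℚ ≤ f i) → 0ℚ ≤ prod f
prod-nonNeg {zero}  _   = 0≤1
prod-nonNeg {suc n} 0≤f = 0≤* (0≤f zero) (prod-nonNeg (0≤f ∘ suc))

prod-≤1 : {f : Fin n → ℚ} → (∀ i → 0ℚ ≤ f i) → (∀ i → f i ≤ 1ℚ) → prod f ≤ 1ℚ
prod-≤1 {zero}  _   _   = ≤-refl
prod-≤1 {suc n} 0≤f f≤1 = *-mono (0≤f zero) 0≤1 (f≤1 zero) (prod-≤1 (0≤f ∘ suc) (f≤1 ∘ suc))

prod≤factor : {f : Fin n → ℚ} → (∀ i → 0ℚ ≤ f i) → (∀ i → f i ≤ 1ℚ) → ∀ i → prod f ≤ f i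
prod≤factor {f = f} 0≤f f≤1 zero    = ≤-trans (*-monoˡ (0≤f zero) (prod-≤1 (0≤f ∘ suc) (f≤1 ∘ suc))) (≤-reflexive (ℚₚ.*-identityʳ (f zero)))
prod≤factor {f = f} 0≤f f≤1 (suc i) = ≤-trans
  (*-mono (0≤f zero) (0≤f (suc i)) (f≤1 zero) (prod≤factor (0≤f ∘ suc) (f≤1 ∘ suc) i))
  (≤-reflexive (ℚₚ.*-identityˡ (f (suc i))))

prod-complement-bound : (f w : Fin n → ℚ) → (∀ i → 0ℚ ≤ w i) → (∀ i → w i ≤ f i) → (∀ i → f i ≤ 1ℚ) →
  prod (λ i → 1ℚ - f i) * (1ℚ + sum w) ≤ 1ℚ
prod-complement-bound {zero}  f w _   _   _   = ≤-refl
prod-complement-bound {suc n} f w 0≤w w≤f f≤1 = begin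
  (1ℚ - f zero) * P * (1ℚ + (w zero + W))  ≤⟨ ≤-+ʳ (0≤* 0≤P (0≤+ 0≤fW (0≤+ (0≤* 0≤f0 (0≤w zero)) (p≤q⇒0≤q-p (w≤f zero))))) (identity (f zero) P (w zero) W) ⟩
  P * (1ℚ + W)                             ≤⟨ prod-complement-bound (f ∘ suc) (w ∘ suc) (0≤w ∘ suc) (w≤f ∘ suc) (f≤1 ∘ suc) ⟩
  1ℚ                                       ∎
  where
  open ≤-Reasoning
  P = prod (λ i → 1ℚ - f (suc i))
  W = sum (w ∘ suc)
  0≤f0 : 0ℚ ≤ f zero
  0≤f0 = ≤-trans (0≤w zero) (w≤f zero)
  0≤P : 0ℚ ≤ P
  0≤P = prod-nonNeg (λ i → p≤q⇒0≤q-p (f≤1 (suc i)))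
  0≤fW : 0ℚ ≤ f zero * W
  0≤fW = 0≤* 0≤f0 (sum-nonNeg (0≤w ∘ suc))
  identity : ∀ f P w W → P * (1ℚ + W) ≡ (1ℚ - f) * P * (1ℚ + (w + W)) + P * (f * W + (f * w + (f - w)))
  identity = solve-∀ ℚring

sumℕ-mono : {f g : Fin n → ℕ} → (∀ i → f i ℕ.≤ g i) → sumℕ f ℕ.≤ sumℕ g
sumℕ-mono {zero}  _   = ℕ.z≤n
sumℕ-mono {suc n} f≤g = ℕₚ.+-mono-≤ (f≤g zero) (sumℕ-mono (f≤g ∘ suc))

sumℕ-mono-< : {f g : Fin n → ℕ} → (∀ i → f i ℕ.≤ g i) → ∀ i → f i ℕ.< g i → sumℕ f ℕ.< sumℕ g
sumℕ-mono-< f≤g zero    f<g = ℕₚ.+-mono-<-≤ f<g (sumℕ-mono (f≤g ∘ suc))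
sumℕ-mono-< f≤g (suc i) f<g = ℕₚ.+-mono-≤-< (f≤g zero) (sumℕ-mono-< (f≤g ∘ suc) i f<g)

sumℕ-bound : ∀ {c} {f : Fin n → ℕ} → (∀ i → f i ℕ.≤ c) → sumℕ f ℕ.≤ n ℕ.* c
sumℕ-bound {zero}  _   = ℕ.z≤n
sumℕ-bound {suc n} f≤c = ℕₚ.+-mono-≤ (f≤c zero) (sumℕ-bound (f≤c ∘ suc))

-- Expectations

E : Dist X → (X → ℚ) → ℚ
E []            f = 0ℚ
E ((w , x) ∷ d) f = w * f x + E d f

record IsLaw (d : Dist X) : Set where
  constructor law
  field
    nonNeg : All (λ wx → 0ℚ ≤ proj₁ wx) d
    mass   : E d (λ _ → 1ℚ) ≡ 1ℚ

open IsLaw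

IsProbability⇒IsLaw : {d : Dist X} → IsProbability d → IsLaw d
IsProbability⇒IsLaw {X} {d} pr = record
  { nonNeg = All.map ℚₚ.<⇒≤ (IsProbability.positive pr)
  ; mass   = trans (mass≡total d) (IsProbability.total≡1 pr)
  }
  where
  mass≡total : (d : Dist X) → E d (λ _ → 1ℚ) ≡ total d
  mass≡total []            = refl
  mass≡total ((w , _) ∷ d) = cong₂ _+_ (ℚₚ.*-identityʳ w) (mass≡total d)

total-filterᵇ : (e : X → Bool) (d : Dist X) → total (filterᵇ (λ wx → e (proj₂ wx)) d) ≡ E d (λ x → ⟦ e x ⟧)
total-filterᵇ e []            = refl
total-filterᵇ e ((w , x) ∷ d) with e x
... | true  = cong₂ _+_ (sym (ℚₚ.*-identityʳ w)) (total-filterᵇ e d)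
... | false = trans (total-filterᵇ e d) (sym (trans (cong (_+ _) (ℚₚ.*-zeroʳ w)) (ℚₚ.+-identityˡ (E d (λ x → ⟦ e x ⟧)))))

probAtLeast : (e : X → Bool) {d : Dist X} {P : X → Set} → (∀ x → T (e x) → P x) → p ≤ E d (λ x → ⟦ e x ⟧) → ProbAtLeast p d P
probAtLeast {p = p} e {d} e⇒P p≤ = e , e⇒P , subst (p ≤_) (sym (total-filterᵇ e d)) p≤

E-cong : (d : Dist X) {f g : X → ℚ} → (∀ x → f x ≡ g x) → E d f ≡ E d g
E-cong []            _   = refl
E-cong ((w , x) ∷ d) f≗g = cong₂ _+_ (cong (w *_) (f≗g x)) (E-cong d f≗g)

E-+ : (d : Dist X) (f g : X → ℚ) → E d (λ x → f x + g x) ≡ E d f + E d g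
E-+ []            f g = refl
E-+ ((w , x) ∷ d) f g = trans (cong (w * (f x + g x) +_) (E-+ d f g)) (identity w (f x) (g x) (E d f) (E d g))
  where
  identity : ∀ w a b c e → w * (a + b) + (c + e) ≡ (w * a + c) + (w * b + e)
  identity = solve-∀ ℚring

E-*ˡ : (d : Dist X) (c : ℚ) (f : X → ℚ) → E d (λ x → c * f x) ≡ c * E d f
E-*ˡ []            c f = sym (ℚₚ.*-zeroʳ c)
E-*ˡ ((w , x) ∷ d) c f = trans (cong (w * (c * f x) +_) (E-*ˡ d c f)) (identity w c (f x) (E d f))
  where
  identity : ∀ w c a e → w * (c * a) + c * e ≡ c * (w * a + e)
  identity = solve-∀ ℚring

E-*ʳ : (d : Dist X) (c : ℚ) (f : X → ℚ) → E d (λ x → f x * c) ≡ E d f * c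
E-*ʳ d c f = trans (E-cong d (λ x → ℚₚ.*-comm (f x) c)) (trans (E-*ˡ d c f) (ℚₚ.*-comm c (E d f)))

E-const : {d : Dist X} → IsLaw d → ∀ c → E d (λ _ → c) ≡ c
E-const {d = d} L c = begin
  E d (λ _ → c)          ≡⟨ E-cong d (λ _ → ℚₚ.*-identityʳ c) ⟨
  E d (λ _ → c * 1ℚ)     ≡⟨ E-*ˡ d c (λ _ → 1ℚ) ⟩
  c * E d (λ _ → 1ℚ)     ≡⟨ cong (c *_) (mass L) ⟩
  c * 1ℚ                 ≡⟨ ℚₚ.*-identityʳ c ⟩
  c                      ∎
  where open ≡-Reasoning

E-complement : {d : Dist X} → IsLaw d → ∀ f → E d (λ x → 1ℚ - f x) ≡ 1ℚ - E d f
E-complement {d = d} L f = begin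
  E d (λ x → 1ℚ - f x)                          ≡⟨ E-cong d (λ x → identity (f x)) ⟩
  E d (λ x → 1ℚ + (0ℚ - 1ℚ) * f x)              ≡⟨ E-+ d (λ _ → 1ℚ) (λ x → (0ℚ - 1ℚ) * f x) ⟩
  E d (λ _ → 1ℚ) + E d (λ x → (0ℚ - 1ℚ) * f x)  ≡⟨ cong₂ _+_ (mass L) (E-*ˡ d (0ℚ - 1ℚ) f) ⟩
  1ℚ + (0ℚ - 1ℚ) * E d f                        ≡⟨ identity (E d f) ⟨
  1ℚ - E d f                                    ∎
  where
  open ≡-Reasoning
  identity : ∀ a → 1ℚ - a ≡ 1ℚ + (0ℚ - 1ℚ) * a
  identity = solve-∀ ℚring

E-mono-on : {d : Dist X} {f g : X → ℚ} {P : X → Set} → IsLaw d → Surely d P → (∀ x → P x → f x ≤ g x) → E d f ≤ E d g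
E-mono-on {X} {f = f} {g} {P} L sure f≤g = go (nonNeg L) sure
  where
  go : {d : Dist X} → All (λ wx → 0ℚ ≤ proj₁ wx) d → Surely d P → E d f ≤ E d g
  go []            []       = ≤-refl
  go (0≤w ∷ 0≤ws) (Px ∷ Ps) = ℚₚ.+-mono-≤ (*-monoˡ 0≤w (f≤g _ Px)) (go 0≤ws Ps)

surely-⊤ : (d : Dist X) → Surely d (λ _ → ⊤)
surely-⊤ []      = []
surely-⊤ (_ ∷ d) = tt ∷ surely-⊤ d

E-mono : {d : Dist X} {f g : X → ℚ} → IsLaw d → (∀ x → f x ≤ g x) → E d f ≤ E d g
E-mono {d = d} L f≤g = E-mono-on L (surely-⊤ d) (λ x _ → f≤g x)

E-nonNeg : {d : Dist X} {f : X → ℚ} → IsLaw d → (∀ x → 0ℚ ≤ f x) → 0ℚ ≤ E d f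
E-nonNeg {d = d} {f} L 0≤f = subst (_≤ E d f) (E-const L 0ℚ) (E-mono L 0≤f)

E-comm : (d : Dist X) (e : Dist Y) (f : X → Y → ℚ) → E d (λ x → E e (f x)) ≡ E e (λ y → E d (λ x → f x y))
E-comm []            e f = sym (trans (E-cong e (λ y → sym (ℚₚ.*-zeroˡ 0ℚ))) (trans (E-*ˡ e 0ℚ (λ _ → 0ℚ)) (ℚₚ.*-zeroˡ (E e (λ _ → 0ℚ)))))
E-comm ((w , x) ∷ d) e f = begin
  w * E e (f x) + E d (λ x → E e (f x))                     ≡⟨ cong₂ _+_ (sym (E-*ˡ e w (f x))) (E-comm d e f) ⟩
  E e (λ y → w * f x y) + E e (λ y → E d (λ x → f x y))     ≡⟨ E-+ e (λ y → w * f x y) _ ⟨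
  E e (λ y → w * f x y + E d (λ x → f x y))                 ∎
  where open ≡-Reasoning

E-sum : (d : Dist X) (f : Fin n → X → ℚ) → E d (λ x → sum (λ i → f i x)) ≡ sum (λ i → E d (f i))
E-sum {n = zero}  d f = trans (E-cong d (λ y → sym (ℚₚ.*-zeroˡ 0ℚ))) (trans (E-*ˡ d 0ℚ (λ _ → 0ℚ)) (ℚₚ.*-zeroˡ (E d (λ _ → 0ℚ))))
E-sum {n = suc n} d f = trans (E-+ d (f zero) _) (cong (E d (f zero) +_) (E-sum d (f ∘ suc)))

E-++ : (d e : Dist X) (f : X → ℚ) → E (d ++ e) f ≡ E d f + E e f
E-++ []            e f = sym (ℚₚ.+-identityˡ (E e f))
E-++ ((w , x) ∷ d) e f = trans (cong (w * f x +_) (E-++ d e f)) (sym (ℚₚ.+-assoc (w * f x) (E d f) (E e f)))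

E-map : (w : ℚ) (g : ℚ × X → ℚ × X) → (∀ v x → g (v , x) ≡ (w * v , x)) →
  (d : Dist X) (f : X → ℚ) → E (map g d) f ≡ w * E d f
E-map w g g≗ []            f = sym (ℚₚ.*-zeroʳ w)
E-map w g g≗ ((v , x) ∷ d) f rewrite g≗ v x = trans (cong (w * v * f x +_) (E-map w g g≗ d f)) (identity w v (f x) (E d f))
  where
  identity : ∀ w v a e → w * v * a + w * e ≡ w * (v * a + e)
  identity = solve-∀ ℚring

E->>= : (d : Dist X) (f : X → Dist Y) (g : Y → ℚ) → E (d >>= f) g ≡ E d (λ x → E (f x) g)
E->>= []            f g = refl
E->>= ((w , x) ∷ d) f g = trans (E-++ (map _ (f x)) _ g) (cong₂ _+_ (E-map w _ (λ _ _ → refl) (f x) g) (E->>= d f g))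

E-return : (x : X) (f : X → ℚ) → E (return x) f ≡ f x
E-return x f = trans (ℚₚ.+-identityʳ (1ℚ * f x)) (ℚₚ.*-identityˡ (f x))

isLaw-return : (x : X) → IsLaw (return x)
isLaw-return x = law (0≤1 ∷ []) refl

isLaw->>= : {d : Dist X} {f : X → Dist Y} → IsLaw d → (∀ x → IsLaw (f x)) → IsLaw (d >>= f)
isLaw->>= {X} {Y} {d} {f} L M = law (go (nonNeg L))
  (trans (E->>= d f _) (trans (E-cong d (λ x → mass (M x))) (mass L)))
  where
  scale : ∀ {w} (g : ℚ × Y → ℚ × Y) → (∀ v x → proj₁ (g (v , x)) ≡ w * v) → 0ℚ ≤ w →
    {e : Dist Y} → All (λ wx → 0ℚ ≤ proj₁ wx) e → All (λ wx → 0ℚ ≤ proj₁ wx) (map g e)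
  scale g g≗ 0≤w []           = []
  scale g g≗ 0≤w (0≤v ∷ 0≤vs) = subst (0ℚ ≤_) (sym (g≗ _ _)) (0≤* 0≤w 0≤v) ∷ scale g g≗ 0≤w 0≤vs
  go : {d : Dist X} → All (λ wx → 0ℚ ≤ proj₁ wx) d → All (λ wx → 0ℚ ≤ proj₁ wx) (d >>= f)
  go []           = []
  go {(w , x) ∷ d} (0≤w ∷ 0≤ws) = All.++⁺ (scale _ (λ _ _ → refl) 0≤w (nonNeg (M x))) (go 0≤ws)

surely-return : {P : X → Set} {x : X} → P x → Surely (return x) P
surely-return Px = Px ∷ []

surely->>= : {d : Dist X} {f : X → Dist Y} {P : X → Set} {Q : Y → Set} →
  Surely d P → (∀ x → P x → Surely (f x) Q) → Surely (d >>= f) Q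
surely->>= []                            _ = []
surely->>= {Y = Y} {d = (w , x) ∷ d} {f} {Q = Q} (Px ∷ Ps) h = All.++⁺ (relabel _ (λ _ _ → refl) (h x Px)) (surely->>= Ps h)
  where
  relabel : (g : ℚ × Y → ℚ × Y) → (∀ v x → proj₂ (g (v , x)) ≡ x) → {e : Dist Y} → Surely e Q → Surely (map g e) Q
  relabel g g≗ []        = []
  relabel g g≗ (Qx ∷ Qs) = subst Q (sym (g≗ _ _)) Qx ∷ relabel g g≗ Qs

>>=-cong : (d : Dist X) {f g : X → Dist Y} → (∀ x → f x ≡ g x) → (d >>= f) ≡ (d >>= g)
>>=-cong []            _   = refl
>>=-cong ((w , x) ∷ d) f≗g = cong₂ _++_ (cong (map _) (f≗g x)) (>>=-cong d f≗g)

independent-cong : {d e : Fin n → Dist X} → (∀ i → d i ≡ e i) → independent d ≡ independent e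
independent-cong {zero}          _   = refl
independent-cong {suc n} {X} {d} {e} d≗e = trans
  (cong (_>>= λ x → independent (d ∘ suc) >>= λ xs → return (x ∷ xs)) (d≗e zero))
  (>>=-cong (e zero) λ x → cong (_>>= λ xs → return (x ∷ xs)) (independent-cong (d≗e ∘ suc)))

E-independent-suc : (d : Fin (suc n) → Dist X) (f : Vec X (suc n) → ℚ) →
  E (independent d) f ≡ E (d zero) (λ x → E (independent (d ∘ suc)) (λ xs → f (x ∷ xs)))
E-independent-suc d f = trans (E->>= (d zero) _ f) (E-cong (d zero) λ x →
  trans (E->>= (independent (d ∘ suc)) (λ xs → return (x ∷ xs)) f) (E-cong (independent (d ∘ suc)) λ xs → E-return (x ∷ xs) f))

isLaw-independent : {d : Fin n → Dist X} → (∀ i → IsLaw (d i)) → IsLaw (independent d)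
isLaw-independent {zero}  L = isLaw-return []
isLaw-independent {suc n} L = isLaw->>= (L zero) λ x → isLaw->>= (isLaw-independent (L ∘ suc)) λ xs → isLaw-return (x ∷ xs)

surely-independent : {d : Fin n → Dist X} {P : Fin n → X → Set} → (∀ i → Surely (d i) (P i)) →
  Surely (independent d) (λ xs → ∀ i → P i (lookup xs i))
surely-independent {zero}  h = surely-return λ ()
surely-independent {suc n} h = surely->>= (h zero) λ x Px → surely->>= (surely-independent (h ∘ suc)) λ xs Pxs →
  surely-return λ { zero → Px ; (suc i) → Pxs i }

E-independent-prod : (d : Fin n → Dist X) (f : Fin n → X → ℚ) →
  E (independent d) (λ xs → prod (λ i → f i (lookup xs i))) ≡ prod (λ i → E (d i) (f i))
E-independent-prod {zero}  d f = refl
E-independent-prod {suc n} d f = begin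
  E (independent d) (λ xs → prod (λ i → f i (lookup xs i)))
    ≡⟨ E-independent-suc d _ ⟩
  E (d zero) (λ x → E (independent (d ∘ suc)) (λ xs → f zero x * prod (λ i → f (suc i) (lookup xs i))))
    ≡⟨ E-cong (d zero) (λ x → trans (E-*ˡ (independent (d ∘ suc)) (f zero x) _) (cong (f zero x *_) (E-independent-prod (d ∘ suc) (f ∘ suc)))) ⟩
  E (d zero) (λ x → f zero x * prod (λ i → E (d (suc i)) (f (suc i))))
    ≡⟨ E-*ʳ (d zero) (prod (λ i → E (d (suc i)) (f (suc i)))) (f zero) ⟩
  E (d zero) (f zero) * prod (λ i → E (d (suc i)) (f (suc i)))
    ∎
  where open ≡-Reasoning

mix : (Fin n → Bool) → Vec X n → Vec X n → Vec X n
mix P xs ys = tabulate λ i → if P i then lookup ys i else lookup xs i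

E-resample : (d : Fin n → Dist X) → (∀ i → IsLaw (d i)) → (P : Fin n → Bool) (f : Vec X n → ℚ) →
  E (independent d) f ≡ E (independent d) (λ xs → E (independent d) (λ ys → f (mix P xs ys)))
E-resample {zero}  d L P f = sym (E-return [] (λ xs → E (independent d) (λ ys → f (mix P xs ys))))
E-resample {suc n} {X} d L P f = begin
  E (independent d) f
    ≡⟨ E-independent-suc d f ⟩
  E (d zero) (λ x → E d′ (λ xs → f (x ∷ xs)))
    ≡⟨ E-cong (d zero) (λ x → E-resample (d ∘ suc) (L ∘ suc) (P ∘ suc) (λ xs → f (x ∷ xs))) ⟩
  E (d zero) (λ x → E d′ (λ xs → E d′ (λ ys → f (x ∷ mix (P ∘ suc) xs ys))))
    ≡⟨ choose (P zero) ⟩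
  E (d zero) (λ x → E d′ (λ xs → E (d zero) (λ y → E d′ (λ ys → f ((if P zero then y else x) ∷ mix (P ∘ suc) xs ys)))))
    ≡⟨ E-cong (d zero) (λ x → E-cong d′ λ xs → sym (E-independent-suc d (λ ys → f (mix P (x ∷ xs) ys)))) ⟩
  E (d zero) (λ x → E d′ (λ xs → E (independent d) (λ ys → f (mix P (x ∷ xs) ys))))
    ≡⟨ E-independent-suc d _ ⟨
  E (independent d) (λ xs → E (independent d) (λ ys → f (mix P xs ys)))
    ∎
  where
  open ≡-Reasoning
  d′ = independent (d ∘ suc)
  F : X → Vec X n → ℚ
  F z xs = E d′ (λ ys → f (z ∷ mix (P ∘ suc) xs ys))
  choose : ∀ b → E (d zero) (λ x → E d′ (F x)) ≡
    E (d zero) (λ x → E d′ (λ xs → E (d zero) (λ y → F (if b then y else x) xs)))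
  choose false = E-cong (d zero) λ x → E-cong d′ λ xs → sym (E-const (L zero) (F x xs))
  choose true  = trans (E-comm (d zero) d′ F) (sym (E-const (L zero) _))

coin : Dist Bool
coin = uniform (false ∷ true ∷ [])

isLaw-coin : IsLaw coin
isLaw-coin = law (0≤// 1 2 ∷ 0≤// 1 2 ∷ []) refl

E-coins-flip : (j : Fin n) (f : Vec Bool n → ℚ) →
  E (independent (λ _ → coin)) f ≡
  E (independent (λ _ → coin)) (λ r → ½ * (f (r [ j ]≔ false) + f (r [ j ]≔ true)))
E-coins-flip {suc n} zero    f = begin
  E (independent (λ _ → coin)) f
    ≡⟨ E-independent-suc (λ _ → coin) f ⟩
  E coin (λ x → E d′ (λ xs → f (x ∷ xs)))
    ≡⟨ E-comm coin d′ (λ x xs → f (x ∷ xs)) ⟩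
  E d′ (λ xs → E coin (λ x → f (x ∷ xs)))
    ≡⟨ E-cong d′ (λ xs → average (f (false ∷ xs)) (f (true ∷ xs))) ⟩
  E d′ (λ xs → ½ * (f (false ∷ xs) + f (true ∷ xs)))
    ≡⟨ E-const isLaw-coin _ ⟨
  E coin (λ x → E d′ (λ xs → ½ * (f (false ∷ xs) + f (true ∷ xs))))
    ≡⟨ E-independent-suc (λ _ → coin) (λ r → ½ * (f (r [ zero ]≔ false) + f (r [ zero ]≔ true))) ⟨
  E (independent (λ _ → coin)) (λ r → ½ * (f (r [ zero ]≔ false) + f (r [ zero ]≔ true)))
    ∎
  where
  open ≡-Reasoning
  d′ = independent {m = n} (λ _ → coin)
  average : ∀ a b → ½ * a + (½ * b + 0ℚ) ≡ ½ * (a + b)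
  average = solve-∀ ℚring
E-coins-flip {suc n} (suc j) f = begin
  E (independent (λ _ → coin)) f
    ≡⟨ E-independent-suc (λ _ → coin) f ⟩
  E coin (λ x → E d′ (λ xs → f (x ∷ xs)))
    ≡⟨ E-cong coin (λ x → E-coins-flip j (λ xs → f (x ∷ xs))) ⟩
  E coin (λ x → E d′ (λ xs → ½ * (f (x ∷ xs [ j ]≔ false) + f (x ∷ xs [ j ]≔ true))))
    ≡⟨ E-independent-suc (λ _ → coin) (λ r → ½ * (f (r [ suc j ]≔ false) + f (r [ suc j ]≔ true))) ⟨
  E (independent (λ _ → coin)) (λ r → ½ * (f (r [ suc j ]≔ false) + f (r [ suc j ]≔ true)))
    ∎
  where
  open ≡-Reasoning
  d′ = independent {m = n} (λ _ → coin)

isLaw-coins : IsLaw (independent {m = n} (λ _ → coin))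
isLaw-coins = isLaw-independent (λ _ → isLaw-coin)

-- One round of proposals

does⇒ : {P : Set} (d : Dec P) → does d ≡ true → P
does⇒ (yes p) _ = p

does⇒¬ : {P : Set} (d : Dec P) → does d ≡ false → ¬ P
does⇒¬ (no ¬p) _ = ¬p

∧-true : ∀ {a b} → a ∧ b ≡ true → a ≡ true × b ≡ true
∧-true {true} h = refl , h

not-true : ∀ {a} → not a ≡ true → a ≡ false
not-true {false} _ = refl

≡true⇒T : ∀ {b} → b ≡ true → T b
≡true⇒T refl = tt

T⇒≡true : ∀ {b} → T b → b ≡ true
T⇒≡true {true} _ = refl

sumᴸ : (X → ℚ) → List X → ℚ
sumᴸ f []       = 0ℚ
sumᴸ f (x ∷ xs) = f x + sumᴸ f xs

sumᴸ-filterᵇ : (f : X → ℚ) (P : X → Bool) (xs : List X) → sumᴸ f (filterᵇ P xs) ≡ sumᴸ (λ x → ⟦ P x ⟧ * f x) xs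
sumᴸ-filterᵇ f P []       = refl
sumᴸ-filterᵇ f P (x ∷ xs) with P x
... | true  = cong₂ _+_ (sym (ℚₚ.*-identityˡ (f x))) (sumᴸ-filterᵇ f P xs)
... | false = trans (sumᴸ-filterᵇ f P xs) (sym (trans (cong (_+ rest) (ℚₚ.*-zeroˡ (f x))) (ℚₚ.+-identityˡ rest)))
  where rest = sumᴸ (λ y → ⟦ P y ⟧ * f y) xs

sumᴸ-tabulate : (f : X → ℚ) (g : Fin n → X) → sumᴸ f (List.tabulate g) ≡ sum (f ∘ g)
sumᴸ-tabulate {n = zero}  f g = refl
sumᴸ-tabulate {n = suc n} f g = cong (f (g zero) +_) (sumᴸ-tabulate f (g ∘ suc))

sumᴸ-map : (f : Y → ℚ) (g : X → Y) (xs : List X) → sumᴸ f (map g xs) ≡ sumᴸ (f ∘ g) xs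
sumᴸ-map f g []       = refl
sumᴸ-map f g (x ∷ xs) = cong (f (g x) +_) (sumᴸ-map f g xs)

sumᴸ-1 : (xs : List X) → sumᴸ (λ _ → 1ℚ) xs ≡ fromℕ (length xs)
sumᴸ-1 []       = refl
sumᴸ-1 (_ ∷ xs) = trans (cong (1ℚ +_) (sumᴸ-1 xs)) (sym (fromℕ-suc (length xs)))

E-equal-weights : (w : ℚ) (xs : List X) (f : X → ℚ) → E (map (λ x → w , x) xs) f ≡ w * sumᴸ f xs
E-equal-weights w []       f = sym (ℚₚ.*-zeroʳ w)
E-equal-weights w (x ∷ xs) f = trans (cong (w * f x +_) (E-equal-weights w xs f)) (sym (ℚₚ.*-distribˡ-+ w (f x) (sumᴸ f xs)))

E-uniform : (xs : List X) (f : X → ℚ) → E (uniform xs) f ≡ 1 // length xs * sumᴸ f xs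
E-uniform xs f = E-equal-weights (1 // length xs) xs f

isLaw-uniform : (x : X) (xs : List X) → IsLaw (uniform (x ∷ xs))
isLaw-uniform x xs = law (All.map⁺ (All.universal (λ _ → 0≤// 1 (length (x ∷ xs))) (x ∷ xs)))
  (trans (E-uniform (x ∷ xs) (λ _ → 1ℚ)) (trans (cong (1 // length (x ∷ xs) *_) (sumᴸ-1 (x ∷ xs))) (//-*-cancel 1 (length xs))))

isLaw-uniformMaybe : (xs : List X) → IsLaw (uniformMaybe xs)
isLaw-uniformMaybe []       = isLaw-return nothing
isLaw-uniformMaybe (x ∷ xs) = isLaw-uniform (just x) (map just xs)

E-uniformMaybe : (xs : List X) (f : Maybe X → ℚ) → f nothing ≡ 0ℚ →
  E (uniformMaybe xs) f ≡ 1 // length xs * sumᴸ (f ∘ just) xs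
E-uniformMaybe []         f f0 = trans (E-return nothing f) f0
E-uniformMaybe xs@(_ ∷ _) f f0 = trans (E-uniform (map just xs) f)
  (cong₂ (λ k S → 1 // k * S) (length-map xs) (sumᴸ-map f just xs))
  where
  length-map : (xs : List X) → length (map {B = Maybe X} just xs) ≡ length xs
  length-map []       = refl
  length-map (_ ∷ xs) = cong suc (length-map xs)

sum-delta : (c : Fin n → ℚ) (v : Fin n) → sum (λ w → c w * ⟦ does (w ≟F v) ⟧) ≡ c v
sum-delta c zero    = trans (cong₂ _+_ (ℚₚ.*-identityʳ (c zero)) (sum-zero (λ i → ℚₚ.*-zeroʳ (c (suc i))))) (ℚₚ.+-identityʳ (c zero))
sum-delta c (suc v) = trans (cong₂ _+_ (ℚₚ.*-zeroʳ (c zero)) (sum-delta (c ∘ suc) v)) (ℚₚ.+-identityˡ (c (suc v)))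

count-tabulate : (f : Fin n → Bool) → fromℕ ∣ tabulate f ∣ ≡ sum (λ i → ⟦ f i ⟧)
count-tabulate {zero}  f = refl
count-tabulate {suc n} f with f zero
... | true  = trans (fromℕ-suc ∣ tabulate (f ∘ suc) ∣) (cong (1ℚ +_) (count-tabulate (f ∘ suc)))
... | false = trans (count-tabulate (f ∘ suc)) (sym (ℚₚ.+-identityˡ (sum (λ i → ⟦ f (suc i) ⟧))))

degree-sum : (G : Graph n) (u : Fin n) → fromℕ (degree G u) ≡ sum (λ v → ⟦ adj G u v ⟧)
degree-sum {n} G u = begin
  fromℕ (degree G u)                                   ≡⟨ sumᴸ-1 (neighbors G u) ⟨
  sumᴸ (λ _ → 1ℚ) (neighbors G u)                      ≡⟨ sumᴸ-filterᵇ (λ _ → 1ℚ) (adj G u) (allFin n) ⟩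
  sumᴸ (λ v → ⟦ adj G u v ⟧ * 1ℚ) (allFin n)           ≡⟨ sumᴸ-tabulate (λ v → ⟦ adj G u v ⟧ * 1ℚ) id ⟩
  sum (λ v → ⟦ adj G u v ⟧ * 1ℚ)                       ≡⟨ sum-cong-≗ (λ v → ℚₚ.*-identityʳ ⟦ adj G u v ⟧) ⟩
  sum (λ v → ⟦ adj G u v ⟧)                            ∎
  where open ≡-Reasoning

module Proposing (G : Graph n) (b : Fin n → Bool) where

  candidates : Fin n → List (Fin n)
  candidates u = filterᵇ (λ v → not (b v)) (neighbors G u)

  d : Fin n → ℕ
  d u = length (candidates u)

  eligible : Fin n → Fin n → ℚ
  eligible u v = ⟦ adj G u v ⟧ * ⟦ not (b v) ⟧

  sumᴸ-candidates : ∀ u (f : Fin n → ℚ) → sumᴸ f (candidates u) ≡ sum (λ v → eligible u v * f v)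
  sumᴸ-candidates u f = begin
    sumᴸ f (candidates u)                                           ≡⟨ sumᴸ-filterᵇ f (λ v → not (b v)) (neighbors G u) ⟩
    sumᴸ (λ v → ⟦ not (b v) ⟧ * f v) (neighbors G u)                ≡⟨ sumᴸ-filterᵇ _ (adj G u) (allFin n) ⟩
    sumᴸ (λ v → ⟦ adj G u v ⟧ * (⟦ not (b v) ⟧ * f v)) (allFin n)   ≡⟨ sumᴸ-tabulate (λ v → ⟦ adj G u v ⟧ * (⟦ not (b v) ⟧ * f v)) id ⟩
    sum (λ v → ⟦ adj G u v ⟧ * (⟦ not (b v) ⟧ * f v))               ≡⟨ sum-cong-≗ (λ v → ℚₚ.*-assoc ⟦ adj G u v ⟧ ⟦ not (b v) ⟧ (f v)) ⟨
    sum (λ v → eligible u v * f v)                                  ∎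
    where open ≡-Reasoning

  d-sum : ∀ u → fromℕ (d u) ≡ sum (eligible u)
  d-sum u = trans (sym (sumᴸ-1 (candidates u))) (trans (sumᴸ-candidates u (λ _ → 1ℚ)) (sum-cong-≗ (λ v → ℚₚ.*-identityʳ (eligible u v))))

  eligible-nonNeg : ∀ u v → 0ℚ ≤ eligible u v
  eligible-nonNeg u v = 0≤* (0≤⟦⟧ (adj G u v)) (0≤⟦⟧ (not (b v)))

  eligible≤adj : ∀ u v → eligible u v ≤ ⟦ adj G u v ⟧
  eligible≤adj u v = ≤-trans (*-monoˡ (0≤⟦⟧ (adj G u v)) (⟦⟧≤1 (not (b v)))) (≤-reflexive (ℚₚ.*-identityʳ ⟦ adj G u v ⟧))

  eligible≤1 : ∀ u v → eligible u v ≤ 1ℚ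
  eligible≤1 u v = ≤-trans (eligible≤adj u v) (⟦⟧≤1 (adj G u v))

  d≥1 : ∀ {u v} → adj G u v ≡ true → b v ≡ false → 1ℚ ≤ fromℕ (d u)
  d≥1 {u} {v} uv bv = begin
    1ℚ                       ≡⟨ cong₂ (λ e f → ⟦ e ⟧ * ⟦ not f ⟧) uv bv ⟨
    eligible u v             ≤⟨ term≤sum (eligible-nonNeg u) v ⟩
    sum (eligible u)         ≡⟨ d-sum u ⟨
    fromℕ (d u)              ∎
    where open ≤-Reasoning

  1/d*d : ∀ {u} → 1ℚ ≤ fromℕ (d u) → 1 // d u * fromℕ (d u) ≡ 1ℚ
  1/d*d {u} h = go (d u) h
    where
    go : ∀ k → 1ℚ ≤ fromℕ k → 1 // k * fromℕ k ≡ 1ℚ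
    go zero    h = contradiction (ℚₚ.<-≤-trans 0<1 h) (ℚₚ.<-irrefl refl)
    go (suc k) _ = //-*-cancel 1 k

  1/d≤1 : ∀ u → 1 // d u ≤ 1ℚ
  1/d≤1 u = go (d u)
    where
    go : ∀ k → 1 // k ≤ 1ℚ
    go zero    = 0≤1
    go (suc k) = begin
      1 // suc k                            ≤⟨ ≤-+ʳ (0≤* (0≤// 1 (suc k)) (0≤fromℕ k)) (expand (1 // suc k) (fromℕ k)) ⟩
      (1 // suc k) * (1ℚ + fromℕ k)         ≡⟨ cong ((1 // suc k) *_) (fromℕ-suc k) ⟨
      (1 // suc k) * fromℕ (suc k)          ≡⟨ //-*-cancel 1 k ⟩
      1ℚ                                    ∎
      where
      open ≤-Reasoning
      expand : ∀ a k → a * (1ℚ + k) ≡ a + a * k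
      expand = solve-∀ ℚring

  -- The probability that u proposes to v; if d u = 0, then eligible u v = 0 as well.
  π : Fin n → Fin n → ℚ
  π u v = ⟦ b u ⟧ * (1 // d u * eligible u v)

  isLaw-propose : ∀ u → IsLaw (propose G b u)
  isLaw-propose u with b u
  ... | true  = isLaw-uniformMaybe (candidates u)
  ... | false = isLaw-return nothing

  E-propose : ∀ u (f : Maybe (Fin n) → ℚ) → f nothing ≡ 0ℚ → E (propose G b u) f ≡ sum (λ v → π u v * f (just v))
  E-propose u f f0 with b u
  ... | false = trans (E-return nothing f) (trans f0 (sym (sum-zero (λ v → identity (1 // d u * eligible u v) (f (just v))))))
    where
    identity : ∀ a c → 0ℚ * a * c ≡ 0ℚ
    identity = solve-∀ ℚring
  ... | true  = begin
    E (uniformMaybe (candidates u)) f                          ≡⟨ E-uniformMaybe (candidates u) f f0 ⟩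
    1 // d u * sumᴸ (f ∘ just) (candidates u)                  ≡⟨ cong (1 // d u *_) (sumᴸ-candidates u (f ∘ just)) ⟩
    1 // d u * sum (λ v → eligible u v * f (just v))           ≡⟨ *-distribˡ-sum (1 // d u) (λ v → eligible u v * f (just v)) ⟩
    sum (λ v → 1 // d u * (eligible u v * f (just v)))         ≡⟨ sum-cong-≗ (λ v → identity (1 // d u) (eligible u v) (f (just v))) ⟩
    sum (λ v → 1ℚ * (1 // d u * eligible u v) * f (just v))    ∎
    where
    open ≡-Reasoning
    identity : ∀ a c e → a * (c * e) ≡ 1ℚ * (a * c) * e
    identity = solve-∀ ℚring

  π-nonNeg : ∀ u v → 0ℚ ≤ π u v
  π-nonNeg u v = 0≤* (0≤⟦⟧ (b u)) (0≤* (0≤// 1 (d u)) (eligible-nonNeg u v))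

  π≤1 : ∀ u v → π u v ≤ 1ℚ
  π≤1 u v = *-mono (0≤⟦⟧ (b u)) 0≤1 (⟦⟧≤1 (b u)) (*-mono (0≤// 1 (d u)) 0≤1 (1/d≤1 u) (eligible≤1 u v))

  π-row : ∀ {u} → b u ≡ true → 1ℚ ≤ fromℕ (d u) → sum (π u) ≡ 1ℚ
  π-row {u} bu h rewrite bu = begin
    sum (λ v → 1ℚ * (1 // d u * eligible u v))   ≡⟨ sum-cong-≗ (λ v → ℚₚ.*-identityˡ (1 // d u * eligible u v)) ⟩
    sum (λ v → 1 // d u * eligible u v)          ≡⟨ *-distribˡ-sum (1 // d u) (eligible u) ⟨
    1 // d u * sum (eligible u)                  ≡⟨ cong (1 // d u *_) (d-sum u) ⟨
    1 // d u * fromℕ (d u)                       ≡⟨ 1/d*d h ⟩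
    1ℚ                                           ∎
    where open ≡-Reasoning

  -- The probability that v receives a proposal; H is the expected number of connections.
  hit : Fin n → ℚ
  hit v = 1ℚ - prod (λ u → 1ℚ - π u v)

  H : ℚ
  H = sum hit

  0≤1-π : ∀ u v → 0ℚ ≤ 1ℚ - π u v
  0≤1-π u v = p≤q⇒0≤q-p (π≤1 u v)

  1-π≤1 : ∀ u v → 1ℚ - π u v ≤ 1ℚ
  1-π≤1 u v = ≤-+ʳ (π-nonNeg u v) (identity (π u v))
    where
    identity : ∀ a → 1ℚ ≡ 1ℚ - a + a
    identity = solve-∀ ℚring

  π≤hit : ∀ u v → π u v ≤ hit v
  π≤hit u v = ≤-+ʳ (p≤q⇒0≤q-p (prod≤factor (λ u → 0≤1-π u v) (λ u → 1-π≤1 u v) u)) (identity (π u v) (prod (λ u → 1ℚ - π u v)))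
    where
    identity : ∀ a P → 1ℚ - P ≡ a + (1ℚ - a - P)
    identity = solve-∀ ℚring

  hit-nonNeg : ∀ v → 0ℚ ≤ hit v
  hit-nonNeg v = p≤q⇒0≤q-p (prod-≤1 (λ u → 0≤1-π u v) (λ u → 1-π≤1 u v))

  H-nonNeg : 0ℚ ≤ H
  H-nonNeg = sum-nonNeg hit-nonNeg

  H≥1 : ∀ {u v} → adj G u v ≡ true → b u ≡ true → b v ≡ false → 1ℚ ≤ H
  H≥1 {u} uv bu bv = ≤-trans (≤-reflexive (sym (π-row bu (d≥1 uv bv)))) (sum-mono (π≤hit u))

  isTo : Fin n → Maybe (Fin n) → Bool
  isTo v (just w) = does (w ≟F v)
  isTo v nothing  = false

  -- The indicator of the event that some entry of the proposal vector is v.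
  hitBy : Proposals n → Fin n → ℚ
  hitBy p v = 1ℚ - prod (λ u → 1ℚ - ⟦ isTo v (lookup p u) ⟧)

  E-hits : E (independent (propose G b)) (λ p → sum (hitBy p)) ≡ H
  E-hits = trans (E-sum (independent (propose G b)) (λ v p → hitBy p v)) (sum-cong-≗ λ v →
    trans (E-complement (isLaw-independent isLaw-propose) _)
      (cong (λ q → 1ℚ - q) (trans (E-independent-prod (propose G b) (λ u x → 1ℚ - ⟦ isTo v x ⟧))
        (prod-cong λ u → trans (E-complement (isLaw-propose u) _)
          (cong (λ q → 1ℚ - q) (trans (E-propose u (λ x → ⟦ isTo v x ⟧) refl) (sum-delta (π u) v)))))))

-- Vertex expansion forces many expected connections

∨-falseˡ : ∀ {a b} → a ∨ b ≡ false → a ≡ false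
∨-falseˡ {false} _ = refl

¬true⇒false : ∀ {b} → b ≢ true → b ≡ false
¬true⇒false {false} _ = refl
¬true⇒false {true}  h = contradiction refl h

count-not : (f : Fin n → Bool) → ∣ tabulate f ∣ ℕ.+ ∣ tabulate (not ∘ f) ∣ ≡ n
count-not {zero}  f = refl
count-not {suc n} f with f zero
... | true  = cong suc (count-not (f ∘ suc))
... | false = trans (ℕₚ.+-suc ∣ tabulate (f ∘ suc) ∣ _) (cong suc (count-not (f ∘ suc)))

≢false⇒true : ∀ {b} → b ≢ false → b ≡ true
≢false⇒true {true}  _ = refl
≢false⇒true {false} h = contradiction refl h

∨-trueʳ : ∀ a {b} → b ≡ true → a ∨ b ≡ true
∨-trueʳ true  _ = refl
∨-trueʳ false h = h

true≢false : ∀ {b} → b ≡ true → b ≢ false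
true≢false refl ()

⟦⟧-≤ : ∀ b → 0ℚ ≤ q → (b ≡ true → 1ℚ ≤ q) → ⟦ b ⟧ ≤ q
⟦⟧-≤ true  _   h = h refl
⟦⟧-≤ false 0≤q _ = 0≤q

⟦⟧*-≤ : ∀ b → 0ℚ ≤ q → (b ≡ true → s * p ≤ q) → s * (⟦ b ⟧ * p) ≤ q
⟦⟧*-≤ {q} {s} {p} true  _   h = subst (λ p → s * p ≤ q) (sym (ℚₚ.*-identityˡ p)) (h refl)
⟦⟧*-≤ {q} {s} {p} false 0≤q _ = subst (_≤ q) (identity s p) 0≤q
  where
  identity : ∀ s p → 0ℚ ≡ s * (0ℚ * p)
  identity = solve-∀ ℚring

⟦⟧*-1 : ∀ b → (b ≡ true → p ≡ 1ℚ) → ⟦ b ⟧ * p ≡ ⟦ b ⟧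
⟦⟧*-1     true  h = cong (1ℚ *_) (h refl)
⟦⟧*-1 {p} false h = ℚₚ.*-zeroˡ p

length≢0⇒∈ : (xs : List X) → length xs ≢ 0 → ∃ λ x → x L.∈ xs
length≢0⇒∈ []      h = contradiction refl h
length≢0⇒∈ (x ∷ _) _ = x , here refl

∈-tabulate⇒ : (f : Fin n → Bool) {v : Fin n} → v ∈ tabulate f → f v ≡ true
∈-tabulate⇒ f {v} v∈ = trans (sym (Vecₚ.lookup∘tabulate f v)) (Vecₚ.[]=⇒lookup v∈)

⇒∈-tabulate : (f : Fin n → Bool) {v : Fin n} → f v ≡ true → v ∈ tabulate f
⇒∈-tabulate f {v} fv = Vecₚ.lookup⇒[]= v (tabulate f) (trans (Vecₚ.lookup∘tabulate f v) fv)

∈-boundary : (G : Graph n) (S : Subset n) {v : Fin n} → v ∈ boundary G S →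
  lookup S v ≡ false × ∃ λ w → adj G v w ≡ true × w ∈ S
∈-boundary G S {v} v∈ with ∧-true {not (lookup S v)} (∈-tabulate⇒ _ v∈)
... | v∉S , h with length≢0⇒∈ (filter (Subₚ._∈? S) (neighbors G v)) (λ eq → contradiction (trans (sym h) (cong (λ k → not (k ℕ.≡ᵇ 0)) eq)) λ ())
... | w , w∈ with L.∈-filter⁻ (Subₚ._∈? S) {xs = neighbors G v} w∈
... | w∈N , w∈S = not-true v∉S , w , T⇒≡true (proj₂ (L.∈-filter⁻ (T? ∘ adj G v) {xs = allFin _} w∈N)) , w∈S

module Cover {n} (G : Graph n) (b : Fin n → Bool) {s : ℚ} {Δ : ℕ} (1≤s : 1ℚ ≤ s)
  (degree≤Δ : ∀ u → degree G u ℕ.≤ Δ) (Δ≤s² : fromℕ Δ ≤ s * s) where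

  open Proposing G b

  0≤s : 0ℚ ≤ s
  0≤s = ≤-trans 0≤1 1≤s

  -- The proposers with more than s candidates and the candidates of the other proposers
  -- cover all edges between proposers and acceptors.
  few : Fin n → Bool
  few u = does (fromℕ (d u) ℚₚ.≤? s)

  many : Fin n → Bool
  many u = b u ∧ not (few u)

  reached : Fin n → Bool
  reached v = not (b v) ∧ does (any? λ u → T? (adj G u v ∧ (b u ∧ few u)))

  covered : Fin n → Bool
  covered v = many v ∨ reached v

  cover-edge : ∀ {u v} → adj G u v ≡ true → b u ≡ true → b v ≡ false → covered u ≡ false → covered v ≡ true
  cover-edge {u} {v} uv bu bv cu = ∨-trueʳ (many v) (cong₂ _∧_ (cong not bv)
    (dec-true (any? λ u → T? (adj G u v ∧ (b u ∧ few u))) (u , ≡true⇒T (cong₂ _∧_ uv (cong₂ _∧_ bu few-u)))))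
    where
    few-u : few u ≡ true
    few-u = lemma′ (b u) (few u) bu (∨-falseˡ {many u} {reached u} cu)
      where
      lemma′ : ∀ B F → B ≡ true → B ∧ not F ≡ false → F ≡ true
      lemma′ true true _ _ = refl

  reached≤s*hit : ∀ v → ⟦ reached v ⟧ ≤ s * hit v
  reached≤s*hit v = ⟦⟧-≤ (reached v) (0≤* 0≤s (hit-nonNeg v)) λ rv →
    let bv , h = ∧-true {not (b v)} rv
        u , Tu = does⇒ (any? λ u → T? (adj G u v ∧ (b u ∧ few u))) h
        uv , h′ = ∧-true {adj G u v} (T⇒≡true Tu)
        bu , fu = ∧-true {b u} h′
    in 1≤s*hit uv bu (not-true bv) fu
    where
    1≤s*hit : ∀ {u} → adj G u v ≡ true → b u ≡ true → b v ≡ false → few u ≡ true → 1ℚ ≤ s * hit v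
    1≤s*hit {u} uv bu bv fu = begin
      1ℚ                      ≡⟨ 1/d*d 1≤d ⟨
      1 // d u * fromℕ (d u)  ≡⟨ cong (_* fromℕ (d u)) π≡ ⟨
      π u v * fromℕ (d u)     ≡⟨ ℚₚ.*-comm (π u v) (fromℕ (d u)) ⟩
      fromℕ (d u) * π u v     ≤⟨ *-mono (0≤fromℕ (d u)) (hit-nonNeg v) (does⇒ (fromℕ (d u) ℚₚ.≤? s) fu) (π≤hit u v) ⟩
      s * hit v               ∎
      where
      open ≤-Reasoning
      1≤d : 1ℚ ≤ fromℕ (d u)
      1≤d = d≥1 uv bv
      π≡ : π u v ≡ 1 // d u
      π≡ = trans (cong₂ (λ B e → ⟦ B ⟧ * (1 // d u * e)) bu (cong₂ (λ a c → ⟦ a ⟧ * ⟦ not c ⟧) uv bv)) (identity (1 // d u))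
        where
        identity : ∀ a → 1ℚ * (a * (1ℚ * 1ℚ)) ≡ a
        identity = solve-∀ ℚring

  -- Every v receives at most Δ proposals, each with probability at most 1/s, from the
  -- proposers with many candidates, so its load is at most Δ/s ≤ s.
  share : Fin n → Fin n → ℚ
  share u v = ⟦ many u ⟧ * π u v

  share-nonNeg : ∀ u v → 0ℚ ≤ share u v
  share-nonNeg u v = 0≤* (0≤⟦⟧ (many u)) (π-nonNeg u v)

  share≤π : ∀ u v → share u v ≤ π u v
  share≤π u v = ≤-trans (*-monoʳ (π-nonNeg u v) (⟦⟧≤1 (many u))) (≤-reflexive (ℚₚ.*-identityˡ (π u v)))

  many⇒s≤d : ∀ {u} → many u ≡ true → s ≤ fromℕ (d u)
  many⇒s≤d {u} mu = ℚₚ.<⇒≤ (ℚₚ.≰⇒> (does⇒¬ (fromℕ (d u) ℚₚ.≤? s) (not-true (proj₂ (∧-true {b u} mu)))))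

  share-row : ∀ u → sum (share u) ≡ ⟦ many u ⟧
  share-row u = trans (sym (*-distribˡ-sum ⟦ many u ⟧ (π u)))
    (⟦⟧*-1 {p = sum (π u)} (many u) λ mu → π-row (proj₁ (∧-true {b u} mu)) (≤-trans 1≤s (many⇒s≤d mu)))

  s*share≤adj : ∀ u v → s * share u v ≤ ⟦ adj G u v ⟧
  s*share≤adj u v = ⟦⟧*-≤ {s = s} {p = π u v} (many u) (0≤⟦⟧ (adj G u v)) λ mu → begin
    s * π u v                                   ≤⟨ *-monoˡ 0≤s (*-monoʳ (0≤* (0≤// 1 (d u)) (eligible-nonNeg u v)) (⟦⟧≤1 (b u))) ⟩
    s * (1ℚ * (1 // d u * eligible u v))        ≡⟨ identity s (1 // d u) (eligible u v) ⟩
    (s * (1 // d u)) * eligible u v               ≤⟨ *-monoʳ (eligible-nonNeg u v) (*-monoʳ (0≤// 1 (d u)) (many⇒s≤d mu)) ⟩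
    (fromℕ (d u) * (1 // d u)) * eligible u v     ≡⟨ cong (_* eligible u v) (trans (ℚₚ.*-comm (fromℕ (d u)) (1 // d u)) (1/d*d (≤-trans 1≤s (many⇒s≤d mu)))) ⟩
    1ℚ * eligible u v                           ≡⟨ ℚₚ.*-identityˡ (eligible u v) ⟩
    eligible u v                                ≤⟨ eligible≤adj u v ⟩
    ⟦ adj G u v ⟧                               ∎
    where
    open ≤-Reasoning
    identity : ∀ s a e → s * (1ℚ * (a * e)) ≡ s * a * e
    identity = solve-∀ ℚring

  load : Fin n → ℚ
  load v = sum (λ u → share u v)

  load≤s : ∀ v → load v ≤ s
  load≤s v = *-cancelˡ (ℚₚ.<-≤-trans 0<1 1≤s) (begin
    s * load v                            ≡⟨ *-distribˡ-sum s (λ u → share u v) ⟩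
    sum (λ u → s * share u v)             ≤⟨ sum-mono (λ u → s*share≤adj u v) ⟩
    sum (λ u → ⟦ adj G u v ⟧)             ≡⟨ sum-cong-≗ (λ u → cong ⟦_⟧ (symmetric G u v)) ⟩
    sum (λ u → ⟦ adj G v u ⟧)             ≡⟨ degree-sum G v ⟨
    fromℕ (degree G v)                    ≤⟨ fromℕ-mono (degree≤Δ v) ⟩
    fromℕ Δ                               ≤⟨ Δ≤s² ⟩
    s * s                                 ∎)
    where open ≤-Reasoning

  load≤hit : ∀ v → load v ≤ (1ℚ + s) * hit v
  load≤hit v = begin
    W                      ≤⟨ ≤-+ʳ (p≤q⇒0≤q-p (prod-complement-bound (λ u → π u v) (λ u → share u v) (λ u → share-nonNeg u v) (λ u → share≤π u v) (λ u → π≤1 u v))) (identity W P) ⟩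
    (1ℚ + W) * (1ℚ - P)    ≤⟨ *-monoʳ (hit-nonNeg v) (ℚₚ.+-monoʳ-≤ 1ℚ (load≤s v)) ⟩
    (1ℚ + s) * hit v       ∎
    where
    open ≤-Reasoning
    W = load v
    P = prod (λ u → 1ℚ - π u v)
    identity : ∀ W P → (1ℚ + W) * (1ℚ - P) ≡ W + (1ℚ - P * (1ℚ + W))
    identity = solve-∀ ℚring

  count-reached : sum (λ v → ⟦ reached v ⟧) ≤ s * H
  count-reached = ≤-trans (sum-mono reached≤s*hit) (≤-reflexive (sym (*-distribˡ-sum s hit)))

  count-many : sum (λ u → ⟦ many u ⟧) ≤ (1ℚ + s) * H
  count-many = begin
    sum (λ u → ⟦ many u ⟧)             ≡⟨ sum-cong-≗ share-row ⟨
    sum (λ u → sum (λ v → share u v))  ≡⟨ ∑-comm share ⟩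
    sum load                           ≤⟨ sum-mono load≤hit ⟩
    sum (λ v → (1ℚ + s) * hit v)       ≡⟨ *-distribˡ-sum (1ℚ + s) hit ⟨
    (1ℚ + s) * H                       ∎
    where open ≤-Reasoning

  cover-size : fromℕ ∣ tabulate covered ∣ ≤ (s + s + s) * H
  cover-size = begin
    fromℕ ∣ tabulate covered ∣                             ≡⟨ count-tabulate covered ⟩
    sum (λ v → ⟦ covered v ⟧)                              ≤⟨ sum-mono (λ v → ⟦∨⟧≤ (many v) (reached v)) ⟩
    sum (λ v → ⟦ many v ⟧ + ⟦ reached v ⟧)                 ≡⟨ ∑-distrib-+ (λ v → ⟦ many v ⟧) (λ v → ⟦ reached v ⟧) ⟩
    sum (λ v → ⟦ many v ⟧) + sum (λ v → ⟦ reached v ⟧)     ≤⟨ ℚₚ.+-mono-≤ count-many count-reached ⟩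
    (1ℚ + s) * H + s * H                                   ≤⟨ ≤-+ʳ (0≤* (p≤q⇒0≤q-p 1≤s) H-nonNeg) (identity s H) ⟩
    (s + s + s) * H                                        ∎
    where
    open ≤-Reasoning
    identity : ∀ s h → (s + s + s) * h ≡ ((1ℚ + s) * h + s * h) + (s - 1ℚ) * h
    identity = solve-∀ ℚring
    ⟦∨⟧≤ : ∀ a c → ⟦ a ∨ c ⟧ ≤ ⟦ a ⟧ + ⟦ c ⟧
    ⟦∨⟧≤ true  c = ≤-+ʳ (0≤⟦⟧ c) refl
    ⟦∨⟧≤ false c = ≤-reflexive (sym (ℚₚ.+-identityˡ ⟦ c ⟧))

  module _ {α : ℚ} (0≤α : 0ℚ ≤ α) (α≤2 : α ≤ 1ℚ + 1ℚ)
    (expands : ∀ S → 2 ℕ.* ∣ S ∣ ℕ.≤ n → α * fromℕ ∣ S ∣ ≤ fromℕ ∣ boundary G S ∣) where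

    side-bound : (side : Fin n → Bool) → 2 ℕ.* ∣ tabulate side ∣ ℕ.≤ n →
      (∀ {v w} → adj G v w ≡ true → side v ≡ false → side w ≡ true → covered w ≡ false → covered v ≡ true) →
      α * fromℕ ∣ tabulate side ∣ ≤ (1ℚ + 1ℚ + 1ℚ) * fromℕ ∣ tabulate covered ∣
    side-bound side small crosses = begin
      α * fromℕ ∣ tabulate side ∣                    ≤⟨ *-monoˡ 0≤α side≤ ⟩
      α * (fromℕ ∣ S ∣ + K)                          ≡⟨ ℚₚ.*-distribˡ-+ α (fromℕ ∣ S ∣) K ⟩
      α * fromℕ ∣ S ∣ + α * K                        ≤⟨ ℚₚ.+-mono-≤ (expands S (ℕₚ.≤-trans (ℕₚ.*-monoʳ-≤ 2 (Subₚ.p⊆q⇒∣p∣≤∣q∣ S⊆side)) small)) (*-monoʳ (0≤fromℕ ∣ tabulate covered ∣) α≤2) ⟩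
      fromℕ ∣ boundary G S ∣ + (1ℚ + 1ℚ) * K         ≤⟨ ℚₚ.+-monoˡ-≤ ((1ℚ + 1ℚ) * K) (fromℕ-mono (Subₚ.p⊆q⇒∣p∣≤∣q∣ ∂S⊆K)) ⟩
      K + (1ℚ + 1ℚ) * K                              ≡⟨ identity K ⟩
      (1ℚ + 1ℚ + 1ℚ) * K                             ∎
      where
      open ≤-Reasoning
      inS : Fin n → Bool
      inS v = side v ∧ not (covered v)
      S = tabulate inS
      K = fromℕ ∣ tabulate covered ∣
      identity : ∀ K → K + (1ℚ + 1ℚ) * K ≡ (1ℚ + 1ℚ + 1ℚ) * K
      identity = solve-∀ ℚring
      S⊆side : S ⊆ tabulate side
      S⊆side {v} v∈ = ⇒∈-tabulate side (proj₁ (∧-true {side v} (∈-tabulate⇒ inS v∈)))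
      side≤ : fromℕ ∣ tabulate side ∣ ≤ fromℕ ∣ S ∣ + K
      side≤ = begin
        fromℕ ∣ tabulate side ∣                              ≡⟨ count-tabulate side ⟩
        sum (λ v → ⟦ side v ⟧)                               ≤⟨ sum-mono (λ v → split (side v) (covered v)) ⟩
        sum (λ v → ⟦ inS v ⟧ + ⟦ covered v ⟧)                ≡⟨ ∑-distrib-+ (λ v → ⟦ inS v ⟧) (λ v → ⟦ covered v ⟧) ⟩
        sum (λ v → ⟦ inS v ⟧) + sum (λ v → ⟦ covered v ⟧)    ≡⟨ cong₂ _+_ (count-tabulate inS) (count-tabulate covered) ⟨
        fromℕ ∣ S ∣ + K                                      ∎
        where
        split : ∀ a c → ⟦ a ⟧ ≤ ⟦ a ∧ not c ⟧ + ⟦ c ⟧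
        split true  true  = ≤-refl
        split true  false = ≤-refl
        split false true  = 0≤1
        split false false = ≤-refl
      ∂S⊆K : boundary G S ⊆ tabulate covered
      ∂S⊆K {v} v∈ =
        let v∉S , w , vw , w∈S = ∈-boundary G S v∈
            sw , ncw = ∧-true {side w} (∈-tabulate⇒ inS w∈S)
        in ⇒∈-tabulate covered (≢false⇒true λ cv →
          true≢false (crosses vw (¬true⇒false λ sv →
            true≢false (⇒inS sv cv) (trans (sym (Vecₚ.lookup∘tabulate inS v)) v∉S)) sw (not-true ncw)) cv)
        where
        ⇒inS : side v ≡ true → covered v ≡ false → inS v ≡ true
        ⇒inS sv cv = cong₂ (λ a c → a ∧ not c) sv cv

    private
      bound : ℚ
      bound = (1ℚ + 1ℚ + 1ℚ) * ((s + s + s) * H)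
      identity : ∀ s n h → (1ℚ + 1ℚ + 1ℚ) * ((s + s + s) * h) * n ≡ fromℕ 9 * s * n * h
      identity = solve-∀ ℚring
      count-nonNeg : (f : Fin n → Bool) → 0ℚ ≤ sum (λ v → ⟦ f v ⟧)
      count-nonNeg f = sum-nonNeg (λ v → 0≤⟦⟧ (f v))
      count≤n : (f : Fin n → Bool) → sum (λ v → ⟦ f v ⟧) ≤ fromℕ n
      count≤n f = ≤-trans (sum-mono (λ v → ⟦⟧≤1 (f v))) (≤-reflexive (sum-1 n))
      side≤bound : ∀ side → 2 ℕ.* ∣ tabulate side ∣ ℕ.≤ n →
        (∀ {v w} → adj G v w ≡ true → side v ≡ false → side w ≡ true → covered w ≡ false → covered v ≡ true) →
        α * sum (λ v → ⟦ side v ⟧) ≤ bound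
      side≤bound side small crosses = ≤-trans (≤-reflexive (cong (α *_) (sym (count-tabulate side))))
        (≤-trans (side-bound side small crosses) (*-monoˡ (0≤fromℕ 3) cover-size))
      αU≤ : 2 ℕ.* ∣ tabulate b ∣ ℕ.≤ n → α * sum (λ v → ⟦ b v ⟧) ≤ bound
      αU≤ small = side≤bound b small λ {v} {w} vw bv bw cw → cover-edge (trans (symmetric G w v) vw) bw bv cw
      αW≤ : 2 ℕ.* ∣ tabulate (not ∘ b) ∣ ℕ.≤ n → α * sum (λ v → ⟦ not (b v) ⟧) ≤ bound
      αW≤ small = side≤bound (not ∘ b) small crosses
        where
        crosses : ∀ {v w} → adj G v w ≡ true → not (b v) ≡ false → not (b w) ≡ true → covered w ≡ false → covered v ≡ true
        crosses {v} {w} vw bv bw cw = ≢false⇒true λ cv → true≢false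
          (cover-edge vw (trans (sym (Boolₚ.not-involutive (b v))) (cong not bv)) (not-true bw) cv) cw
      U W : ℚ
      U = sum (λ v → ⟦ b v ⟧)
      W = sum (λ v → ⟦ not (b v) ⟧)

    cut-bound : α * (U * W) ≤ fromℕ 9 * s * fromℕ n * H
    cut-bound with 2 ℕ.* ∣ tabulate b ∣ ℕ.≤? n
    ... | yes small = begin
      α * (U * W)                           ≡⟨ ℚₚ.*-assoc α U W ⟨
      α * U * W                             ≤⟨ *-mono (0≤* 0≤α (count-nonNeg b)) (0≤fromℕ n) (αU≤ small) (count≤n (not ∘ b)) ⟩
      bound * fromℕ n                       ≡⟨ identity s (fromℕ n) H ⟩
      fromℕ 9 * s * fromℕ n * H             ∎
      where open ≤-Reasoning
    ... | no large = begin
      α * (U * W)                           ≡⟨ swap α U W ⟩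
      α * W * U                             ≤⟨ *-mono (0≤* 0≤α (count-nonNeg (not ∘ b))) (0≤fromℕ n) (αW≤ W-small) (count≤n b) ⟩
      bound * fromℕ n                       ≡⟨ identity s (fromℕ n) H ⟩
      fromℕ 9 * s * fromℕ n * H             ∎
      where
      open ≤-Reasoning
      swap : ∀ a u w → a * (u * w) ≡ a * w * u
      swap = solve-∀ ℚring
      W-small : 2 ℕ.* ∣ tabulate (not ∘ b) ∣ ℕ.≤ n
      W-small = ℕₚ.+-cancelˡ-≤ n _ _ (ℕₚ.≤-trans
        (ℕₚ.+-monoˡ-≤ (2 ℕ.* w) (ℕₚ.<⇒≤ (ℕₚ.≰⇒> large)))
        (ℕₚ.≤-reflexive (trans (sym (ℕₚ.*-distribˡ-+ 2 u w)) (trans (cong (2 ℕ.*_) (count-not b)) (cong (n ℕ.+_) (ℕₚ.+-identityʳ n))))))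
        where
        u = ∣ tabulate b ∣
        w = ∣ tabulate (not ∘ b) ∣

-- Token exchange

∈⇒true : {S : Subset n} {t : Fin n} → t ∈ S → lookup S t ≡ true
∈⇒true = Vecₚ.[]=⇒lookup

true⇒∈ : (S : Subset n) {t : Fin n} → lookup S t ≡ true → t ∈ S
true⇒∈ S {t} = Vecₚ.lookup⇒[]= t S

lookup-symmetricDifference : (A B : Subset n) (t : Fin n) → lookup (symmetricDifference A B) t ≡ lookup A t xor lookup B t
lookup-symmetricDifference (true  ∷ A) (true  ∷ B) zero    = refl
lookup-symmetricDifference (true  ∷ A) (false ∷ B) zero    = refl
lookup-symmetricDifference (false ∷ A) (true  ∷ B) zero    = refl
lookup-symmetricDifference (false ∷ A) (false ∷ B) zero    = refl
lookup-symmetricDifference (a     ∷ A) (b     ∷ B) (suc t) = lookup-symmetricDifference A B t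

≢⇒lookup-≢ : {A B : Subset n} → A ≢ B → ∃ λ t → lookup A t xor lookup B t ≡ true
≢⇒lookup-≢ {A = []}        {[]}        A≢B = contradiction refl A≢B
≢⇒lookup-≢ {A = true  ∷ A} {false ∷ B} A≢B = zero , refl
≢⇒lookup-≢ {A = false ∷ A} {true  ∷ B} A≢B = zero , refl
≢⇒lookup-≢ {A = true  ∷ A} {true  ∷ B} A≢B with t , h ← ≢⇒lookup-≢ (A≢B ∘ cong (true ∷_))  = suc t , h
≢⇒lookup-≢ {A = false ∷ A} {false ∷ B} A≢B with t , h ← ≢⇒lookup-≢ (A≢B ∘ cong (false ∷_)) = suc t , h

smallest : (S : Subset n) (t : Fin n) → lookup S t ≡ true → ∃ λ t → IsSmallest t S
smallest (true  ∷ S) t       h = zero , Vec.here , λ _ _ → ℕ.z≤n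
smallest (false ∷ S) (suc t) h with smallest S t h
... | t₀ , t₀∈S , least = suc t₀ , Vec.there t₀∈S , λ { (suc t′) (Vec.there t′∈S) → ℕ.s≤s (least t′ t′∈S) }

smallest-difference : {A B : Subset n} → A ≢ B → ∃ λ t → IsSmallest t (symmetricDifference A B)
smallest-difference {A = A} {B} A≢B with ≢⇒lookup-≢ A≢B
... | t , h = smallest (symmetricDifference A B) t (trans (lookup-symmetricDifference A B t) h)

module Potential {n N : ℕ} (ident : Fin n → Fin N) where

  member : TokenSet N → Fin n → ℕ
  member A w = if lookup A (ident w) then 1 else 0

  known : TokenSet N → ℕ
  known A = sumℕ (member A)

  Φ : State n N → ℕ
  Φ st = sumℕ (λ u → known (lookup st u))

  member≤1 : ∀ A w → member A w ℕ.≤ 1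
  member≤1 A w with lookup A (ident w)
  ... | true  = ℕₚ.≤-refl
  ... | false = ℕ.z≤n

  Φ≤n² : ∀ st → Φ st ℕ.≤ n ℕ.* n
  Φ≤n² st = sumℕ-bound λ u → ℕₚ.≤-trans (sumℕ-bound (member≤1 (lookup st u))) (ℕₚ.≤-reflexive (ℕₚ.*-identityʳ n))

  member-mono : ∀ {A B} → A ⊆ B → ∀ w → member A w ℕ.≤ member B w
  member-mono {A} {B} A⊆B w with lookup A (ident w) in wA
  ... | false = ℕ.z≤n
  ... | true  rewrite ∈⇒true (A⊆B (true⇒∈ A wA)) = ℕₚ.≤-refl

  known-mono : ∀ {A B} → A ⊆ B → known A ℕ.≤ known B
  known-mono A⊆B = sumℕ-mono (member-mono A⊆B)

  known-mono-< : ∀ {A B} → A ⊆ B → ∀ {w} → lookup A (ident w) ≡ false → ident w ∈ B → known A ℕ.< known B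
  known-mono-< {A} {B} A⊆B {w} w∉A w∈B = sumℕ-mono-< (member-mono A⊆B) w 0<1′
    where
    0<1′ : member A w ℕ.< member B w
    0<1′ rewrite w∉A | ∈⇒true w∈B = ℕₚ.≤-refl

  ValidAt : Fin n → TokenSet N → Set
  ValidAt u A = ident u ∈ A × (∀ t → t ∈ A → ∃ λ w → t ≡ ident w)

  Valid : State n N → Set
  Valid st = ∀ u → ValidAt u (lookup st u)

  valid-initial : Valid (initial ident)
  valid-initial u rewrite Vecₚ.lookup∘tabulate (λ u → ⁅ ident u ⁆) u =
    Subₚ.x∈⁅x⁆ (ident u) , λ t t∈ → u , Subₚ.x∈⁅y⁆⇒x≡y (ident u) t∈

lookup-update₂ : (P : Fin n → X → Set) (xs : Vec X n) (u v : Fin n) {A B : X} →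
  P u A → P v B → (∀ w → P w (lookup xs w)) → ∀ w → P w (lookup ((xs [ u ]≔ A) [ v ]≔ B) w)
lookup-update₂ P xs u v {A} {B} PA PB Pxs w with w ≟F v
... | yes refl = subst (P w) (sym (Vecₚ.lookup∘update w (xs [ u ]≔ A) B)) PB
... | no w≢v with w ≟F u
...   | yes refl = subst (P w) (sym (trans (Vecₚ.lookup∘update′ w≢v (xs [ u ]≔ A) B) (Vecₚ.lookup∘update w xs A))) PA
...   | no w≢u   = subst (P w) (sym (trans (Vecₚ.lookup∘update′ w≢v (xs [ u ]≔ A) B) (Vecₚ.lookup∘update′ w≢u xs A))) (Pxs w)

Disjoint : Fin n × Fin n → Fin n × Fin n → Set
Disjoint (u , v) (u′ , v′) = (u ≢ u′ × u ≢ v′) × (v ≢ u′ × v ≢ v′)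

module Exchanging {n N : ℕ} {δ : ℚ} (ident : Fin n → Fin N) (tr : Transfer N δ) (δ≤½ : δ ≤ ½)
  {y : ℚ} (0≤y : 0ℚ ≤ y) (4y≤1 : (y + y) + (y + y) ≤ 1ℚ) where

  open Potential ident
  open Transfer tr

  a β : ℚ
  a = 1ℚ - ((y + y) + (y + y))
  β = 1ℚ - (y + y)

  0≤2y : 0ℚ ≤ y + y
  0≤2y = 0≤+ 0≤y 0≤y

  0≤4y : 0ℚ ≤ (y + y) + (y + y)
  0≤4y = 0≤+ 0≤2y 0≤2y

  0≤a : 0ℚ ≤ a
  0≤a = p≤q⇒0≤q-p 4y≤1

  a≤1 : a ≤ 1ℚ
  a≤1 = ≤-+ʳ 0≤4y (identity y)
    where
    identity : ∀ y → 1ℚ ≡ 1ℚ - ((y + y) + (y + y)) + ((y + y) + (y + y))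
    identity = solve-∀ ℚring

  a≤β : a ≤ β
  a≤β = ≤-+ʳ 0≤2y (identity y)
    where
    identity : ∀ y → 1ℚ - (y + y) ≡ 1ℚ - ((y + y) + (y + y)) + (y + y)
    identity = solve-∀ ℚring

  0≤β : 0ℚ ≤ β
  0≤β = ≤-trans 0≤a a≤β

  weight : State n N → ℚ
  weight st = a ^ Φ st

  weight-nonNeg : ∀ st → 0ℚ ≤ weight st
  weight-nonNeg st = ^-nonNeg (Φ st) 0≤a

  Gains : TokenSet N → TokenSet N → TokenSet N × TokenSet N → Set
  Gains A B (A′ , B′) = (A ⊆ A′ × A′ ⊆ A ∪ B) × (B ⊆ B′ × B′ ⊆ A ∪ B)

  module _ (st : State n N) (u v : Fin n) (valid : Valid st) where
    private
      A = lookup st u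
      B = lookup st v

    valid-update : ∀ A′ B′ → Gains A B (A′ , B′) → Valid ((st [ u ]≔ A′) [ v ]≔ B′)
    valid-update A′ B′ ((A⊆ , ⊆A) , (B⊆ , ⊆B)) = lookup-update₂ ValidAt st u v
      (A⊆ (proj₁ (valid u)) , λ t t∈ → from t (⊆A t∈))
      (B⊆ (proj₁ (valid v)) , λ t t∈ → from t (⊆B t∈))
      valid
      where
      from : ∀ t → t ∈ A ∪ B → ∃ λ w → t ≡ ident w
      from t t∈ with Subₚ.x∈p∪q⁻ A B t∈
      ... | inj₁ t∈A = proj₂ (valid u) t t∈A
      ... | inj₂ t∈B = proj₂ (valid v) t t∈B

    step-up : ∀ A′ B′ → Gains A B (A′ , B′) → ∀ w → lookup st w ⊆ lookup ((st [ u ]≔ A′) [ v ]≔ B′) w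
    step-up A′ B′ ((A⊆ , _) , (B⊆ , _)) = lookup-update₂ (λ w C → lookup st w ⊆ C) st u v A⊆ B⊆ (λ w → id)

    E-run-weight : A ≢ B → E (run A B) (λ { (A′ , B′) → weight ((st [ u ]≔ A′) [ v ]≔ B′) }) ≤ weight st * β
    E-run-weight A≢B with smallest-difference A≢B
    ... | t , small@(t∈ , _) with succeeds A B t small
    ...   | e , e⇒ , 1-δ≤ = begin
      E (run A B) (λ { (A′ , B′) → weight ((st [ u ]≔ A′) [ v ]≔ B′) })
        ≤⟨ E-mono-on L (onlyGains A B) (λ { (A′ , B′) g → gain A′ B′ g }) ⟩
      E (run A B) (λ x → weight st * (1ℚ - c * ⟦ e x ⟧))
        ≡⟨ trans (E-*ˡ (run A B) (weight st) _) (cong (weight st *_) (trans (E-complement L _) (cong (λ q → 1ℚ - q) (E-*ˡ (run A B) c (λ x → ⟦ e x ⟧))))) ⟩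
      weight st * (1ℚ - c * P)
        ≤⟨ *-monoˡ (weight-nonNeg st) (≤-+ʳ (0≤* 0≤4y (p≤q⇒0≤q-p ½≤P)) (identity y P)) ⟩
      weight st * β
        ∎
      where
      open ≤-Reasoning
      c = (y + y) + (y + y)
      L = IsProbability⇒IsLaw (isProbability A B)
      P = E (run A B) (λ x → ⟦ e x ⟧)
      ½≤P : ½ ≤ P
      ½≤P = begin
        ½          ≤⟨ 0≤q-p⇒p≤q (subst (0ℚ ≤_) (half δ) (p≤q⇒0≤q-p δ≤½)) ⟩
        1ℚ - δ     ≤⟨ 1-δ≤ ⟩
        total (filterᵇ (λ wx → e (proj₂ wx)) (run A B)) ≡⟨ total-filterᵇ e (run A B) ⟩
        P          ∎
        where
        half : ∀ δ → ½ - δ ≡ 1ℚ - δ - ½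
        half = solve-∀ ℚring
      identity : ∀ y P → 1ℚ - (y + y) ≡ 1ℚ - ((y + y) + (y + y)) * P + ((y + y) + (y + y)) * (P - ½)
      identity = solve-∀ ℚring
      fresh : ∀ A′ B′ → Gains A B (A′ , B′) → t ∈ A′ × t ∈ B′ → Φ st ℕ.< Φ ((st [ u ]≔ A′) [ v ]≔ B′)
      fresh A′ B′ g (t∈A′ , t∈B′) with lookup A t in tA | lookup B t in tB | trans (sym (lookup-symmetricDifference A B t)) (∈⇒true t∈)
      ... | true  | false | _ with proj₂ (valid u) t (true⇒∈ A tA)
      ...   | w , refl = sumℕ-mono-< (λ x → known-mono (step-up A′ B′ g x)) v (known-mono-< (step-up A′ B′ g v) tB
        (subst (t ∈_) (sym (Vecₚ.lookup∘update v (st [ u ]≔ A′) B′)) t∈B′))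
      fresh A′ B′ g (t∈A′ , t∈B′) | false | true  | _ with proj₂ (valid v) t (true⇒∈ B tB)
      ...   | w , refl = sumℕ-mono-< (λ x → known-mono (step-up A′ B′ g x)) u (known-mono-< (step-up A′ B′ g u) tA
        (subst (t ∈_) (sym (trans (Vecₚ.lookup∘update′ u≢v (st [ u ]≔ A′) B′) (Vecₚ.lookup∘update u st A′))) t∈A′))
        where
        u≢v : u ≢ v
        u≢v refl = A≢B refl
      gain : ∀ A′ B′ → Gains A B (A′ , B′) → weight ((st [ u ]≔ A′) [ v ]≔ B′) ≤ weight st * (1ℚ - c * ⟦ e (A′ , B′) ⟧)
      gain A′ B′ g with e (A′ , B′) in eq
      ... | false = ≤-trans (^-antimonoʳ 0≤a a≤1 (sumℕ-mono (λ x → known-mono (step-up A′ B′ g x)))) (≤-reflexive (identity′ (weight st) c))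
        where
        identity′ : ∀ w c → w ≡ w * (1ℚ - c * 0ℚ)
        identity′ = solve-∀ ℚring
      ... | true  = ≤-trans (^-antimonoʳ 0≤a a≤1 (fresh A′ B′ g (e⇒ (A′ , B′) (≡true⇒T eq)))) (≤-reflexive (identity′ (weight st) y))
        where
        identity′ : ∀ w y → (1ℚ - ((y + y) + (y + y))) * w ≡ w * (1ℚ - ((y + y) + (y + y)) * 1ℚ)
        identity′ = solve-∀ ℚring

  isLaw-exchange : ∀ cs (st : State n N) → IsLaw (exchange tr cs st)
  isLaw-exchange []             st = isLaw-return st
  isLaw-exchange ((u , v) ∷ cs) st = isLaw->>= (IsProbability⇒IsLaw (isProbability (lookup st u) (lookup st v)))
    λ { (A , B) → isLaw-exchange cs ((st [ u ]≔ A) [ v ]≔ B) }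

  surely-valid-exchange : ∀ cs st → Valid st → Surely (exchange tr cs st) Valid
  surely-valid-exchange []             st valid = surely-return valid
  surely-valid-exchange ((u , v) ∷ cs) st valid = surely->>= (onlyGains (lookup st u) (lookup st v))
    λ { (A , B) g → surely-valid-exchange cs ((st [ u ]≔ A) [ v ]≔ B) (valid-update st u v valid A B g) }

  Differ : State n N → Fin n × Fin n → Set
  Differ st (u , v) = lookup st u ≢ lookup st v

  E-exchange-weight : ∀ cs st → Valid st → All (Differ st) cs → AllPairs Disjoint cs →
    E (exchange tr cs st) weight ≤ weight st * β ^ length cs
  E-exchange-weight []             st valid _          _          = ≤-reflexive (trans (E-return st weight) (sym (ℚₚ.*-identityʳ (weight st))))
  E-exchange-weight ((u , v) ∷ cs) st valid (u≁v ∷ ds) (disj ∷ ps) = begin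
    E (exchange tr ((u , v) ∷ cs) st) weight
      ≡⟨ E->>= (run (lookup st u) (lookup st v)) (λ { (A , B) → exchange tr cs ((st [ u ]≔ A) [ v ]≔ B) }) weight ⟩
    E (run (lookup st u) (lookup st v)) (λ { (A , B) → E (exchange tr cs ((st [ u ]≔ A) [ v ]≔ B)) weight })
      ≤⟨ E-mono-on (IsProbability⇒IsLaw (isProbability (lookup st u) (lookup st v))) (onlyGains (lookup st u) (lookup st v))
           (λ { (A , B) g → E-exchange-weight cs ((st [ u ]≔ A) [ v ]≔ B) (valid-update st u v valid A B g) (All.zipWith still-differ (disj , ds)) ps }) ⟩
    E (run (lookup st u) (lookup st v)) (λ { (A , B) → weight ((st [ u ]≔ A) [ v ]≔ B) * β ^ length cs })
      ≡⟨ E-*ʳ (run (lookup st u) (lookup st v)) (β ^ length cs) (λ x → weight ((st [ u ]≔ proj₁ x) [ v ]≔ proj₂ x)) ⟩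
    E (run (lookup st u) (lookup st v)) (λ { (A , B) → weight ((st [ u ]≔ A) [ v ]≔ B) }) * β ^ length cs
      ≤⟨ *-monoʳ (^-nonNeg (length cs) 0≤β) (E-run-weight st u v valid u≁v) ⟩
    weight st * β * β ^ length cs
      ≡⟨ ℚₚ.*-assoc (weight st) β (β ^ length cs) ⟩
    weight st * β ^ length ((u , v) ∷ cs)
      ∎
    where
    open ≤-Reasoning
    untouched : ∀ {w A B} → u ≢ w → v ≢ w → lookup ((st [ u ]≔ A) [ v ]≔ B) w ≡ lookup st w
    untouched {w} {A} {B} u≢w v≢w = trans (Vecₚ.lookup∘update′ (v≢w ∘ sym) (st [ u ]≔ A) B) (Vecₚ.lookup∘update′ (u≢w ∘ sym) st A)
    still-differ : ∀ {A B uv′} → Disjoint (u , v) uv′ × Differ st uv′ → Differ ((st [ u ]≔ A) [ v ]≔ B) uv′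
    still-differ ((((u≢u′ , u≢v′) , (v≢u′ , v≢v′))) , ne) eq =
      ne (trans (sym (untouched u≢u′ v≢u′)) (trans eq (untouched u≢v′ v≢v′)))

all-mapMaybe : {P : Y → Set} (f : X → Maybe Y) (xs : List X) → (∀ x y → f x ≡ just y → P y) → All P (mapMaybe f xs)
all-mapMaybe f []       h = []
all-mapMaybe f (x ∷ xs) h with f x in eq
... | just y  = h x y eq ∷ all-mapMaybe f xs h
... | nothing = all-mapMaybe f xs h

allPairs-mapMaybe : {R : Y → Y → Set} (f : X → Maybe Y) {xs : List X} → AllPairs _≢_ xs →
  (∀ {x x′ y y′} → x ≢ x′ → f x ≡ just y → f x′ ≡ just y′ → R y y′) → AllPairs R (mapMaybe f xs)
allPairs-mapMaybe f []                     h = []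
allPairs-mapMaybe {Y = Y} {X} {R} f {x ∷ xs} (x∉ ∷ ps) h with f x in eq
... | nothing = allPairs-mapMaybe f ps h
... | just y  = related x∉ ∷ allPairs-mapMaybe f ps h
  where
  related : ∀ {xs} → All (x ≢_) xs → All (R y) (mapMaybe f xs)
  related []                = []
  related {x′ ∷ xs} (x≢ ∷ x∉) with f x′ in eq′
  ... | just y′ = h x≢ eq eq′ ∷ related x∉
  ... | nothing = related x∉

sumᴸ≤length-mapMaybe : (f : X → Maybe Y) (g : X → ℚ) (xs : List X) → (∀ x → g x ≤ 1ℚ) → (∀ x → f x ≡ nothing → g x ≤ 0ℚ) →
  sumᴸ g xs ≤ fromℕ (length (mapMaybe f xs))
sumᴸ≤length-mapMaybe f g []       g≤1 g≤0 = ≤-refl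
sumᴸ≤length-mapMaybe f g (x ∷ xs) g≤1 g≤0 with f x in eq
... | just y  = ≤-trans (ℚₚ.+-mono-≤ (g≤1 x) (sumᴸ≤length-mapMaybe f g xs g≤1 g≤0)) (≤-reflexive (sym (fromℕ-suc (length (mapMaybe f xs)))))
... | nothing = ≤-trans (ℚₚ.+-mono-≤ (g≤0 x eq) (sumᴸ≤length-mapMaybe f g xs g≤1 g≤0)) (≤-reflexive (ℚₚ.+-identityˡ (fromℕ (length (mapMaybe f xs)))))

length-mapMaybe≤ : (f : X → Maybe Y) (xs : List X) → length (mapMaybe f xs) ℕ.≤ length xs
length-mapMaybe≤ f []       = ℕ.z≤n
length-mapMaybe≤ f (x ∷ xs) with f x
... | just _  = ℕ.s≤s (length-mapMaybe≤ f xs)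
... | nothing = ℕₚ.m≤n⇒m≤1+n (length-mapMaybe≤ f xs)

Choice : List X → Maybe X → Set
Choice xs x = (∀ v → x ≡ just v → v L.∈ xs) × (x ≡ nothing → xs ≡ [])

surely-uniformMaybe : (xs : List X) → Surely (uniformMaybe xs) (Choice xs)
surely-uniformMaybe []         = surely-return ((λ _ ()) , λ _ → refl)
surely-uniformMaybe {X} xs@(_ ∷ _) = All.map⁺ (All.map⁺ (All.tabulate λ {v} v∈ → (λ { _ refl → v∈ }) , λ ()))

-- Gives access to the local function in the definition of connectionsOf.
connectionsOf-mapMaybe : (acc : Vec (Maybe (Fin n)) n) → Σ (Fin n → Maybe (Fin n × Fin n)) λ f → connectionsOf acc ≡ mapMaybe f (allFin n)
connectionsOf-mapMaybe acc = _ , refl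

connection : Vec (Maybe (Fin n)) n → Fin n → Maybe (Fin n × Fin n)
connection acc = proj₁ (connectionsOf-mapMaybe acc)

connection-just : (acc : Vec (Maybe (Fin n)) n) (v : Fin n) {uv : Fin n × Fin n} → connection acc v ≡ just uv →
  proj₂ uv ≡ v × lookup acc v ≡ just (proj₁ uv)
connection-just acc v eq with lookup acc v | eq
... | just u  | refl = refl , refl
... | nothing | ()

connection-nothing : (acc : Vec (Maybe (Fin n)) n) (v : Fin n) → connection acc v ≡ nothing → lookup acc v ≡ nothing
connection-nothing acc v eq with lookup acc v | eq
... | just u  | ()
... | nothing | _  = refl

prod-1 : {f : Fin n → ℚ} → (∀ i → f i ≡ 1ℚ) → prod f ≡ 1ℚ
prod-1 {zero}  _   = refl
prod-1 {suc n} f≡1 = cong₂ _*_ (f≡1 zero) (prod-1 (f≡1 ∘ suc))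

isLaw-accept : (p : Proposals n) (v : Fin n) → IsLaw (accept p v)
isLaw-accept p v with lookup p v
... | just _  = isLaw-return nothing
... | nothing = isLaw-uniformMaybe (proposersTo p v)

module Round {n N : ℕ} {δ : ℚ} (ident : Fin n → Fin N) (tr : Transfer N δ) (δ≤½ : δ ≤ ½)
  {y : ℚ} (0≤y : 0ℚ ≤ y) (4y≤1 : (y + y) + (y + y) ≤ 1ℚ) (2yn≤1 : (y + y) * fromℕ n ≤ 1ℚ) (G : Graph n) where

  open Potential ident
  open Exchanging ident tr δ≤½ 0≤y 4y≤1

  module _ (b : Fin n → Bool) where
    open Proposing G b

    Legal : Proposals n → Set
    Legal p = ∀ u v → lookup p u ≡ just v → b u ≡ true × b v ≡ false

    surely-legal : Surely (independent (propose G b)) Legal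
    surely-legal = surely-independent λ u → legal u
      where
      legal : ∀ u → Surely (propose G b u) (λ x → ∀ v → x ≡ just v → b u ≡ true × b v ≡ false)
      legal u with b u
      ... | false = surely-return λ _ ()
      ... | true  = All.map (λ h v eq → refl , not-true (T⇒≡true (proj₂ (L.∈-filter⁻ (T? ∘ not ∘ b) {xs = neighbors G u} (proj₁ h v eq)))))
        (surely-uniformMaybe (candidates u))

    Matching : Proposals n → Vec (Maybe (Fin n)) n → Set
    Matching p acc = ∀ v → (∀ u → lookup acc v ≡ just u → lookup p u ≡ just v)
      × (lookup acc v ≡ nothing → lookup p v ≡ nothing → ∀ u → lookup p u ≢ just v)

    surely-matching : ∀ p → Surely (independent (accept p)) (Matching p)
    surely-matching p = surely-independent matching
      where
      P? : ∀ v u → Dec (lookup p u ≡ just v)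
      P? v u = ≡-dec _≟F_ (lookup p u) (just v)
      matching : ∀ v → Surely (accept p v) (λ x → (∀ u → x ≡ just u → lookup p u ≡ just v)
        × (x ≡ nothing → lookup p v ≡ nothing → ∀ u → lookup p u ≢ just v))
      matching v with lookup p v
      ... | just w  = surely-return ((λ _ ()) , λ _ ())
      ... | nothing = All.map (λ (chosen , none) →
        (λ u eq → proj₂ (L.∈-filter⁻ (P? v) {xs = allFin n} (chosen u eq))) ,
        (λ eq _ u pu → contradiction (subst (u L.∈_) (none eq) (L.∈-filter⁺ (P? v) (L.∈-allFin u) pu)) λ ()))
        (surely-uniformMaybe (proposersTo p v))

    hits≤connections : ∀ p acc → Legal p → Matching p acc → sum (hitBy p) ≤ fromℕ (length (connectionsOf acc))
    hits≤connections p acc legal matching = ≤-trans (≤-reflexive (sym (sumᴸ-tabulate (hitBy p) id)))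
      (sumᴸ≤length-mapMaybe (connection acc) (hitBy p) (allFin n) hitBy≤1 (λ v eq → ≤-reflexive (unhit v eq)))
      where
      hitBy≤1 : ∀ v → hitBy p v ≤ 1ℚ
      hitBy≤1 v = ≤-+ʳ (prod-nonNeg (λ u → p≤q⇒0≤q-p (⟦⟧≤1 (isTo v (lookup p u))))) (identity (prod (λ u → 1ℚ - ⟦ isTo v (lookup p u) ⟧)))
        where
        identity : ∀ P → 1ℚ ≡ 1ℚ - P + P
        identity = solve-∀ ℚring
      isTo⇒ : ∀ v x → isTo v x ≡ true → x ≡ just v
      isTo⇒ v (just w) h = cong just (does⇒ (w ≟F v) h)
      unhit : ∀ v → connection acc v ≡ nothing → hitBy p v ≡ 0ℚ
      unhit v eq = cong (λ P → 1ℚ - P) (prod-1 λ u → cong (λ B → 1ℚ - ⟦ B ⟧) (¬true⇒false λ h → unproposed (lookup p v) refl u (isTo⇒ v (lookup p u) h)))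
        where
        unproposed : ∀ x → lookup p v ≡ x → ∀ u → lookup p u ≢ just v
        unproposed nothing  pv u pu = proj₂ (matching v) (connection-nothing acc v eq) pv u pu
        unproposed (just w) pv u pu = true≢false (proj₁ (legal v w pv)) (proj₂ (legal u v pu))

    disjoint-connections : ∀ p acc → Legal p → Matching p acc → AllPairs Disjoint (connectionsOf acc)
    disjoint-connections p acc legal matching = allPairs-mapMaybe (connection acc) (allFin⁺ n) disj
      where
      disj : ∀ {v v′ uv uv′} → v ≢ v′ → connection acc v ≡ just uv → connection acc v′ ≡ just uv′ → Disjoint uv uv′
      disj {v} {v′} {u , _} {u′ , _} v≢v′ eq eq′ with connection-just acc v eq | connection-just acc v′ eq′
      ... | refl , av | refl , av′ =
        ((λ { refl → v≢v′ (just-injective (trans (sym pu) pu′)) })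
        , (λ { refl → true≢false (proj₁ (legal _ _ pu)) (proj₂ (legal _ _ pu′)) }))
        , ((λ { refl → true≢false (proj₁ (legal _ _ pu′)) (proj₂ (legal _ _ pu)) }) , v≢v′)
        where
        pu : lookup p u ≡ just v
        pu = proj₁ (matching v) u av
        pu′ : lookup p u′ ≡ just v′
        pu′ = proj₁ (matching v′) u′ av′

    opposite-connections : ∀ p acc → Legal p → Matching p acc → All (λ (u , v) → b u ≡ true × b v ≡ false) (connectionsOf acc)
    opposite-connections p acc legal matching = all-mapMaybe (connection acc) (allFin n) opp
      where
      opp : ∀ v uv → connection acc v ≡ just uv → b (proj₁ uv) ≡ true × b (proj₂ uv) ≡ false
      opp v (u , _) eq with connection-just acc v eq
      ... | refl , av = legal u v (proj₁ (matching v) u av)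

  module _ (bit : Fin N → Bool) (st : State n N) where
    private
      b : Fin n → Bool
      b u = advertise bit (lookup st u)
    open Proposing G b

    isLaw-round : IsLaw (sharedBitRound G tr bit st)
    isLaw-round = isLaw->>= (isLaw-independent isLaw-propose) λ p → isLaw->>= (isLaw-independent (isLaw-accept p)) λ acc →
      isLaw-exchange (connectionsOf acc) st

    surely-valid-round : Valid st → Surely (sharedBitRound G tr bit st) Valid
    surely-valid-round valid = surely->>= (surely-legal b) λ p _ → surely->>= (surely-matching b p) λ acc _ →
      surely-valid-exchange (connectionsOf acc) st valid

    E-round-weight : Valid st → E (sharedBitRound G tr bit st) weight ≤ weight st * (1ℚ - y * H)
    E-round-weight valid = begin
      E (sharedBitRound G tr bit st) weight
        ≡⟨ E->>= (independent (propose G b)) _ weight ⟩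
      E (independent (propose G b)) (λ p → E (independent (accept p) >>= λ acc → exchange tr (connectionsOf acc) st) weight)
        ≤⟨ E-mono-on (isLaw-independent isLaw-propose) (surely-legal b) E-accept ⟩
      E (independent (propose G b)) (λ p → weight st * (1ℚ - y * sum (hitBy p)))
        ≡⟨ E-*ˡ (independent (propose G b)) (weight st) (λ p → 1ℚ - y * sum (hitBy p)) ⟩
      weight st * E (independent (propose G b)) (λ p → 1ℚ - y * sum (hitBy p))
        ≡⟨ cong (weight st *_) (trans (E-complement (isLaw-independent isLaw-propose) (λ p → y * sum (hitBy p)))
             (cong (λ q → 1ℚ - q) (trans (E-*ˡ (independent (propose G b)) y (λ p → sum (hitBy p))) (cong (y *_) E-hits)))) ⟩
      weight st * (1ℚ - y * H)
        ∎
      where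
      open ≤-Reasoning
      E-connected : ∀ p acc → Legal b p → Matching b p acc →
        E (exchange tr (connectionsOf acc) st) weight ≤ weight st * (1ℚ - y * sum (hitBy p))
      E-connected p acc legal matching = begin
        E (exchange tr cs st) weight               ≤⟨ E-exchange-weight cs st valid (All.map differ (opposite-connections b p acc legal matching)) (disjoint-connections b p acc legal matching) ⟩
        weight st * β ^ length cs                  ≤⟨ *-monoˡ (weight-nonNeg st) (reverse-bernoulli (length cs) 0≤y (≤-trans (*-monoˡ 0≤2y (fromℕ-mono length≤n)) 2yn≤1)) ⟩
        weight st * (1ℚ - y * fromℕ (length cs))   ≤⟨ *-monoˡ (weight-nonNeg st) (ℚₚ.+-monoʳ-≤ 1ℚ (ℚₚ.neg-antimono-≤ (*-monoˡ 0≤y (hits≤connections b p acc legal matching)))) ⟩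
        weight st * (1ℚ - y * sum (hitBy p))       ∎
        where
        cs = connectionsOf acc
        length≤n : length cs ℕ.≤ n
        length≤n = ℕₚ.≤-trans (length-mapMaybe≤ (connection acc) (allFin n)) (ℕₚ.≤-reflexive (length-tabulate id))
        differ : ∀ {uv} → b (proj₁ uv) ≡ true × b (proj₂ uv) ≡ false → Differ st uv
        differ (bu , bv) eq = true≢false (trans (cong (advertise bit) (sym eq)) bu) bv
      E-accept : ∀ p → Legal b p →
        E (independent (accept p) >>= λ acc → exchange tr (connectionsOf acc) st) weight ≤ weight st * (1ℚ - y * sum (hitBy p))
      E-accept p legal = begin
        E (independent (accept p) >>= λ acc → exchange tr (connectionsOf acc) st) weight
          ≡⟨ E->>= (independent (accept p)) (λ acc → exchange tr (connectionsOf acc) st) weight ⟩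
        E (independent (accept p)) (λ acc → E (exchange tr (connectionsOf acc) st) weight)
          ≤⟨ E-mono-on (isLaw-independent (isLaw-accept p)) (surely-matching b p) (λ acc → E-connected p acc legal) ⟩
        E (independent (accept p)) (λ _ → weight st * (1ℚ - y * sum (hitBy p)))
          ≡⟨ E-const (isLaw-independent (isLaw-accept p)) (weight st * (1ℚ - y * sum (hitBy p))) ⟩
        weight st * (1ℚ - y * sum (hitBy p))
          ∎

-- Shared random bits

odd : ℕ → Bool
odd m = (m ℕ.% 2) ℕ.≡ᵇ 1

odd-suc : ∀ m → odd (suc m) ≡ not (odd m)
odd-suc zero          = refl
odd-suc (suc zero)    = refl
odd-suc (suc (suc m)) = odd-suc m

sum-tabulate-cong : {f g : Fin n → ℕ} → (∀ i → f i ≡ g i) → Vec.sum (tabulate f) ≡ Vec.sum (tabulate g)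
sum-tabulate-cong f≗g = cong Vec.sum (Vecₚ.tabulate-cong f≗g)

sum-tabulate-change : (f g : Fin n → ℕ) (t : Fin n) → f t ≡ 0 → (∀ i → i ≢ t → g i ≡ f i) →
  Vec.sum (tabulate g) ≡ g t ℕ.+ Vec.sum (tabulate f)
sum-tabulate-change f g zero    ft≡0 g≗f = cong₂ (λ a b → g zero ℕ.+ (a ℕ.+ b)) (sym ft≡0) (sum-tabulate-cong λ i → g≗f (suc i) λ ())
sum-tabulate-change f g (suc t) ft≡0 g≗f = trans
  (cong₂ ℕ._+_ (g≗f zero λ ()) (sum-tabulate-change (f ∘ suc) (g ∘ suc) t ft≡0 λ i i≢t → g≗f (suc i) (i≢t ∘ Finₚ.suc-injective)))
  (swap (f zero) (g (suc t)) (Vec.sum (tabulate (f ∘ suc))))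
  where
  swap : ∀ a b c → a ℕ.+ (b ℕ.+ c) ≡ b ℕ.+ (a ℕ.+ c)
  swap a b c = trans (sym (ℕₚ.+-assoc a b c)) (trans (cong (ℕ._+ c) (ℕₚ.+-comm a b)) (ℕₚ.+-assoc b a c))

advertise-flip : (A : TokenSet N) (f g : Fin N → Bool) (t : Fin N) → f t ≡ false → g t ≡ true → (∀ i → i ≢ t → g i ≡ f i) →
  advertise g A ≡ lookup A t xor advertise f A
advertise-flip A f g t ft gt g≗f = trans
  (cong odd (sum-tabulate-change _ _ t
    (cong (λ b → if b then 1 else 0) (trans (cong (lookup A t ∧_) ft) (Boolₚ.∧-zeroʳ (lookup A t))))
    (λ i i≢t → cong (λ b → if lookup A i ∧ b then 1 else 0) (g≗f i i≢t))))
  (add-bit (lookup A t) gt _)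
  where
  add-bit : ∀ a {b} → b ≡ true → ∀ m → odd ((if a ∧ b then 1 else 0) ℕ.+ m) ≡ a xor odd m
  add-bit true  refl m = odd-suc m
  add-bit false refl m = refl

sum-*-sum : (f : Fin m → ℚ) (g : Fin n → ℚ) → sum f * sum g ≡ sum (λ u → sum (λ v → f u * g v))
sum-*-sum f g = trans (*-distribʳ-sum (sum g) f) (sum-cong-≗ λ u → *-distribˡ-sum (f u) g)

xor-split : ∀ b c → ⟦ b xor c ⟧ ≡ ⟦ b ⟧ * ⟦ not c ⟧ + ⟦ not b ⟧ * ⟦ c ⟧
xor-split true  true  = refl
xor-split true  false = refl
xor-split false true  = refl
xor-split false false = refl

count-opposite : (b : Fin n → Bool) → sum (λ u → sum (λ v → ⟦ b u xor b v ⟧)) ≡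
  (1ℚ + 1ℚ) * (sum (λ v → ⟦ b v ⟧) * sum (λ v → ⟦ not (b v) ⟧))
count-opposite b = begin
  sum (λ u → sum (λ v → ⟦ b u xor b v ⟧))
    ≡⟨ sum-cong-≗ (λ u → trans (sum-cong-≗ (λ v → xor-split (b u) (b v))) (∑-distrib-+ (λ v → f u * f̄ v) (λ v → f̄ u * f v))) ⟩
  sum (λ u → sum (λ v → f u * f̄ v) + sum (λ v → f̄ u * f v))
    ≡⟨ ∑-distrib-+ (λ u → sum (λ v → f u * f̄ v)) (λ u → sum (λ v → f̄ u * f v)) ⟩
  sum (λ u → sum (λ v → f u * f̄ v)) + sum (λ u → sum (λ v → f̄ u * f v))
    ≡⟨ cong₂ _+_ (sum-*-sum f f̄) (sum-*-sum f̄ f) ⟨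
  sum f * sum f̄ + sum f̄ * sum f
    ≡⟨ identity (sum f) (sum f̄) ⟩
  (1ℚ + 1ℚ) * (sum f * sum f̄)
    ∎
  where
  open ≡-Reasoning
  f f̄ : Fin _ → ℚ
  f v = ⟦ b v ⟧
  f̄ v = ⟦ not (b v) ⟧
  identity : ∀ a c → a * c + c * a ≡ (1ℚ + 1ℚ) * (a * c)
  identity = solve-∀ ℚring

sameSet : State n N → Fin n → Fin n → Bool
sameSet st u v = does (Vecₚ.≡-dec Boolₚ._≟_ (lookup st u) (lookup st v))

classSize : State n N → Fin n → ℚ
classSize st u = sum (λ v → ⟦ sameSet st u v ⟧)

strings : Dist (Vec Bool M)
strings = independent (λ _ → coin)

module Bits {n N M : ℕ} (pos : Fin N → Fin M) (pos-injective : ∀ {t t′} → pos t ≡ pos t′ → t ≡ t′) (st : State n N) where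

  advertised : Vec Bool M → Fin n → Bool
  advertised r u = advertise (λ t → lookup r (pos t)) (lookup st u)

  E-opposite : ∀ {u v} → lookup st u ≢ lookup st v → E strings (λ r → ⟦ advertised r u xor advertised r v ⟧) ≡ ½
  E-opposite {u} {v} u≁v with ≢⇒lookup-≢ u≁v
  ... | t , differ = begin
    E strings (λ r → ⟦ advertised r u xor advertised r v ⟧)
      ≡⟨ E-coins-flip (pos t) (λ r → ⟦ advertised r u xor advertised r v ⟧) ⟩
    E strings (λ r → ½ * (⟦ advertised (r [ pos t ]≔ false) u xor advertised (r [ pos t ]≔ false) v ⟧ + ⟦ advertised (r [ pos t ]≔ true) u xor advertised (r [ pos t ]≔ true) v ⟧))
      ≡⟨ E-cong strings (λ r → cong₂ (λ c e → ½ * (⟦ advertised (r [ pos t ]≔ false) u xor advertised (r [ pos t ]≔ false) v ⟧ + ⟦ c xor e ⟧)) (flipped r u) (flipped r v)) ⟩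
    E strings (λ r → ½ * (⟦ advertised (r [ pos t ]≔ false) u xor advertised (r [ pos t ]≔ false) v ⟧
      + ⟦ (lookup (lookup st u) t xor advertised (r [ pos t ]≔ false) u) xor (lookup (lookup st v) t xor advertised (r [ pos t ]≔ false) v) ⟧))
      ≡⟨ E-cong strings (λ r → one-of-two (advertised (r [ pos t ]≔ false) u) (advertised (r [ pos t ]≔ false) v) (lookup (lookup st u) t) (lookup (lookup st v) t) differ) ⟩
    E (strings {M}) (λ _ → ½)
      ≡⟨ E-const (isLaw-coins {M}) ½ ⟩
    ½
      ∎
    where
    open ≡-Reasoning
    flipped : ∀ r w → advertised (r [ pos t ]≔ true) w ≡ lookup (lookup st w) t xor advertised (r [ pos t ]≔ false) w
    flipped r w = advertise-flip (lookup st w) _ _ t (Vecₚ.lookup∘update (pos t) r false) (Vecₚ.lookup∘update (pos t) r true)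
      λ i i≢t → trans (Vecₚ.lookup∘update′ (i≢t ∘ pos-injective) r true) (sym (Vecₚ.lookup∘update′ (i≢t ∘ pos-injective) r false))
    one-of-two : ∀ x y a b → a xor b ≡ true → ½ * (⟦ x xor y ⟧ + ⟦ (a xor x) xor (b xor y) ⟧) ≡ ½
    one-of-two true  true  true  false _ = refl
    one-of-two true  true  false true  _ = refl
    one-of-two true  false true  false _ = refl
    one-of-two true  false false true  _ = refl
    one-of-two false true  true  false _ = refl
    one-of-two false true  false true  _ = refl
    one-of-two false false true  false _ = refl
    one-of-two false false false true  _ = refl

  E-opposite-≥ : ∀ u v → ½ * (1ℚ - ⟦ sameSet st u v ⟧) ≤ E strings (λ r → ⟦ advertised r u xor advertised r v ⟧)
  E-opposite-≥ u v with Vecₚ.≡-dec Boolₚ._≟_ (lookup st u) (lookup st v)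
  ... | yes _  = E-nonNeg isLaw-coins (λ r → 0≤⟦⟧ (advertised r u xor advertised r v))
  ... | no u≁v = ≤-reflexive (sym (E-opposite u≁v))

  cutProduct : Vec Bool M → ℚ
  cutProduct r = sum (λ v → ⟦ advertised r v ⟧) * sum (λ v → ⟦ not (advertised r v) ⟧)

  E-cutProduct : (∀ u → classSize st u ≤ q * fromℕ n) → fromℕ n * fromℕ n * (1ℚ - q) ≤ fromℕ 4 * E strings cutProduct
  E-cutProduct {q} small = begin
    fromℕ n * fromℕ n * (1ℚ - q)
      ≡⟨ identity (fromℕ n) q ⟩
    (1ℚ + 1ℚ) * (fromℕ n * (½ * (fromℕ n - q * fromℕ n)))
      ≡⟨ cong ((1ℚ + 1ℚ) *_) (sum-const n (½ * (fromℕ n - q * fromℕ n))) ⟨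
    (1ℚ + 1ℚ) * sum {n} (λ u → ½ * (fromℕ n - q * fromℕ n))
      ≤⟨ *-monoˡ (0≤fromℕ 2) (sum-mono λ u → *-monoˡ (0≤// 1 2) (ℚₚ.+-monoʳ-≤ (fromℕ n) (ℚₚ.neg-antimono-≤ (small u)))) ⟩
    (1ℚ + 1ℚ) * sum (λ u → ½ * (fromℕ n - classSize st u))
      ≡⟨ cong ((1ℚ + 1ℚ) *_) (sum-cong-≗ λ u → trans (cong (λ k → ½ * (k - classSize st u)) (sym (sum-1 n)))
           (trans (cong (½ *_) (sym (∑-distrib-- (λ _ → 1ℚ) (λ v → ⟦ sameSet st u v ⟧)))) (*-distribˡ-sum ½ (λ v → 1ℚ - ⟦ sameSet st u v ⟧)))) ⟩
    (1ℚ + 1ℚ) * sum (λ u → sum (λ v → ½ * (1ℚ - ⟦ sameSet st u v ⟧)))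
      ≤⟨ *-monoˡ (0≤fromℕ 2) (sum-mono λ u → sum-mono λ v → E-opposite-≥ u v) ⟩
    (1ℚ + 1ℚ) * sum (λ u → sum (λ v → E strings (λ r → ⟦ advertised r u xor advertised r v ⟧)))
      ≡⟨ cong ((1ℚ + 1ℚ) *_) (trans (E-sum strings (λ u r → sum (λ v → ⟦ advertised r u xor advertised r v ⟧))) (sum-cong-≗ λ u → E-sum strings (λ v r → ⟦ advertised r u xor advertised r v ⟧))) ⟨
    (1ℚ + 1ℚ) * E strings (λ r → sum (λ u → sum (λ v → ⟦ advertised r u xor advertised r v ⟧)))
      ≡⟨ cong ((1ℚ + 1ℚ) *_) (trans (E-cong strings (λ r → count-opposite (advertised r))) (E-*ˡ strings (1ℚ + 1ℚ) cutProduct)) ⟩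
    (1ℚ + 1ℚ) * ((1ℚ + 1ℚ) * E strings cutProduct)
      ≡⟨ identity′ (E strings cutProduct) ⟩
    fromℕ 4 * E strings cutProduct
      ∎
    where
    open ≤-Reasoning
    identity : ∀ n q → n * n * (1ℚ - q) ≡ (1ℚ + 1ℚ) * (n * (½ * (n - q * n)))
    identity = solve-∀ ℚring
    identity′ : ∀ e → (1ℚ + 1ℚ) * ((1ℚ + 1ℚ) * e) ≡ fromℕ 4 * e
    identity′ = solve-∀ ℚring

  expectedHits : Graph n → ℚ
  expectedHits G = E strings (λ r → Proposing.H G (advertised r))

  expectedHits-edge : (G : Graph n) → ∀ {u v} → adj G u v ≡ true → lookup st u ≢ lookup st v → ½ ≤ expectedHits G
  expectedHits-edge G {u} {v} uv u≁v = ≤-trans (≤-reflexive (sym (E-opposite u≁v)))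
    (E-mono isLaw-coins λ r → ⟦⟧-≤ (advertised r u xor advertised r v) (Proposing.H-nonNeg G (advertised r)) (some-hit r _ _ refl refl))
    where
    some-hit : ∀ r x y → advertised r u ≡ x → advertised r v ≡ y → advertised r u xor advertised r v ≡ true → 1ℚ ≤ Proposing.H G (advertised r)
    some-hit r true  false ru rv _ = Proposing.H≥1 G (advertised r) uv ru rv
    some-hit r false true  ru rv _ = Proposing.H≥1 G (advertised r) (trans (symmetric G v u) uv) rv ru
    some-hit r true  true  ru rv h = contradiction (trans (sym h) (cong₂ _xor_ ru rv)) λ ()
    some-hit r false false ru rv h = contradiction (trans (sym h) (cong₂ _xor_ ru rv)) λ ()

  expectedHits-spread : (G : Graph n) {s α : ℚ} {Δ : ℕ} → 1ℚ ≤ s → (∀ u → degree G u ℕ.≤ Δ) → fromℕ Δ ≤ s * s →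
    0ℚ ≤ α → α ≤ 1ℚ + 1ℚ → (∀ S → 2 ℕ.* ∣ S ∣ ℕ.≤ n → α * fromℕ ∣ S ∣ ≤ fromℕ ∣ boundary G S ∣) →
    (∀ u → classSize st u ≤ q * fromℕ n) →
    α * (fromℕ n * fromℕ n * (1ℚ - q)) ≤ fromℕ 36 * s * fromℕ n * expectedHits G
  expectedHits-spread {q} G {s} {α} 1≤s degree≤Δ Δ≤s² 0≤α α≤2 expands small = begin
    α * (fromℕ n * fromℕ n * (1ℚ - q))                          ≤⟨ *-monoˡ 0≤α (E-cutProduct {q} small) ⟩
    α * (fromℕ 4 * E strings cutProduct)                        ≡⟨ *-swap α (fromℕ 4) (E strings cutProduct) ⟩
    fromℕ 4 * (α * E strings cutProduct)                        ≡⟨ cong (fromℕ 4 *_) (E-*ˡ strings α cutProduct) ⟨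
    fromℕ 4 * E strings (λ r → α * cutProduct r)                ≤⟨ *-monoˡ (0≤fromℕ 4) (E-mono isLaw-coins λ r → Cover.cut-bound G (advertised r) 1≤s degree≤Δ Δ≤s² 0≤α α≤2 expands) ⟩
    fromℕ 4 * E strings (λ r → fromℕ 9 * s * fromℕ n * Proposing.H G (advertised r)) ≡⟨ cong (fromℕ 4 *_) (E-*ˡ strings (fromℕ 9 * s * fromℕ n) (λ r → Proposing.H G (advertised r))) ⟩
    fromℕ 4 * (fromℕ 9 * s * fromℕ n * expectedHits G)          ≡⟨ identity s (fromℕ n) (expectedHits G) ⟩
    fromℕ 36 * s * fromℕ n * expectedHits G                     ∎
    where
    open ≤-Reasoning
    identity : ∀ s n h → fromℕ 4 * (fromℕ 9 * s * n * h) ≡ fromℕ 36 * s * n * h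
    identity = solve-∀ ℚring

-- Executions

every : (X → Bool) → Vec X n → Bool
every f []       = true
every f (x ∷ xs) = f x ∧ every f xs

¬every⇒Any : {P : X → Set} (f : X → Bool) → (∀ x → f x ≡ false → P x) → (xs : Vec X n) → T (not (every f xs)) → Any P xs
¬every⇒Any f h (x ∷ xs) some with f x in eq
... | false = AnyV.here (h x eq)
... | true  = AnyV.there (¬every⇒Any f h xs some)

filterᵇ-cong : {f g : X → Bool} → (∀ x → f x ≡ g x) → (xs : List X) → filterᵇ f xs ≡ filterᵇ g xs
filterᵇ-cong             f≗g []       = refl
filterᵇ-cong {f = f} {g} f≗g (x ∷ xs) with f x | g x | f≗g x
... | true  | _ | refl = cong (x ∷_) (filterᵇ-cong f≗g xs)
... | false | _ | refl = filterᵇ-cong f≗g xs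

candidates-cong : (G : Graph n) {b b′ : Fin n → Bool} → (∀ u → b u ≡ b′ u) → ∀ u →
  Proposing.candidates G b u ≡ Proposing.candidates G b′ u
candidates-cong G b≗b′ u = filterᵇ-cong (λ v → cong not (b≗b′ v)) (neighbors G u)

propose-cong : (G : Graph n) {b b′ : Fin n → Bool} → (∀ u → b u ≡ b′ u) → ∀ u → propose G b u ≡ propose G b′ u
propose-cong G b≗b′ u = cong₂ (λ B xs → if B then uniformMaybe xs else return nothing) (b≗b′ u) (candidates-cong G b≗b′ u)

H-cong : (G : Graph n) {b b′ : Fin n → Bool} → (∀ u → b u ≡ b′ u) → Proposing.H G b ≡ Proposing.H G b′
H-cong G b≗b′ = sum-cong-≗ λ v → cong (λ P → 1ℚ - P) (prod-cong λ u → cong (λ q → 1ℚ - q)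
  (cong₂ (λ B q → ⟦ B ⟧ * q) (b≗b′ u) (cong₂ (λ xs B → 1 // length xs * (⟦ adj G u v ⟧ * ⟦ not B ⟧)) (candidates-cong G b≗b′ u) (b≗b′ v))))

advertise-cong : {f g : Fin N → Bool} → (∀ t → f t ≡ g t) → ∀ A → advertise f A ≡ advertise g A
advertise-cong f≗g A = cong odd (sum-tabulate-cong λ t → cong (λ b → if lookup A t ∧ b then 1 else 0) (f≗g t))

sharedBitRound-cong : ∀ {δ} (G : Graph n) (tr : Transfer N δ) {f g : Fin N → Bool} → (∀ t → f t ≡ g t) → ∀ st →
  sharedBitRound G tr f st ≡ sharedBitRound G tr g st
sharedBitRound-cong G tr f≗g st = cong
  (_>>= λ p → independent (accept p) >>= λ acc → exchange tr (connectionsOf acc) st)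
  (independent-cong (propose-cong G λ u → advertise-cong f≗g (lookup st u)))

module _ (c N : ℕ) where

  position : Fin (groups c N) → Fin N → Fin (groups c N ℕ.* N ℕ.* bundleSize N)
  position g t = Fin.combine (Fin.combine g t) (zero {n = ⌈log₂ N ⌉})

  position-injective : ∀ g {t t′} → position g t ≡ position g t′ → t ≡ t′
  position-injective g {t} {t′} eq = Finₚ.combine-injectiveʳ g t g t′ (Finₚ.combine-injectiveˡ (Fin.combine g t) zero (Fin.combine g t′) zero eq)

  groupOf : Fin (groups c N ℕ.* N ℕ.* bundleSize N) → Fin (groups c N)
  groupOf j = proj₁ (Fin.remQuot N (proj₁ (Fin.remQuot {groups c N ℕ.* N} (bundleSize N) j)))

  groupOf-position : ∀ g t → groupOf (position g t) ≡ g
  groupOf-position g t = trans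
    (cong (λ x → proj₁ (Fin.remQuot N (proj₁ x))) (Finₚ.remQuot-combine (Fin.combine g t) (zero {n = ⌈log₂ N ⌉})))
    (cong proj₁ (Finₚ.remQuot-combine g t))

  regroup : Fin (groups c N) → SharedString c N → SharedString c N → SharedString c N
  regroup g = mix (λ j → does (groupOf j ≟F g))

  regroup-same : ∀ g r ρ t → tokenBit {c} (regroup g r ρ) g t ≡ tokenBit {c} ρ g t
  regroup-same g r ρ t = trans (Vecₚ.lookup∘tabulate _ (position g t))
    (cong (λ B → if B then lookup ρ (position g t) else lookup r (position g t)) (dec-true (groupOf (position g t) ≟F g) (groupOf-position g t)))

  regroup-other : ∀ g r ρ {g′} t → g′ ≢ g → tokenBit {c} (regroup g r ρ) g′ t ≡ tokenBit {c} r g′ t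
  regroup-other g r ρ {g′} t g′≢g = trans (Vecₚ.lookup∘tabulate _ (position g′ t))
    (cong (λ B → if B then lookup ρ (position g′ t) else lookup r (position g′ t))
      (dec-false (groupOf (position g′ t) ≟F g) (λ eq → g′≢g (trans (sym (groupOf-position g′ t)) eq))))

module Execution {n N c : ℕ} {δ : ℚ} (ident : Fin n → Fin N) (𝒢 : DynamicGraph n)
  (tr : Transfer N δ) (late : LateBehavior c n N) (δ≤½ : δ ≤ ½)
  {y : ℚ} (0≤y : 0ℚ ≤ y) (4y≤1 : (y + y) + (y + y) ≤ 1ℚ) (2yn≤1 : (y + y) * fromℕ n ≤ 1ℚ) where

  open Potential ident
  open Exchanging ident tr δ≤½ 0≤y 4y≤1
  module R (i : ℕ) = Round ident tr δ≤½ 0≤y 4y≤1 2yn≤1 (𝒢 i)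

  private
    gs : ℕ
    gs = groups c N
    run : SharedString c N → (m : ℕ) → Dist (History n N m)
    run = executionWith {δ = δ} ident 𝒢 tr late
    next : SharedString c N → (i : ℕ) → History n N (suc i) → Dist (State n N)
    next = step {δ = δ} ident 𝒢 tr late

  isLaw-S : IsLaw (sharedString c N)
  isLaw-S = isLaw-coins {groups c N ℕ.* N ℕ.* bundleSize N}

  step-early : ∀ r i (i<gs : i ℕ.< gs) h → next r i h ≡ sharedBitRound (𝒢 i) tr (tokenBit {c} r (Fin.fromℕ< i<gs)) (Vec.head h)
  step-early r i i<gs h with i ℕ.<? gs
  ... | yes _   = refl
  ... | no i≮gs = contradiction i<gs i≮gs

  isLaw-step : ∀ r i h → IsLaw (next r i h)
  isLaw-step r i h with i ℕ.<? gs
  ... | yes i<gs = R.isLaw-round i (tokenBit {c} r (Fin.fromℕ< i<gs)) (Vec.head h)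
  ... | no _     = IsProbability⇒IsLaw (LateBehavior.isProbability late r h)

  isLaw-run : ∀ r m → IsLaw (run r m)
  isLaw-run r zero          = isLaw-return []
  isLaw-run r (suc zero)    = isLaw-return (initial ident ∷ [])
  isLaw-run r (suc (suc i)) = isLaw->>= (isLaw-run r (suc i)) λ h → isLaw->>= (isLaw-step r i h) λ st → isLaw-return (st ∷ h)

  E-run-suc : ∀ r i (f : History n N (suc (suc i)) → ℚ) →
    E (run r (suc (suc i))) f ≡ E (run r (suc i)) (λ h → E (next r i h) (λ st → f (st ∷ h)))
  E-run-suc r i f = trans (E->>= (run r (suc i)) (λ h → next r i h >>= λ st → return (st ∷ h)) f)
    (E-cong (run r (suc i)) λ h → trans (E->>= (next r i h) (λ st → return (st ∷ h)) f)
      (E-cong (next r i h) λ st → E-return (st ∷ h) f))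

  surely-valid-run : ∀ r i → i ℕ.≤ gs → Surely (run r (suc i)) (λ h → Valid (Vec.head h))
  surely-valid-run r zero    _    = surely-return valid-initial
  surely-valid-run r (suc i) i<gs = surely->>= (surely-valid-run r i (ℕₚ.<⇒≤ i<gs)) λ h valid →
    surely->>= (subst (λ d → Surely d Valid) (sym (step-early r i i<gs h)) (R.surely-valid-round i (tokenBit {c} r (Fin.fromℕ< i<gs)) (Vec.head h) valid)) λ st valid′ →
    surely-return valid′

  run-cong : ∀ i → i ℕ.≤ gs → ∀ {r r′} → (∀ g t → Fin.toℕ g ℕ.< i → tokenBit {c} r g t ≡ tokenBit {c} r′ g t) →
    run r (suc i) ≡ run r′ (suc i)
  run-cong zero    _    _     = refl
  run-cong (suc i) i<gs {r} {r′} agree = trans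
    (cong (_>>= λ h → next r i h >>= λ st → return (st ∷ h)) (run-cong i (ℕₚ.<⇒≤ i<gs) λ g t g<i → agree g t (ℕₚ.m≤n⇒m≤1+n g<i)))
    (>>=-cong (run r′ (suc i)) λ h → cong (_>>= λ st → return (st ∷ h))
      (trans (step-early r i i<gs h) (trans
        (sharedBitRound-cong (𝒢 i) tr (λ t → agree (Fin.fromℕ< i<gs) t (ℕₚ.≤-reflexive (cong suc (Finₚ.toℕ-fromℕ< i<gs)))) (Vec.head h))
        (sym (step-early r′ i i<gs h)))))

  -- The bits of group i are independent of the history up to round i, so they may be drawn afresh.
  E-fresh-group : ∀ i (i<gs : i ℕ.< gs) (f : History n N (suc i) → SharedString c N → ℚ) →
    (∀ h {r r′} → (∀ t → tokenBit {c} r (Fin.fromℕ< i<gs) t ≡ tokenBit {c} r′ (Fin.fromℕ< i<gs) t) → f h r ≡ f h r′) →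
    E (sharedString c N) (λ r → E (run r (suc i)) (λ h → f h r)) ≡
    E (sharedString c N) (λ r → E (run r (suc i)) (λ h → E (sharedString c N) (f h)))
  E-fresh-group i i<gs f f-cong = begin
    E S (λ r → E (run r (suc i)) (λ h → f h r))
      ≡⟨ E-resample (λ _ → coin) (λ _ → isLaw-coin) (λ j → does (groupOf c N j ≟F g)) (λ r → E (run r (suc i)) (λ h → f h r)) ⟩
    E S (λ r → E S (λ ρ → E (run (regroup c N g r ρ) (suc i)) (λ h → f h (regroup c N g r ρ))))
      ≡⟨ E-cong S (λ r → E-cong S λ ρ → trans
           (cong (λ d → E d (λ h → f h (regroup c N g r ρ))) (run-cong i (ℕₚ.<⇒≤ i<gs) λ g′ t g′<i → regroup-other c N g r ρ t (earlier g′<i)))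
           (E-cong (run r (suc i)) λ h → f-cong h (regroup-same c N g r ρ))) ⟩
    E S (λ r → E S (λ ρ → E (run r (suc i)) (λ h → f h ρ)))
      ≡⟨ E-cong S (λ r → E-comm S (run r (suc i)) (λ ρ h → f h ρ)) ⟩
    E S (λ r → E (run r (suc i)) (λ h → E S (f h)))
      ∎
    where
    open ≡-Reasoning
    S = sharedString c N
    g = Fin.fromℕ< i<gs
    earlier : ∀ {g′} → Fin.toℕ g′ ℕ.< i → g′ ≢ g
    earlier g′<i refl = ℕₚ.<-irrefl (Finₚ.toℕ-fromℕ< i<gs) g′<i

  module Drift (bad : State n N → Bool) where

    allBad : ∀ {m} → History n N m → Bool
    allBad = every bad

    survival : ∀ {m} → History n N (suc m) → ℚ
    survival h = ⟦ allBad h ⟧ * weight (Vec.head h)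

    bits : ∀ {i} → i ℕ.< gs → State n N → SharedString c N → Fin n → Bool
    bits i<gs = Bits.advertised (position c N (Fin.fromℕ< i<gs)) (position-injective c N (Fin.fromℕ< i<gs))

    hits : ∀ {i} → i ℕ.< gs → State n N → ℚ
    hits {i} i<gs st = Bits.expectedHits (position c N (Fin.fromℕ< i<gs)) (position-injective c N (Fin.fromℕ< i<gs)) st (𝒢 i)

    module _ {κ : ℚ} (0≤κ : 0ℚ ≤ κ) (drift : ∀ i (i<gs : i ℕ.< gs) st → Valid st → bad st ≡ true → 1ℚ - y * hits i<gs st ≤ κ) where

      survival-step : ∀ r i (i<gs : i ℕ.< gs) (h : History n N (suc i)) → Valid (Vec.head h) →
        E (next r i h) (λ st → survival (st ∷ h)) ≤ survival h * (1ℚ - y * Proposing.H (𝒢 i) (bits i<gs (Vec.head h) r))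
      survival-step r i i<gs h valid = begin
        E (next r i h) (λ st → ⟦ bad st ∧ allBad h ⟧ * weight st)
          ≤⟨ E-mono (isLaw-step r i h) (λ st → *-monoʳ (weight-nonNeg st) (⟦∧⟧≤ (bad st) (allBad h))) ⟩
        E (next r i h) (λ st → ⟦ allBad h ⟧ * weight st)
          ≡⟨ E-*ˡ (next r i h) ⟦ allBad h ⟧ weight ⟩
        ⟦ allBad h ⟧ * E (next r i h) weight
          ≤⟨ *-monoˡ (0≤⟦⟧ (allBad h)) (subst (λ d → E d weight ≤ weight (Vec.head h) * (1ℚ - y * Proposing.H (𝒢 i) (bits i<gs (Vec.head h) r))) (sym (step-early r i i<gs h))
               (R.E-round-weight i (tokenBit {c} r (Fin.fromℕ< i<gs)) (Vec.head h) valid)) ⟩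
        ⟦ allBad h ⟧ * (weight (Vec.head h) * (1ℚ - y * Proposing.H (𝒢 i) (bits i<gs (Vec.head h) r)))
          ≡⟨ ℚₚ.*-assoc ⟦ allBad h ⟧ (weight (Vec.head h)) _ ⟨
        survival h * (1ℚ - y * Proposing.H (𝒢 i) (bits i<gs (Vec.head h) r))
          ∎
        where
        open ≤-Reasoning

      survival-drift : ∀ i (i<gs : i ℕ.< gs) (h : History n N (suc i)) → Valid (Vec.head h) →
        E (sharedString c N) (λ r → survival h * (1ℚ - y * Proposing.H (𝒢 i) (bits i<gs (Vec.head h) r))) ≤ κ * survival h
      survival-drift i i<gs h valid = begin
        E (sharedString c N) (λ r → survival h * (1ℚ - y * Proposing.H (𝒢 i) (bits i<gs (Vec.head h) r)))
          ≡⟨ trans (E-*ˡ (sharedString c N) (survival h) _) (cong (survival h *_) (trans (E-complement isLaw-S (λ r → y * Proposing.H (𝒢 i) (bits i<gs (Vec.head h) r)))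
               (cong (λ q → 1ℚ - q) (E-*ˡ (sharedString c N) y (λ r → Proposing.H (𝒢 i) (bits i<gs (Vec.head h) r)))))) ⟩
        ⟦ allBad h ⟧ * weight (Vec.head h) * (1ℚ - y * hits i<gs (Vec.head h))
          ≤⟨ bound (allBad h) refl ⟩
        κ * survival h
          ∎
        where
        open ≤-Reasoning
        head-bad : ∀ {m} (h : History n N (suc m)) → allBad h ≡ true → bad (Vec.head h) ≡ true
        head-bad (st ∷ h) eq = proj₁ (∧-true {bad st} eq)
        bound : ∀ B → allBad h ≡ B → ⟦ B ⟧ * weight (Vec.head h) * (1ℚ - y * hits i<gs (Vec.head h)) ≤ κ * (⟦ B ⟧ * weight (Vec.head h))
        bound true  eq = ≤-trans (*-monoˡ (0≤* 0≤1 (weight-nonNeg (Vec.head h))) (drift i i<gs (Vec.head h) valid (head-bad h eq)))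
          (≤-reflexive (ℚₚ.*-comm (1ℚ * weight (Vec.head h)) κ))
        bound false _  = ≤-reflexive (identity (weight (Vec.head h)) (1ℚ - y * hits i<gs (Vec.head h)) κ)
          where
          identity : ∀ w e k → 0ℚ * w * e ≡ k * (0ℚ * w)
          identity = solve-∀ ℚring

      E-survival : ∀ m → m ℕ.≤ gs → E (sharedString c N) (λ r → E (run r (suc m)) survival) ≤ κ ^ m
      E-survival zero    _    = begin
        E (sharedString c N) (λ r → E (return (initial ident ∷ [])) survival)
          ≡⟨ trans (E-const isLaw-S (E (return (initial ident ∷ [])) survival)) (E-return (initial ident ∷ []) survival) ⟩
        ⟦ bad (initial ident) ∧ true ⟧ * weight (initial ident)
          ≤⟨ *-mono (0≤⟦⟧ (bad (initial ident) ∧ true)) 0≤1 (⟦⟧≤1 (bad (initial ident) ∧ true)) (^-antimonoʳ {n = Φ (initial ident)} 0≤a a≤1 ℕ.z≤n) ⟩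
        1ℚ ∎
        where open ≤-Reasoning
      E-survival (suc i) i<gs = begin
        E S (λ r → E (run r (suc (suc i))) survival)
          ≡⟨ E-cong S (λ r → E-run-suc r i survival) ⟩
        E S (λ r → E (run r (suc i)) (λ h → E (next r i h) (λ st → survival (st ∷ h))))
          ≤⟨ E-mono isLaw-S (λ r → E-mono-on (isLaw-run r (suc i)) (surely-valid-run r i (ℕₚ.<⇒≤ i<gs)) (survival-step r i i<gs)) ⟩
        E S (λ r → E (run r (suc i)) (λ h → survival h * (1ℚ - y * Proposing.H (𝒢 i) (bits i<gs (Vec.head h) r))))
          ≡⟨ E-fresh-group i i<gs (λ h r → survival h * (1ℚ - y * Proposing.H (𝒢 i) (bits i<gs (Vec.head h) r)))
               (λ h {r} {r′} agree → cong (λ H → survival h * (1ℚ - y * H)) (H-cong (𝒢 i) λ u → advertise-cong agree (lookup (Vec.head h) u))) ⟩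
        E S (λ r → E (run r (suc i)) (λ h → E S (λ ρ → survival h * (1ℚ - y * Proposing.H (𝒢 i) (bits i<gs (Vec.head h) ρ)))))
          ≤⟨ E-mono isLaw-S (λ r → E-mono-on (isLaw-run r (suc i)) (surely-valid-run r i (ℕₚ.<⇒≤ i<gs)) (survival-drift i i<gs)) ⟩
        E S (λ r → E (run r (suc i)) (λ h → κ * survival h))
          ≡⟨ trans (E-cong S (λ r → E-*ˡ (run r (suc i)) κ survival)) (E-*ˡ S κ (λ r → E (run r (suc i)) survival)) ⟩
        κ * E S (λ r → E (run r (suc i)) survival)
          ≤⟨ *-monoˡ 0≤κ (E-survival i (ℕₚ.<⇒≤ i<gs)) ⟩
        κ ^ suc i
          ∎
        where
        open ≤-Reasoning
        S = sharedString c N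

      failure : ℕ → ℚ
      failure m = E (sharedString c N) (λ r → E (run r m) (λ h → ⟦ allBad h ⟧))

      failure-nonNeg : ∀ m → 0ℚ ≤ failure m
      failure-nonNeg m = E-nonNeg isLaw-S λ r → E-nonNeg (isLaw-run r m) λ h → 0≤⟦⟧ (allBad h)

      failure-antitone : ∀ k m → failure (suc (k ℕ.+ m)) ≤ failure (suc m)
      failure-antitone zero    m = ≤-refl
      failure-antitone (suc k) m = ≤-trans (E-mono isLaw-S λ r → ≤-trans (≤-reflexive (E-run-suc r (k ℕ.+ m) (λ h → ⟦ allBad h ⟧)))
        (E-mono (isLaw-run r (suc (k ℕ.+ m))) λ h → ≤-trans (E-mono (isLaw-step r (k ℕ.+ m) h) (λ st → ⟦∧⟧≤ (bad st) (allBad h)))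
          (≤-reflexive (E-const (isLaw-step r (k ℕ.+ m) h) ⟦ allBad h ⟧)))) (failure-antitone k m)

      failure-bound : ∀ m → m ℕ.≤ gs → failure (suc m) * a ^ (n ℕ.* n) ≤ κ ^ m
      failure-bound m m≤gs = ≤-trans (≤-reflexive (trans (sym (E-*ʳ (sharedString c N) (a ^ (n ℕ.* n)) _)) (E-cong (sharedString c N) λ r → sym (E-*ʳ (run r (suc m)) (a ^ (n ℕ.* n)) _))))
        (≤-trans (E-mono isLaw-S λ r → E-mono (isLaw-run r (suc m)) λ h → *-monoˡ (0≤⟦⟧ (allBad h)) (^-antimonoʳ 0≤a a≤1 (Φ≤n² (Vec.head h))))
          (E-survival m m≤gs))

      success : ∀ m → 1ℚ - failure m ≡ E (execution {δ = δ} ident 𝒢 tr late m) (λ h → ⟦ not (allBad h) ⟧)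
      success m = sym (trans (E->>= (sharedString c N) (λ r → run r m) (λ h → ⟦ not (allBad h) ⟧))
        (trans (E-cong (sharedString c N) λ r → trans (E-cong (run r m) λ h → ⟦⟧-not (allBad h)) (E-complement (isLaw-run r m) (λ h → ⟦ allBad h ⟧)))
          (E-complement isLaw-S (λ r → E (run r m) (λ h → ⟦ allBad h ⟧)))))

-- Numerical estimates and facts on graphs

^-1 : ∀ k → 1ℚ ^ k ≡ 1ℚ
^-1 zero    = refl
^-1 (suc k) = trans (ℚₚ.*-identityˡ (1ℚ ^ k)) (^-1 k)

reciprocal : 1ℚ ≤ q → ∃ λ κ → 0ℚ ≤ κ × κ * q ≡ 1ℚ
reciprocal {q} 1≤q = κ , ℚₚ.<⇒≤ (ℚₚ.positive⁻¹ κ) , ℚₚ.*-inverseˡ q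
  where
  instance
    pos-q : ℚ.Positive q
    pos-q = positive (ℚₚ.<-≤-trans 0<1 1≤q)
    nonZero-q : ℚ.NonZero q
    nonZero-q = ℚₚ.pos⇒nonZero q
  κ = ℚ.1/ q
  instance
    pos-κ : ℚ.Positive κ
    pos-κ = ℚₚ.1/pos⇒pos q

n≤2^n : ∀ n → fromℕ n ≤ fromℕ 2 ^ n
n≤2^n n = ≤-trans (≤-+ʳ 0≤1 (identity (fromℕ n))) (bernoulli n (0≤fromℕ 2))
  where
  identity : ∀ n → 1ℚ + n * 1ℚ ≡ n + 1ℚ
  identity = solve-∀ ℚring

-- With R = m + 1 and L = ⌊m / n⌋ one has 2Ln ≥ R, so (1 + z)^L ≥ 1 + Lz ≥ 4.
4^n≤[1+z]^m : ∀ n m → 1 ℕ.≤ n → 2 ℕ.* n ℕ.≤ suc m → 0ℚ ≤ z → fromℕ (suc m) * z ≡ fromℕ 6 * fromℕ n →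
  fromℕ 4 ^ n ≤ (1ℚ + z) ^ m
4^n≤[1+z]^m {z} n@(suc n-1) m _ 2n≤R 0≤z Rz≡6n = begin
  fromℕ 4 ^ n              ≤⟨ ^-monoˡ n (0≤fromℕ 4) (≤-trans (ℚₚ.+-monoʳ-≤ 1ℚ 3≤Lz) (bernoulli L (0≤+ 0≤1 0≤z))) ⟩
  ((1ℚ + z) ^ L) ^ n       ≡⟨ ^-assocʳ (1ℚ + z) L n ⟩
  (1ℚ + z) ^ (L ℕ.* n)     ≤⟨ ^-monoʳ (≤-+ʳ 0≤z refl) (DivMod.m/n*n≤m m n) ⟩
  (1ℚ + z) ^ m             ∎
  where
  open ≤-Reasoning
  L = m DivMod./ n
  R = suc m
  R≤n+Ln : R ℕ.≤ n ℕ.+ L ℕ.* n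
  R≤n+Ln = ℕₚ.≤-trans (ℕₚ.≤-reflexive (cong suc (DivMod.m≡m%n+[m/n]*n m n))) (ℕₚ.+-monoˡ-≤ (L ℕ.* n) (DivMod.m%n<n m n))
  R≤2Ln : R ℕ.≤ 2 ℕ.* (L ℕ.* n)
  R≤2Ln = ℕₚ.+-cancelˡ-≤ (2 ℕ.* n) R (2 ℕ.* (L ℕ.* n)) (ℕₚ.≤-trans (ℕₚ.+-monoˡ-≤ R 2n≤R)
    (ℕₚ.≤-trans (ℕₚ.+-mono-≤ R≤n+Ln R≤n+Ln) (ℕₚ.≤-reflexive (trans (sym (cong ((n ℕ.+ L ℕ.* n) ℕ.+_) (ℕₚ.+-identityʳ (n ℕ.+ L ℕ.* n)))) (ℕₚ.*-distribˡ-+ 2 n (L ℕ.* n))))))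
  3≤Lz : fromℕ 3 ≤ fromℕ L * z
  3≤Lz = *-cancelˡ (0<fromℕ-suc m) (begin
    fromℕ R * fromℕ 3                   ≤⟨ *-monoʳ (0≤fromℕ 3) (fromℕ-mono R≤2Ln) ⟩
    fromℕ (2 ℕ.* (L ℕ.* n)) * fromℕ 3   ≡⟨ cong (_* fromℕ 3) (trans (fromℕ-* 2 (L ℕ.* n)) (cong (fromℕ 2 *_) (fromℕ-* L n))) ⟩
    fromℕ 2 * (fromℕ L * fromℕ n) * fromℕ 3  ≡⟨ identity (fromℕ L) (fromℕ n) ⟩
    fromℕ L * (fromℕ 6 * fromℕ n)       ≡⟨ cong (fromℕ L *_) Rz≡6n ⟨
    fromℕ L * (fromℕ R * z)             ≡⟨ *-swap (fromℕ L) (fromℕ R) z ⟩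
    fromℕ R * (fromℕ L * z)             ∎)
    where
    identity : ∀ l n → fromℕ 2 * (l * n) * fromℕ 3 ≡ l * (fromℕ 6 * n)
    identity = solve-∀ ℚring

½^n≤a^n² : ∀ n → 0ℚ ≤ 1ℚ - ((y + y) + (y + y)) → y * (fromℕ 8 * fromℕ n) ≡ 1ℚ → ½ ^ n ≤ (1ℚ - ((y + y) + (y + y))) ^ (n ℕ.* n)
½^n≤a^n² {y} n 0≤a 8yn≡1 = ≤-trans (^-monoˡ n (0≤// 1 2) ½≤a^n) (≤-reflexive (^-assocʳ (1ℚ - ((y + y) + (y + y))) n n))
  where
  open ≤-Reasoning
  ½≤a^n : ½ ≤ (1ℚ - ((y + y) + (y + y))) ^ n
  ½≤a^n = begin
    ½                                                      ≡⟨⟩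
    1ℚ - ½ * 1ℚ                                            ≡⟨ cong (λ e → 1ℚ - ½ * e) 8yn≡1 ⟨
    1ℚ - ½ * (y * (fromℕ 8 * fromℕ n))                     ≡⟨ identity y (fromℕ n) ⟩
    1ℚ + fromℕ n * (0ℚ - ((y + y) + (y + y)))              ≤⟨ bernoulli n (subst (0ℚ ≤_) (identity′ y) 0≤a) ⟩
    (1ℚ + (0ℚ - ((y + y) + (y + y)))) ^ n                  ≡⟨ cong (_^ n) (identity′ y) ⟨
    (1ℚ - ((y + y) + (y + y))) ^ n                         ∎
    where
    identity : ∀ y n → 1ℚ - ½ * (y * (fromℕ 8 * n)) ≡ 1ℚ + n * (0ℚ - ((y + y) + (y + y)))
    identity = solve-∀ ℚring
    identity′ : ∀ y → 1ℚ - ((y + y) + (y + y)) ≡ 1ℚ + (0ℚ - ((y + y) + (y + y)))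
    identity′ = solve-∀ ℚring

small-failure : ∀ n {f t w A} → 0ℚ ≤ f → ½ ^ n ≤ A → f * A ≤ t → 0ℚ ≤ w → fromℕ 4 ^ n ≤ w → t * w ≤ 1ℚ → f * fromℕ n ≤ 1ℚ
small-failure n {f} {t} {w} {A} 0≤f ½^n≤A fA≤t 0≤w 4^n≤w tw≤1 = begin
  f * fromℕ n                    ≤⟨ *-monoˡ 0≤f (n≤2^n n) ⟩
  f * fromℕ 2 ^ n                ≡⟨ cong (f *_) (^-distrib-* ½ (fromℕ 4) n) ⟩
  f * (½ ^ n * fromℕ 4 ^ n)      ≤⟨ *-monoˡ 0≤f (*-mono (^-nonNeg n (0≤// 1 2)) 0≤w ½^n≤A 4^n≤w) ⟩
  f * (A * w)                    ≡⟨ ℚₚ.*-assoc f A w ⟨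
  f * A * w                      ≤⟨ *-monoʳ 0≤w fA≤t ⟩
  t * w                          ≤⟨ tw≤1 ⟩
  1ℚ                             ∎
  where open ≤-Reasoning

subsets : ∀ n → List (Subset n)
subsets zero    = [] ∷ []
subsets (suc n) = map (true ∷_) (subsets n) ++ map (false ∷_) (subsets n)

∈-subsets : (S : Subset n) → S L.∈ subsets n
∈-subsets []          = here refl
∈-subsets (true  ∷ S) = L.∈-++⁺ˡ (L.∈-map⁺ (true ∷_) (∈-subsets S))
∈-subsets (false ∷ S) = L.∈-++⁺ʳ (map (true ∷_) (subsets _)) (L.∈-map⁺ (false ∷_) (∈-subsets S))

admissible? : (S : Subset n) → Dec (Admissible S)
admissible? {n} S = 0 ℕ.<? ∣ S ∣ ×-dec 2 ℕ.* ∣ S ∣ ℕ.≤? n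

isExpansion-exists : (G : Graph n) (S : Subset n) → Admissible S → ∃ λ β → IsExpansion G β × β ≤ expansionRatio G S
isExpansion-exists {n} G S adm = expansionRatio G best ,
  ((best , argmin-all (expansionRatio G) {xs = candidates} adm (All.all-filter admissible? (subsets n)) , refl) ,
   λ S′ adm′ → All.lookup (f[argmin]≤f[xs] {f = expansionRatio G} S candidates) (L.∈-filter⁺ admissible? (∈-subsets S′) adm′)) ,
  f[argmin]≤f[⊤] {f = expansionRatio G} S candidates
  where
  candidates = filter admissible? (subsets n)
  best = argmin (expansionRatio G) S candidates

subset-of-size : k ℕ.≤ n → ∃ λ (S : Subset n) → ∣ S ∣ ≡ k
subset-of-size {n = n} ℕ.z≤n       = Subset.⊥ , Subₚ.∣⊥∣≡0 n
subset-of-size         (ℕ.s≤s k≤n) with S , eq ← subset-of-size k≤n = true ∷ S , cong suc eq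

boundary+size≤n : (G : Graph n) (S : Subset n) → ∣ boundary G S ∣ ℕ.+ ∣ S ∣ ℕ.≤ n
boundary+size≤n {n} G S = ℕₚ.≤-trans
  (ℕₚ.+-monoˡ-≤ ∣ S ∣ (ℕₚ.≤-trans (Subₚ.p⊆q⇒∣p∣≤∣q∣ ∂⊆∁) (ℕₚ.≤-reflexive (Subₚ.∣∁p∣≡n∸∣p∣ S))))
  (ℕₚ.≤-reflexive (ℕₚ.m∸n+n≡m (Subₚ.∣p∣≤n S)))
  where
  ∂⊆∁ : boundary G S ⊆ ∁ S
  ∂⊆∁ {v} v∈∂ = Subₚ.x∉p⇒x∈∁p λ v∈S → true≢false (∈⇒true v∈S) (proj₁ (∈-boundary G S v∈∂))

module Expansion {n : ℕ} (2≤n : 2 ℕ.≤ n) (𝒢 : DynamicGraph n) {α : ℚ} (isα : IsDynamicExpansion 𝒢 α) where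

  α≤ratio : ∀ i S → Admissible S → α ≤ expansionRatio (𝒢 i) S
  α≤ratio i S adm with β , isβ , β≤ ← isExpansion-exists (𝒢 i) S adm = ≤-trans (proj₂ isα i β isβ) β≤

  expands : ∀ i S → 2 ℕ.* ∣ S ∣ ℕ.≤ n → α * fromℕ ∣ S ∣ ≤ fromℕ ∣ boundary (𝒢 i) S ∣
  expands i S small = go ∣ S ∣ refl
    where
    go : ∀ k → ∣ S ∣ ≡ k → α * fromℕ ∣ S ∣ ≤ fromℕ ∣ boundary (𝒢 i) S ∣
    go zero    eq = ≤-trans (≤-reflexive (trans (cong (λ k → α * fromℕ k) eq) (ℚₚ.*-zeroʳ α))) (0≤fromℕ ∣ boundary (𝒢 i) S ∣)
    go (suc k) eq = ≤-trans
      (*-monoʳ (0≤fromℕ ∣ S ∣) (α≤ratio i S (subst (0 ℕ.<_) (sym eq) ℕ.z<s , small)))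
      (≤-reflexive (trans (cong (λ k → (∣ boundary (𝒢 i) S ∣ // k) * fromℕ k) eq) (//-*-cancel ∣ boundary (𝒢 i) S ∣ k)))

  0≤α : 0ℚ ≤ α
  0≤α with proj₁ isα
  ... | i , (S , _ , refl) , _ = 0≤// ∣ boundary (𝒢 i) S ∣ ∣ S ∣

  α≤2 : α ≤ 1ℚ + 1ℚ
  α≤2 with subset-of-size {n ℕ./ 2} {n} (DivMod.m/n≤m n 2)
  ... | S , eq = go ∣ S ∣ refl
    where
    half : 2 ℕ.* ∣ S ∣ ℕ.≤ n
    half = ℕₚ.≤-trans (ℕₚ.≤-reflexive (trans (cong (2 ℕ.*_) eq) (ℕₚ.*-comm 2 (n ℕ./ 2)))) (DivMod.m/n*n≤m n 2)
    n≤1+2S : n ℕ.≤ 1 ℕ.+ 2 ℕ.* ∣ S ∣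
    n≤1+2S = ℕₚ.≤-trans (ℕₚ.≤-reflexive (DivMod.m≡m%n+[m/n]*n n 2))
      (ℕₚ.+-mono-≤ (ℕ.s≤s⁻¹ (DivMod.m%n<n n 2)) (ℕₚ.≤-reflexive (trans (ℕₚ.*-comm (n ℕ./ 2) 2) (cong (2 ℕ.*_) (sym eq)))))
    go : ∀ k → ∣ S ∣ ≡ k → α ≤ 1ℚ + 1ℚ
    go zero    eq′ = contradiction (ℕₚ.≤-trans 2≤n (subst (λ k → n ℕ.≤ 1 ℕ.+ 2 ℕ.* k) eq′ n≤1+2S)) λ { (ℕ.s≤s ()) }
    go (suc k) eq′ = *-cancelˡ (0<fromℕ-suc k) (begin
      fromℕ (suc k) * α                      ≡⟨ ℚₚ.*-comm (fromℕ (suc k)) α ⟩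
      α * fromℕ (suc k)                      ≡⟨ cong (λ k → α * fromℕ k) eq′ ⟨
      α * fromℕ ∣ S ∣                        ≤⟨ expands 0 S half ⟩
      fromℕ ∣ boundary (𝒢 0) S ∣             ≤⟨ fromℕ-mono boundary≤ ⟩
      fromℕ (suc k ℕ.+ suc k)                ≡⟨ fromℕ-+ (suc k) (suc k) ⟩
      fromℕ (suc k) + fromℕ (suc k)          ≡⟨ identity (fromℕ (suc k)) ⟩
      fromℕ (suc k) * (1ℚ + 1ℚ)              ∎)
      where
      open ≤-Reasoning
      identity : ∀ k → k + k ≡ k * (1ℚ + 1ℚ)
      identity = solve-∀ ℚring
      boundary≤ : ∣ boundary (𝒢 0) S ∣ ℕ.≤ suc k ℕ.+ suc k
      boundary≤ = ℕₚ.+-cancelʳ-≤ (suc k) _ _ (ℕₚ.≤-trans (subst (λ k → ∣ boundary (𝒢 0) S ∣ ℕ.+ k ℕ.≤ n) eq′ (boundary+size≤n (𝒢 0) S))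
        (ℕₚ.≤-trans (subst (λ k → n ℕ.≤ 1 ℕ.+ 2 ℕ.* k) eq′ n≤1+2S)
          (ℕₚ.≤-trans (ℕₚ.≤-reflexive (cong (λ x → 1 ℕ.+ (suc k ℕ.+ x)) (ℕₚ.+-identityʳ (suc k))))
            (ℕₚ.≤-trans (ℕₚ.+-monoˡ-≤ (suc k ℕ.+ suc k) (ℕ.s≤s ℕ.z≤n)) (ℕₚ.≤-reflexive (ℕₚ.+-comm (suc k) (suc k ℕ.+ suc k)))))))

2≤length : {xs : List X} {x y : X} → x L.∈ xs → y L.∈ xs → x ≢ y → 2 ℕ.≤ length xs
2≤length {xs = _ ∷ []}    (here refl) (here refl) x≢y = contradiction refl x≢y
2≤length {xs = _ ∷ _ ∷ _} _           _           _   = ℕ.s≤s (ℕ.s≤s ℕ.z≤n)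

∈-neighbors : (G : Graph n) {u v : Fin n} → T (adj G u v) → v L.∈ neighbors G u
∈-neighbors G {u} {v} uv = L.∈-filter⁺ (T? ∘ adj G u) (L.∈-allFin v) uv

2≤maxDegree : ∀ {Δ} → 3 ℕ.≤ n → (G : Graph n) → Connected G → (∀ u → degree G u ℕ.≤ Δ) → 2 ℕ.≤ Δ
2≤maxDegree {n@(suc (suc (suc _)))} {Δ} (ℕ.s≤s (ℕ.s≤s (ℕ.s≤s _))) G connected degree≤Δ with 2 ℕ.≤? Δ
... | yes 2≤Δ = 2≤Δ
... | no  2≰Δ = contradiction two-nodes λ ()
  where
  unique : ∀ {u v w} → T (adj G u v) → T (adj G u w) → v ≡ w
  unique {u} {v} {w} uv uw with v ≟F w
  ... | yes v≡w = v≡w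
  ... | no v≢w  = contradiction (ℕₚ.≤-trans (2≤length (∈-neighbors G uv) (∈-neighbors G uw) v≢w) (degree≤Δ u)) 2≰Δ
  sym-adj : ∀ {u v} → T (adj G u v) → T (adj G v u)
  sym-adj {u} {v} = subst T (symmetric G u v)
  trapped : ∀ {u w x v} → T (adj G u w) → x ≡ u ⊎ x ≡ w → Star (λ x y → T (adj G x y)) x v → v ≡ u ⊎ v ≡ w
  trapped uw at          stop       = at
  trapped uw (inj₁ refl) (xy ◅ p) = trapped uw (inj₂ (unique xy uw)) p
  trapped uw (inj₂ refl) (xy ◅ p) = trapped uw (inj₁ (unique xy (sym-adj uw))) p
  two-nodes : _≡_ {A = Fin n} (suc zero) (suc (suc zero))
  two-nodes with connected zero (suc zero)
  ... | uw ◅ _ with trapped uw (inj₁ refl) (connected zero (suc zero)) | trapped uw (inj₁ refl) (connected zero (suc (suc zero)))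
  ...   | inj₂ eq | inj₂ eq′ = trans eq (sym eq′)

log-≥1 : ∀ {Δ ℓ} → 2 ℕ.≤ Δ → Log₂≤ Δ ℓ → 1ℚ ≤ ℓ
log-≥1 {Δ} 2≤Δ (a , b , refl , Δ^≤2^) = *-cancelˡ (0<fromℕ-suc b) (≤-trans
  (≤-reflexive (ℚₚ.*-identityʳ (fromℕ (suc b))))
  (≤-trans (fromℕ-mono b<a) (≤-reflexive (trans (sym (//-*-cancel a b)) (ℚₚ.*-comm (a // suc b) (fromℕ (suc b)))))))
  where
  b<a : suc b ℕ.≤ a
  b<a = ℕₚ.≮⇒≥ λ a<1+b → ℕₚ.<⇒≱ (ℕₚ.^-monoʳ-< 2 (ℕ.s≤s (ℕ.s≤s ℕ.z≤n)) a<1+b) (ℕₚ.≤-trans (ℕₚ.^-monoˡ-≤ (suc b) 2≤Δ) Δ^≤2^)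

sqrt-bounds : ∀ {Δ ℓ s} → 2 ℕ.≤ Δ → 1ℚ ≤ ℓ → Sqrt≤ (fromℕ Δ * ℓ) s → 1ℚ ≤ s × fromℕ Δ ≤ s * s
sqrt-bounds {Δ} {ℓ} {s} 2≤Δ 1≤ℓ (0≤s , Δℓ≤s²) = 1≤s , Δ≤s²
  where
  Δ≤s² : fromℕ Δ ≤ s * s
  Δ≤s² = ≤-trans (≤-reflexive (sym (ℚₚ.*-identityʳ (fromℕ Δ)))) (≤-trans (*-monoˡ (0≤fromℕ Δ) 1≤ℓ) Δℓ≤s²)
  1≤s : 1ℚ ≤ s
  1≤s with 1ℚ ℚₚ.≤? s
  ... | yes 1≤s = 1≤s
  ... | no  1≰s = contradiction (fromℕ-cancel-≤ {2} {1} (≤-trans (fromℕ-mono 2≤Δ) (≤-trans Δ≤s²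
    (*-mono 0≤s 0≤1 s≤1 s≤1)))) λ { (ℕ.s≤s ()) }
    where
    s≤1 : s ≤ 1ℚ
    s≤1 = ℚₚ.<⇒≤ (ℚₚ.≰⇒> 1≰s)

1//n*n : 1 ℕ.≤ n → (1 // n) * fromℕ n ≡ 1ℚ
1//n*n {suc k} _ = //-*-cancel 1 k

1//≤½ : 2 ℕ.≤ k → 1 // k ≤ ½
1//≤½ {k} 2≤k = *-cancelˡ {r = fromℕ 2} (0<fromℕ-suc 1) (begin
  fromℕ 2 * (1 // k)      ≤⟨ *-monoʳ (0≤// 1 k) (fromℕ-mono {2} {k} 2≤k) ⟩
  fromℕ k * (1 // k)      ≡⟨ ℚₚ.*-comm (fromℕ k) (1 // k) ⟩
  (1 // k) * fromℕ k      ≡⟨ 1//n*n (ℕₚ.≤-trans (ℕ.s≤s ℕ.z≤n) 2≤k) ⟩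
  1ℚ                      ≡⟨⟩
  fromℕ 2 * ½             ∎)
  where open ≤-Reasoning

large : ℚ → State n N → Fin n → Bool
large {n} q st u = does (q * fromℕ n ℚₚ.≤? classSize st u)

-- Valid states satisfy the second conjunct; it makes every state that is not bad solved.
bad : ℚ → (Fin n → Fin N) → State n N → Bool
bad {n} q ident st = not (does (any? λ u → T? (large q st u)) ∧ does (all? λ w → ident w Subₚ.∈? lookup st w))

¬bad⇒Solved : (ε : ℝ) {q : ℚ} → ε ᴿ≤ q → (ident : Fin n → Fin N) (st : State n N) → bad q ident st ≡ false → Solved ε ident st
¬bad⇒Solved {n} ε {q} ε≤q ident st good = tabulate (sameSet st u) , enough , share
  where
  both : does (any? λ u → T? (large q st u)) ≡ true × does (all? λ w → ident w Subₚ.∈? lookup st w) ≡ true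
  both = ∧-true (trans (sym (Boolₚ.not-involutive _)) (cong not good))
  witness : ∃ λ u → T (large q st u)
  witness = does⇒ (any? λ u → T? (large q st u)) (proj₁ both)
  u : Fin n
  u = proj₁ witness
  enough : ∀ p → p <ᴿ ε → p * fromℕ n ≤ fromℕ ∣ tabulate (sameSet st u) ∣
  enough p p<ε = ≤-trans (*-monoʳ (0≤fromℕ n) (ε≤q p p<ε))
    (≤-trans (does⇒ (q * fromℕ n ℚₚ.≤? classSize st u) (T⇒≡true (proj₂ witness))) (≤-reflexive (sym (count-tabulate (sameSet st u)))))
  own : ∀ w → ident w ∈ lookup st w
  own = does⇒ (all? λ w → ident w Subₚ.∈? lookup st w) (proj₂ both)
  equal : ∀ {v} → v ∈ tabulate (sameSet st u) → lookup st u ≡ lookup st v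
  equal {v} v∈ = does⇒ (Vecₚ.≡-dec Boolₚ._≟_ (lookup st u) (lookup st v)) (∈-tabulate⇒ (sameSet st u) v∈)
  share : ∀ v w → v ∈ tabulate (sameSet st u) → w ∈ tabulate (sameSet st u) → ident w ∈ lookup st v × ident v ∈ lookup st w
  share v w v∈ w∈ = subst (ident w ∈_) (trans (sym (equal w∈)) (equal v∈)) (own w) , subst (ident v ∈_) (trans (sym (equal v∈)) (equal w∈)) (own v)

bad⇒classes-small : (ident : Fin n → Fin N) (st : State n N) → Potential.Valid ident st → bad q ident st ≡ true →
  ∀ u → ¬ (q * fromℕ n ≤ classSize st u)
bad⇒classes-small {n} {q = q} ident st valid isBad u large-u = true≢false
  (cong₂ _∧_ (dec-true (any? λ u → T? (large q st u)) (u , ≡true⇒T (dec-true (q * fromℕ n ℚₚ.≤? classSize st u) large-u)))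
             (dec-true (all? λ w → ident w Subₚ.∈? lookup st w) (λ w → proj₁ (valid w))))
  (not-true isBad)

differing-edge : (G : Graph n) (st : State n N) {u v : Fin n} → Star (λ x y → T (adj G x y)) u v → lookup st u ≢ lookup st v →
  ∃₂ λ x y → adj G x y ≡ true × lookup st x ≢ lookup st y
differing-edge G st     stop                     u≁v = contradiction refl u≁v
differing-edge G st {u} (_◅_ {j = x} ux path)  u≁v with Vecₚ.≡-dec Boolₚ._≟_ (lookup st u) (lookup st x)
... | yes u~x = differing-edge G st path (u≁v ∘ trans u~x)
... | no  u≁x = u , x , T⇒≡true ux , u≁x

differing-node : (st : State n N) (u : Fin n) → ¬ (1ℚ * fromℕ n ≤ classSize st u) → ∃ λ v → lookup st u ≢ lookup st v
differing-node {n} st u small with any? (λ v → T? (not (sameSet st u v)))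
... | yes (v , differ) = v , does⇒¬ (Vecₚ.≡-dec Boolₚ._≟_ (lookup st u) (lookup st v)) (not-true (T⇒≡true differ))
... | no none = contradiction (≤-reflexive (trans (ℚₚ.*-identityˡ (fromℕ n)) (trans (sym (sum-1 n))
  (sum-cong-≗ λ v → sym (cong ⟦_⟧ (≢false⇒true λ eq → none (v , ≡true⇒T (cong not eq)))))))) small

rate-exists : ∀ n m → ∃ λ z → 0ℚ ≤ z × fromℕ (suc m) * z ≡ fromℕ 6 * fromℕ n
rate-exists n m = (6 ℕ.* n) // suc m , 0≤// (6 ℕ.* n) (suc m) ,
  trans (ℚₚ.*-comm (fromℕ (suc m)) ((6 ℕ.* n) // suc m)) (trans (//-*-cancel (6 ℕ.* n) m) (fromℕ-* 6 n))

-- With y = 1/(8n) the base a = 1 − 4y of the weight satisfies aⁿ ≥ ½, hence a^(n²) ≥ 2⁻ⁿ.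
unit-exists : ∀ n → 1 ℕ.≤ n → ∃ λ y → 0ℚ ≤ y × y * (fromℕ 8 * fromℕ n) ≡ 1ℚ
unit-exists n 1≤n = 1 // (8 ℕ.* n) , 0≤// 1 (8 ℕ.* n) ,
  trans (cong (1 // (8 ℕ.* n) *_) (sym (fromℕ-* 8 n))) (1//n*n (ℕₚ.≤-trans 1≤n (ℕₚ.m≤m+n n (7 ℕ.* n))))

1//n^k≤½ : ∀ k → 2 ℕ.≤ n → 1 ℕ.≤ k → 1 // (n ℕ.^ k) ≤ ½
1//n^k≤½ {n} k 2≤n 1≤k = 1//≤½ (ℕₚ.≤-trans 2≤n (ℕₚ.≤-trans (ℕₚ.≤-reflexive (sym (ℕₚ.*-identityʳ n)))
  (ℕₚ.^-monoʳ-≤ n {{ℕ.>-nonZero (ℕₚ.≤-trans (ℕ.s≤s ℕ.z≤n) 2≤n)}} 1≤k)))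

<1⇒≤1 : (ε : ℝ) → ε ᴿ< 1ℚ → ε ᴿ≤ 1ℚ
<1⇒≤1 ε ε<1 p p<ε = ℚₚ.<⇒≤ (ℚₚ.≰⇒> λ 1≤p → ℝ.disjoint ε (p<ε , upward 1≤p))
  where
  upward : ∀ {p} → 1ℚ ≤ p → ε ᴿ< p
  upward {p} 1≤p with 1ℚ ℚₚ.<? p
  ... | yes 1<p = ℝ.upper-closed ε 1<p ε<1
  ... | no  1≮p = subst (ε ᴿ<_) (ℚₚ.≤-antisym 1≤p (ℚₚ.≮⇒≥ 1≮p)) ε<1

module Guarantee {n N c : ℕ} {δ : ℚ} (ident : Fin n → Fin N) (𝒢 : DynamicGraph n)
  (tr : Transfer N δ) (late : LateBehavior c n N) (δ≤½ : δ ≤ ½) (2≤n : 2 ℕ.≤ n)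
  {y : ℚ} (0≤y : 0ℚ ≤ y) (y8n≡1 : y * (fromℕ 8 * fromℕ n) ≡ 1ℚ) where

  1≤n : 1 ℕ.≤ n
  1≤n = ℕₚ.≤-trans (ℕ.s≤s ℕ.z≤n) 2≤n

  0≤yn : 0ℚ ≤ y * fromℕ n
  0≤yn = 0≤* 0≤y (0≤fromℕ n)

  2yn≤1 : (y + y) * fromℕ n ≤ 1ℚ
  2yn≤1 = ≤-+ʳ (0≤* (0≤fromℕ 6) 0≤yn) (trans (sym y8n≡1) (identity y (fromℕ n)))
    where
    identity : ∀ y n → y * (fromℕ 8 * n) ≡ (y + y) * n + fromℕ 6 * (y * n)
    identity = solve-∀ ℚring

  4y≤1 : (y + y) + (y + y) ≤ 1ℚ
  4y≤1 = ≤-+ʳ (0≤+ (0≤* (0≤fromℕ 4) 0≤yn) (0≤* (0≤* (0≤fromℕ 4) 0≤y) (p≤q⇒0≤q-p (fromℕ-mono {1} {n} 1≤n)))) (trans (sym y8n≡1) (identity y (fromℕ n)))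
    where
    identity : ∀ y n → y * (fromℕ 8 * n) ≡ ((y + y) + (y + y)) + (fromℕ 4 * (y * n) + fromℕ 4 * y * (n - 1ℚ))
    identity = solve-∀ ℚring

  open Potential ident
  open Exchanging ident tr δ≤½ 0≤y 4y≤1 using (a; 0≤a)
  open Execution {c = c} ident 𝒢 tr late δ≤½ 0≤y 4y≤1 2yn≤1

  module _ (isBad : State n N → Bool) (m : ℕ) (m≤groups : m ℕ.≤ groups c N) (2n≤R : 2 ℕ.* n ℕ.≤ suc m)
    (many-hits : ∀ i (i< : i ℕ.< groups c N) st → Valid st → isBad st ≡ true →
      fromℕ 48 * (fromℕ n * fromℕ n) ≤ fromℕ (suc m) * Drift.hits isBad i< st) where

    open Drift isBad

    module _ {z κ : ℚ} (0≤z : 0ℚ ≤ z) (Rz≡6n : fromℕ (suc m) * z ≡ fromℕ 6 * fromℕ n)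
      (0≤κ : 0ℚ ≤ κ) (κ[1+z]≡1 : κ * (1ℚ + z) ≡ 1ℚ) where

      κ≤1 : κ ≤ 1ℚ
      κ≤1 = ≤-+ʳ (0≤* 0≤κ 0≤z) (trans (sym κ[1+z]≡1) (identity κ z))
        where
        identity : ∀ κ z → κ * (1ℚ + z) ≡ κ + κ * z
        identity = solve-∀ ℚring

      1-z≤κ : 1ℚ - z ≤ κ
      1-z≤κ = ≤-+ʳ (0≤* 0≤z (p≤q⇒0≤q-p κ≤1)) (trans (identity κ z) (cong (λ e → e - z + z * (1ℚ - κ)) κ[1+z]≡1))
        where
        identity : ∀ κ z → κ ≡ κ * (1ℚ + z) - z + z * (1ℚ - κ)
        identity = solve-∀ ℚring

      z≤yh : ∀ {h} → fromℕ 48 * (fromℕ n * fromℕ n) ≤ fromℕ (suc m) * h → z ≤ y * h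
      z≤yh {h} many = *-cancelˡ (0<fromℕ-suc m) (begin
        fromℕ (suc m) * z                          ≡⟨ Rz≡6n ⟩
        fromℕ 6 * fromℕ n                          ≡⟨ ℚₚ.*-identityʳ (fromℕ 6 * fromℕ n) ⟨
        fromℕ 6 * fromℕ n * 1ℚ                     ≡⟨ cong (fromℕ 6 * fromℕ n *_) y8n≡1 ⟨
        fromℕ 6 * fromℕ n * (y * (fromℕ 8 * fromℕ n)) ≡⟨ identity y (fromℕ n) ⟩
        y * (fromℕ 48 * (fromℕ n * fromℕ n))       ≤⟨ *-monoˡ 0≤y many ⟩
        y * (fromℕ (suc m) * h)                    ≡⟨ *-swap y (fromℕ (suc m)) h ⟩
        fromℕ (suc m) * (y * h)                    ∎)
        where
        open ≤-Reasoning
        identity : ∀ y n → fromℕ 6 * n * (y * (fromℕ 8 * n)) ≡ y * (fromℕ 48 * (n * n))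
        identity = solve-∀ ℚring

      drift : ∀ i (i< : i ℕ.< groups c N) st → Valid st → isBad st ≡ true → 1ℚ - y * hits i< st ≤ κ
      drift i i< st valid b = ≤-trans (ℚₚ.+-monoʳ-≤ 1ℚ (ℚₚ.neg-antimono-≤ (z≤yh {hits i< st} (many-hits i i< st valid b)))) 1-z≤κ

      failure≤1/n : ∀ k → failure 0≤κ drift (suc (k ℕ.+ m)) ≤ 1 // n
      failure≤1/n k = ≤-trans (failure-antitone 0≤κ drift k m) (*-cancelˡ {r = fromℕ n} 0<n (begin
        fromℕ n * failure 0≤κ drift (suc m)    ≡⟨ ℚₚ.*-comm (fromℕ n) (failure 0≤κ drift (suc m)) ⟩
        failure 0≤κ drift (suc m) * fromℕ n    ≤⟨ small-failure n {failure 0≤κ drift (suc m)} {κ ^ m} {(1ℚ + z) ^ m} {a ^ (n ℕ.* n)} (failure-nonNeg 0≤κ drift (suc m)) (½^n≤a^n² {y} n 0≤a y8n≡1)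
                                                    (failure-bound 0≤κ drift m m≤groups) (^-nonNeg {1ℚ + z} m (0≤+ {1ℚ} {z} 0≤1 0≤z))
                                                    (4^n≤[1+z]^m {z} n m 1≤n 2n≤R 0≤z Rz≡6n)
                                                    (≤-reflexive (trans (sym (^-distrib-* κ (1ℚ + z) m)) (trans (cong (_^ m) κ[1+z]≡1) (^-1 m)))) ⟩
        1ℚ                                     ≡⟨ 1//n*n 1≤n ⟨
        (1 // n) * fromℕ n                     ≡⟨ ℚₚ.*-comm (1 // n) (fromℕ n) ⟩
        fromℕ n * (1 // n)                     ∎))
        where
        open ≤-Reasoning
        0<n : 0ℚ < fromℕ n
        0<n = ℚₚ.<-≤-trans 0<1 (fromℕ-mono {1} {n} 1≤n)

    success-probability : ∀ k → 1ℚ - 1 // n ≤ E (execution {δ = δ} ident 𝒢 tr late (suc (k ℕ.+ m))) (λ h → ⟦ not (allBad h) ⟧)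
    success-probability k =
      let z , 0≤z , Rz≡6n = rate-exists n m
          κ , 0≤κ , κ[1+z]≡1 = reciprocal {1ℚ + z} (≤-+ʳ {z} {1ℚ + z} {1ℚ} 0≤z refl)
      in conclude {z} {κ} 0≤z Rz≡6n 0≤κ κ[1+z]≡1
      where
      conclude : ∀ {z κ} → 0ℚ ≤ z → fromℕ (suc m) * z ≡ fromℕ 6 * fromℕ n → 0ℚ ≤ κ → κ * (1ℚ + z) ≡ 1ℚ →
        1ℚ - 1 // n ≤ E (execution {δ = δ} ident 𝒢 tr late (suc (k ℕ.+ m))) (λ h → ⟦ not (allBad h) ⟧)
      conclude {z} {κ} 0≤z Rz≡6n 0≤κ κ[1+z]≡1 = ≤-trans
        (ℚₚ.+-monoʳ-≤ 1ℚ (ℚₚ.neg-antimono-≤ (failure≤1/n {z} {κ} 0≤z Rz≡6n 0≤κ κ[1+z]≡1 k)))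
        (≤-reflexive (success 0≤κ (drift {z} {κ} 0≤z Rz≡6n 0≤κ κ[1+z]≡1) (suc (k ℕ.+ m))))

    succeeds-with : (P : State n N → Set) → (∀ st → isBad st ≡ false → P st) →
      ∀ k → ProbAtLeast (1ℚ - 1 // n) (execution {δ = δ} ident 𝒢 tr late (suc (k ℕ.+ m))) (Any P)
    succeeds-with P good⇒P k = probAtLeast (λ h → not (allBad h)) {execution {δ = δ} ident 𝒢 tr late (suc (k ℕ.+ m))} (¬every⇒Any isBad good⇒P) (success-probability k)

module Main (c cₜ : ℕ) (96≤c : 96 ℕ.≤ c) (1≤cₜ : 1 ℕ.≤ cₜ) (ε : ℝ) (0<ε : 0ℚ <ᴿ ε) (ε<1 : ε ᴿ< 1ℚ)
  (n N : ℕ) (2≤n : 2 ℕ.≤ n) (3≤n : 3 ℕ.≤ n) (n≤N : n ℕ.≤ N) (ident : Fin n → Fin N) (𝒢 : DynamicGraph n)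
  (connected : ∀ i → Connected (𝒢 i)) (α : ℚ) (isα : IsDynamicExpansion 𝒢 α)
  (Δ : ℕ) (degree≤Δ : ∀ i u → degree (𝒢 i) u ℕ.≤ Δ)
  (tr : Transfer N (1 // (n ℕ.^ cₜ))) (late : LateBehavior c n N) (R : ℕ)
  {q ℓ s : ℚ} (ε≤q : ε ᴿ≤ q) (q<1 : q < 1ℚ) (log≤ℓ : Log₂≤ Δ ℓ) (sqrt≤s : Sqrt≤ (fromℕ Δ * ℓ) s)
  (bound : fromℕ 1728 * fromℕ n * s ≤ fromℕ R * ((1ℚ - q) * α))
  {y : ℚ} (0≤y : 0ℚ ≤ y) (y8n≡1 : y * (fromℕ 8 * fromℕ n) ≡ 1ℚ) where

  δ≤½ : 1 // (n ℕ.^ cₜ) ≤ ½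
  δ≤½ = 1//n^k≤½ cₜ 2≤n 1≤cₜ

  open Guarantee {c = c} ident 𝒢 tr late δ≤½ 2≤n {y} 0≤y y8n≡1
  open Expansion 2≤n 𝒢 isα

  2≤Δ : 2 ℕ.≤ Δ
  2≤Δ = 2≤maxDegree 3≤n (𝒢 0) (connected 0) (degree≤Δ 0)
  s-bounds : 1ℚ ≤ s × fromℕ Δ ≤ s * s
  s-bounds = sqrt-bounds 2≤Δ (log-≥1 2≤Δ log≤ℓ) sqrt≤s
  1≤s : 1ℚ ≤ s
  1≤s = proj₁ s-bounds
  0≤s : 0ℚ ≤ s
  0≤s = ≤-trans 0≤1 1≤s
  0≤q : 0ℚ ≤ q
  0≤q = ε≤q 0ℚ 0<ε
  0≤1-q : 0ℚ ≤ 1ℚ - q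
  0≤1-q = p≤q⇒0≤q-p (ℚₚ.<⇒≤ q<1)
  n² : ℚ
  n² = fromℕ n * fromℕ n

  2n≤R : 2 ℕ.* n ℕ.≤ R
  2n≤R = fromℕ-cancel-≤ {2 ℕ.* n} {R} (*-cancelˡ {r = fromℕ 2} (0<fromℕ-suc 1) (begin
    fromℕ 2 * fromℕ (2 ℕ.* n)                 ≡⟨ cong (fromℕ 2 *_) (fromℕ-* 2 n) ⟩
    fromℕ 2 * (fromℕ 2 * fromℕ n)             ≡⟨ ℚₚ.*-assoc (fromℕ 2) (fromℕ 2) (fromℕ n) ⟨
      fromℕ 4 * fromℕ n                         ≤⟨ ≤-+ʳ (0≤* (0≤fromℕ 1724) (0≤fromℕ n)) (trans (cong (λ e → e * fromℕ n * 1ℚ) (fromℕ-+ 4 1724)) (identity (fromℕ 4) (fromℕ 1724) (fromℕ n))) ⟩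
    fromℕ 1728 * fromℕ n * 1ℚ                 ≤⟨ *-monoˡ (0≤* (0≤fromℕ 1728) (0≤fromℕ n)) 1≤s ⟩
    fromℕ 1728 * fromℕ n * s                  ≤⟨ bound ⟩
    fromℕ R * ((1ℚ - q) * α)                  ≤⟨ *-monoˡ (0≤fromℕ R) (*-mono 0≤1-q (0≤fromℕ 2) (≤-+ʳ 0≤q (cancel q)) α≤2) ⟩
    fromℕ R * (1ℚ * (1ℚ + 1ℚ))                ≡⟨ identity′ (fromℕ R) ⟩
    fromℕ 2 * fromℕ R                         ∎))
    where
    open ≤-Reasoning
    identity : ∀ a b n → (a + b) * n * 1ℚ ≡ a * n + b * n
    identity = solve-∀ ℚring
    cancel : ∀ q → 1ℚ ≡ 1ℚ - q + q
    cancel = solve-∀ ℚring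
    identity′ : ∀ r → r * (1ℚ * (1ℚ + 1ℚ)) ≡ fromℕ 2 * r
    identity′ = solve-∀ ℚring

  enough : ∀ {h} → α * (n² * (1ℚ - q)) ≤ fromℕ 36 * s * fromℕ n * h → fromℕ 48 * n² ≤ fromℕ R * h
  enough {h} spread = *-cancelˡ {r = fromℕ 36 * s * fromℕ n} 0<36sn (begin
    fromℕ 36 * s * fromℕ n * (fromℕ 48 * n²)         ≡⟨ trans (identity (fromℕ 36) (fromℕ 48) s (fromℕ n)) (cong (λ e → n² * (e * fromℕ n * s)) (sym (fromℕ-* 36 48))) ⟩
    n² * (fromℕ 1728 * fromℕ n * s)                  ≤⟨ *-monoˡ (0≤* (0≤fromℕ n) (0≤fromℕ n)) bound ⟩
    n² * (fromℕ R * ((1ℚ - q) * α))                  ≡⟨ identity′ n² (fromℕ R) (1ℚ - q) α ⟩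
    fromℕ R * (α * (n² * (1ℚ - q)))                  ≤⟨ *-monoˡ (0≤fromℕ R) spread ⟩
    fromℕ R * (fromℕ 36 * s * fromℕ n * h)           ≡⟨ *-swap (fromℕ R) (fromℕ 36 * s * fromℕ n) h ⟩
    fromℕ 36 * s * fromℕ n * (fromℕ R * h)           ∎)
    where
    open ≤-Reasoning
    0<36sn : 0ℚ < fromℕ 36 * s * fromℕ n
    0<36sn = ℚₚ.<-≤-trans 0<1 (*-mono 0≤1 (0≤fromℕ n) (*-mono 0≤1 0≤s (fromℕ-mono {1} {36} (ℕ.s≤s ℕ.z≤n)) 1≤s) (fromℕ-mono {1} {n} 1≤n))
    identity : ∀ a b s n → a * s * n * (b * (n * n)) ≡ n * n * ((a * b) * n * s)
    identity = solve-∀ ℚring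
    identity′ : ∀ w r q α → w * (r * (q * α)) ≡ r * (α * (w * q))
    identity′ = solve-∀ ℚring

  within-groups : ∀ R′ → R ≡ R′ → R′ ℕ.≤ groups c N → ProbAtLeast (1ℚ - 1 // n) (execution ident 𝒢 tr late R′) (Any (Solved ε ident))
  within-groups zero    eq _   = contradiction (ℕₚ.≤-trans (ℕₚ.*-mono-≤ (ℕ.s≤s (ℕ.z≤n {1})) 1≤n) (subst (2 ℕ.* n ℕ.≤_) eq 2n≤R)) λ ()
  within-groups (suc m) eq m<g = succeeds-with (bad q ident) m (ℕₚ.<⇒≤ m<g) (subst (2 ℕ.* n ℕ.≤_) eq 2n≤R)
    (λ i i< st valid isBad → subst (λ R → fromℕ 48 * n² ≤ fromℕ R * Bits.expectedHits (position c N (Fin.fromℕ< i<)) (position-injective c N (Fin.fromℕ< i<)) st (𝒢 i)) eq (enough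
      (Bits.expectedHits-spread (position c N (Fin.fromℕ< i<)) (position-injective c N (Fin.fromℕ< i<)) st {q} (𝒢 i) {s} {α} {Δ} 1≤s (degree≤Δ i) (proj₂ s-bounds) 0≤α α≤2 (expands i)
        (λ u → ℚₚ.<⇒≤ (ℚₚ.≰⇒> (bad⇒classes-small {q = q} ident st valid isBad u))))))
    (Solved ε ident) (¬bad⇒Solved ε ε≤q ident) 0

  96n²≤groups : 96 ℕ.* (n ℕ.* n) ℕ.≤ groups c N
  96n²≤groups = ℕₚ.*-mono-≤ 96≤c (ℕₚ.*-mono-≤ n≤N n≤N)

  ε≤1 : ε ᴿ≤ 1ℚ
  ε≤1 = <1⇒≤1 ε ε<1

  beyond-groups : ∀ g → groups c N ≡ g → g ℕ.≤ R → ProbAtLeast (1ℚ - 1 // n) (execution ident 𝒢 tr late R) (Any (Solved ε ident))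
  beyond-groups zero    eq _   = contradiction (ℕₚ.≤-trans (ℕₚ.*-mono-≤ (ℕ.s≤s (ℕ.z≤n {95})) (ℕₚ.*-mono-≤ 1≤n 1≤n)) (subst (96 ℕ.* (n ℕ.* n) ℕ.≤_) eq 96n²≤groups)) λ ()
  beyond-groups (suc m) eq m<R =
    let k , eq′ = ℕₚ.m≤n⇒∃[o]m+o≡n m<R in
    subst (λ R → ProbAtLeast (1ℚ - 1 // n) (execution ident 𝒢 tr late R) (Any (Solved ε ident)))
      (trans (cong suc (ℕₚ.+-comm k m)) eq′)
      (succeeds-with (bad 1ℚ ident) m (subst (m ℕ.≤_) (sym eq) (ℕₚ.n≤1+n m)) 2n≤groups
        (λ i i< st valid isBad → many i i< st (bad⇒classes-small {q = 1ℚ} ident st valid isBad))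
        (Solved ε ident) (¬bad⇒Solved ε ε≤1 ident) k)
    where
    96n²≤1+m : 96 ℕ.* (n ℕ.* n) ℕ.≤ suc m
    96n²≤1+m = subst (96 ℕ.* (n ℕ.* n) ℕ.≤_) eq 96n²≤groups
    2n≤groups : 2 ℕ.* n ℕ.≤ suc m
    2n≤groups = ℕₚ.≤-trans (ℕₚ.*-mono-≤ (ℕ.s≤s (ℕ.s≤s (ℕ.z≤n {94}))) (ℕₚ.≤-trans (ℕₚ.≤-reflexive (sym (ℕₚ.*-identityʳ n))) (ℕₚ.*-monoʳ-≤ n 1≤n))) 96n²≤1+m
    first : Fin n
    first = Fin.fromℕ< 1≤n
    many : ∀ i (i< : i ℕ.< groups c N) st → (∀ u → ¬ (1ℚ * fromℕ n ≤ classSize st u)) →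
      fromℕ 48 * n² ≤ fromℕ (suc m) * Bits.expectedHits (position c N (Fin.fromℕ< i<)) (position-injective c N (Fin.fromℕ< i<)) st (𝒢 i)
    many i i< st small = begin
      fromℕ 48 * n²                              ≡⟨ identity (fromℕ n) ⟩
      fromℕ 96 * (fromℕ n * fromℕ n) * ½         ≡⟨ cong (_* ½) (trans (fromℕ-* 96 (n ℕ.* n)) (cong (fromℕ 96 *_) (fromℕ-* n n))) ⟨
      fromℕ (96 ℕ.* (n ℕ.* n)) * ½               ≤⟨ *-mono (0≤fromℕ (96 ℕ.* (n ℕ.* n))) (≤-trans (0≤// 1 2) half≤) (fromℕ-mono {96 ℕ.* (n ℕ.* n)} {suc m} 96n²≤1+m) half≤ ⟩
      fromℕ (suc m) * Bits.expectedHits (position c N (Fin.fromℕ< i<)) (position-injective c N (Fin.fromℕ< i<)) st (𝒢 i) ∎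
      where
      open ≤-Reasoning
      half≤ : ½ ≤ Bits.expectedHits (position c N (Fin.fromℕ< i<)) (position-injective c N (Fin.fromℕ< i<)) st (𝒢 i)
      half≤ =
        let v , first≁v = differing-node st first (small first)
            x , w , xw , x≁w = differing-edge (𝒢 i) st (connected i first v) first≁v
        in Bits.expectedHits-edge (position c N (Fin.fromℕ< i<)) (position-injective c N (Fin.fromℕ< i<)) st (𝒢 i) xw x≁w
      identity : ∀ n → fromℕ 48 * (n * n) ≡ fromℕ 96 * (n * n) * ½
      identity = solve-∀ ℚring

  solved : ProbAtLeast (1ℚ - 1 // n) (execution ident 𝒢 tr late R) (Any (Solved ε ident))
  solved = [ within-groups R refl , beyond-groups (groups c N) refl ]′ (ℕₚ.≤-total R (groups c N))

theorem7p4 : ∃[ C ] ∃[ c₀ ] ∃[ k₀ ] ∃[ n₀ ]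
    ((c cₜ : ℕ) → 1 ℕ.≤ c → c₀ ℕ.≤ c → 1 ℕ.≤ cₜ → k₀ ℕ.≤ cₜ →
    (ε : ℝ) → 0ℚ <ᴿ ε → ε ᴿ< 1ℚ →
    (n N : ℕ) → 1 ℕ.< n → n₀ ℕ.≤ n → n ℕ.≤ N →
    (ident : Fin n → Fin N) → Injective _≡_ _≡_ ident →
    (τ : StabilityFactor) (𝒢 : DynamicGraph n) →
    (∀ i → Connected (𝒢 i)) → Stable τ 𝒢 →
    (α : ℚ) → IsDynamicExpansion 𝒢 α →
    (Δ : ℕ) → IsMaxDegree 𝒢 Δ →
    (transfer : Transfer N (1 // (n ℕ.^ cₜ))) (late : LateBehavior c n N) →
    (R : ℕ) → BoundedBy C n Δ α ε R →
    ProbAtLeast (1ℚ - 1 // n)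
    (execution ident 𝒢 transfer late R)
    (Any (Solved ε ident)))
theorem7p4 = 1728 , 96 , 1 , 3 ,
  λ c cₜ _ 96≤c 1≤cₜ _ ε 0<ε ε<1 n N 2≤n 3≤n n≤N ident _ τ 𝒢 connected _ α isα Δ isΔ tr late R
    (q , ℓ , s , ε≤q , q<1 , log≤ℓ , sqrt≤s , bound) →
    let y , 0≤y , y8n≡1 = unit-exists n (ℕₚ.≤-trans (ℕ.s≤s ℕ.z≤n) 2≤n) in
    Main.solved c cₜ 96≤c 1≤cₜ ε 0<ε ε<1 n N 2≤n 3≤n n≤N ident 𝒢 connected α isα Δ (proj₂ isΔ) tr late R
      ε≤q q<1 log≤ℓ sqrt≤s bound 0≤y y8n≡1
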